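{- Let $W$ be one of the groups $S_n$ ($n\ge 1$), $S^B_n$ ($n \ge 1$), $\widetilde{S}_n$ ($n\ge 2$), or $\widetilde{S}^C_n$ ($n \ge 1$), and let $w\in W$. The following are equivalent: (A) $\mathrm{dis}(w)/2 = \ell_S(w)$; (B) in every reduced word for $w$, for every $i\in[n-1]=\{1,\dots,n-1\}$, between every two copies of the letter $i$ there is a copy of the letter $i-1$ and a copy of the letter $i+1$; (C) $w$ globally avoids the pattern $321$. Moreover, if $W$ is nondegenerate (i.e. $W$ is $S_n$ with $n\ge1$, $S^B_n$ with $n\ge 1$, $\widetilde{S}_n$ with $n\ge 3$, or $\widetilde{S}^C_n$ with $n\ge 2$), these are also equivalent to (B$'$) no reduced word for $w$ contains consecutive letters $i\,(i+1)\,i$ or $i\,(i-1)\,i$ for any $i\in[n-1]$.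
   Context: All groups act by bijections on $\mathbb{Z}$ (or a subset); $n$ is the window size. - $S_n$: permutations of $[n]=\{1,\dots,n\}$. Unfrozen integers: $[n]$. - $S^B_n$: bijections $w$ of $\{ -n,\dots,n\}$ with $w(-i)=-w(i)$ (so $w(0)=0$). Unfrozen integers: $\{\pm1,\dots,\pm n\}$. - $\widetilde{S}_n$: bijections $w:\mathbb{Z}\to\mathbb{Z}$ with $w(i+n)=w(i)+n$ for all $i$ and $\sum_{i=1}^n w(i)=\binom{n+1}{2}$. Unfrozen integers: all of $\mathbb{Z}$. - $\widetilde{S}^C_n$: bijections $w:\mathbb{Z}\to\mathbb{Z}$ with $w(-i)=-w(i)$ and $w(2(n+1)-i)=2(n+1)-w(i)$ for all $i$ (so $w$ fixes every multiple of $n+1$). Unfrozen integers: $\mathbb{Z}\setminus(n+1)\mathbb{Z}$. Integers that are not unfrozen (e.g. $0$ for $S^B_n$, multiples of $n+1$ for $\widetilde{S}^C_n$) are fixed by every element ("frozen"). Generators (simple transpositions), where each transposition is extended to all its images under the symmetries the group respects: $s_i$ swaps $i$ and $i+1$ for $1\le i\le n-1$ (in all four groups); in $\widetilde{S}_n$ additionally $s_0=s_n$ swaps $0$ and $1$ (equivalently $n$ and $n+1$), and letters $0$ and $n$ denote the same generator; in $S^B_n$ and $\widetilde{S}^C_n$ additionally $s_0$ swaps $-1$ and $1$; in $\widetilde{S}^C_n$ additionally $s_n$ swaps $n$ and $n+2$. For instance, in $\widetilde{S}^C_n$, $s_i$ ($1\le i\le n-1$) swaps $i+2k(n+1)\leftrightarrow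 i+1+2k(n+1)$ and $-i+2k(n+1)\leftrightarrow -i-1+2k(n+1)$ for all $k\in\mathbb{Z}$. These form Coxeter generating sets; $\ell_S(w)$ is the minimum length of a word in the generators equal to $w$, and a reduced word for $w$ is a word $i_1\cdots i_\ell$ with $w=s_{i_1}\cdots s_{i_\ell}$ and $\ell=\ell_S(w)$. A letter that does not index a generator of $W$ never occurs. Disarray: $\mathrm{dis}(w)=\sum_{i=1}^n |w(i)-i|$. $w$ globally contains $321$ if there are unfrozen integers $i<j<k$ with $w(i)>w(j)>w(k)$; otherwise $w$ globally avoids $321$. -}

module Defs where

open import Data.Bool using (Bool; true; false; if_then_else_; _∨_)
open import Data.Nat as ℕ using (ℕ; zero; suc; _∸_; _≡ᵇ_)
open import Data.Nat.Combinatorics using (_C_)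
open import Data.Integer as ℤ using (ℤ; +_; -_; ∣_∣)
open import Data.Integer.Divisibility using (_∣_)
open import Data.List using (List; []; _∷_; _++_; length; [_])
open import Data.List.Relation.Unary.All using (All)
open import Data.List.Relation.Unary.Any using (Any)
open import Data.Product using (Σ; ∃; ∃-syntax; _×_; _,_)
open import Data.Sum using (_⊎_)
open import Data.Unit using (⊤)
open import Function.Definitions using (Bijective)
open import Relation.Binary.PropositionalEquality using (_≡_)
open import Relation.Nullary using (¬_; does)

-- The four families of groups.
--   typeA  n : S_n          (finite symmetric group)
--   typeB  n : S^B_n        (signed permutations)
--   typeÃ  n : \tilde S_n   (affine symmetric group)
--   typeC̃  n : \tilde S^C_n (affine type C)
--
-- Uniform encoding: every element is a bijection ℤ → ℤ.  For S_n and
-- S^B_n, a bijection of [n] (resp. {-n..n}) is extended by the identity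
-- outside its domain; this is a bijection-preserving isomorphism.

data Kind : Set where
  typeA typeB typeÃ typeC̃ : Kind

Admissible : Kind → ℕ → Set
Admissible typeA n = 1 ℕ.≤ n
Admissible typeB n = 1 ℕ.≤ n
Admissible typeÃ n = 2 ℕ.≤ n
Admissible typeC̃ n = 1 ℕ.≤ n

Nondegenerate : Kind → ℕ → Set
Nondegenerate typeA n = 1 ℕ.≤ n
Nondegenerate typeB n = 1 ℕ.≤ n
Nondegenerate typeÃ n = 3 ℕ.≤ n
Nondegenerate typeC̃ n = 2 ℕ.≤ n

sumℕ1to : ℕ → (ℕ → ℕ) → ℕ
sumℕ1to zero    f = 0
sumℕ1to (suc n) f = sumℕ1to n f ℕ.+ f (suc n)

sumℤ1to : ℕ → (ℕ → ℤ) → ℤ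
sumℤ1to zero    f = + 0
sumℤ1to (suc n) f = sumℤ1to n f ℤ.+ f (suc n)

InW : Kind → ℕ → (ℤ → ℤ) → Set
InW typeA n w =
  Bijective _≡_ _≡_ w ×
  (∀ x → (x ℤ.< + 1 ⊎ + n ℤ.< x) → w x ≡ x)
InW typeB n w =
  Bijective _≡_ _≡_ w ×
  (∀ x → w (- x) ≡ - w x) ×
  (∀ x → n ℕ.< ∣ x ∣ → w x ≡ x)
InW typeÃ n w =
  Bijective _≡_ _≡_ w ×
  (∀ x → w (x ℤ.+ + n) ≡ w x ℤ.+ + n) ×
  (sumℤ1to n (λ i → w (+ i)) ≡ + ((suc n) C 2))
InW typeC̃ n w =
  Bijective _≡_ _≡_ w ×
  (∀ x → w (- x) ≡ - w x) ×
  (∀ x → w (+ (2 ℕ.* suc n) ℤ.- x) ≡ + (2 ℕ.* suc n) ℤ.- w x)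

Unfrozen : Kind → ℕ → ℤ → Set
Unfrozen typeA n x = + 1 ℤ.≤ x × x ℤ.≤ + n
Unfrozen typeB n x = ¬ (x ≡ + 0) × ∣ x ∣ ℕ.≤ n
Unfrozen typeÃ n x = ⊤
Unfrozen typeC̃ n x = ¬ (+ (suc n) ∣ x)

infix 4 _==_
_==_ : ℤ → ℤ → Bool
x == y = does (x ℤ.≟ y)

cong? : ℕ → ℤ → ℤ → Bool
cong? zero    x y = x == y
cong? (suc m) x y = (x ℤ.- y) ℤ.%ℕ suc m ≡ᵇ 0

ValidLetter : Kind → ℕ → ℕ → Set
ValidLetter typeA n a = 1 ℕ.≤ a × a ℕ.≤ n ∸ 1
ValidLetter typeB n a = a ℕ.≤ n ∸ 1
ValidLetter typeÃ n a = a ℕ.≤ n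
ValidLetter typeC̃ n a = a ℕ.≤ n

-- the action of generator s_a (only meaningful for valid letters a;
-- invalid letters never occur in words, see `Valid`)
gen : Kind → ℕ → ℕ → ℤ → ℤ
gen typeA n a x =
  if x == + a then + (suc a)
  else if x == + (suc a) then + a
  else x
gen typeB n zero x =
  if x == + 1 then - + 1
  else if x == - + 1 then + 1
  else x
gen typeB n (suc i) x =
  if x == + (suc i) then + (suc (suc i))
  else if x == + (suc (suc i)) then + (suc i)
  else if x == - + (suc i) then - + (suc (suc i))
  else if x == - + (suc (suc i)) then - + (suc i)
  else x
-- \tilde S_n: s_a swaps a+kn and a+1+kn for all k (s_0 = s_n)
gen typeÃ n a x =
  if cong? n x (+ a) then x ℤ.+ + 1
  else if cong? n x (+ (suc a)) then x ℤ.- + 1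
  else x
gen typeC̃ n zero x =
  if cong? (2 ℕ.* suc n) x (+ 1) then x ℤ.- + 2
  else if cong? (2 ℕ.* suc n) x (- + 1) then x ℤ.+ + 2
  else x
gen typeC̃ n (suc i) x =
  if does (suc i ℕ.≟ n) then
    (if cong? (2 ℕ.* suc n) x (+ n) then x ℤ.+ + 2
     else if cong? (2 ℕ.* suc n) x (+ (suc (suc n))) then x ℤ.- + 2
     else x)
  else
    (if cong? (2 ℕ.* suc n) x (+ (suc i)) then x ℤ.+ + 1
     else if cong? (2 ℕ.* suc n) x (+ (suc (suc i))) then x ℤ.- + 1
     else if cong? (2 ℕ.* suc n) x (- + (suc i)) then x ℤ.- + 1
     else if cong? (2 ℕ.* suc n) x (- + (suc (suc i))) then x ℤ.+ + 1
     else x)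

Word : Set
Word = List ℕ

Valid : Kind → ℕ → Word → Set
Valid k n ws = All (ValidLetter k n) ws

eval : Kind → ℕ → Word → ℤ → ℤ
eval k n []       x = x
eval k n (a ∷ ws) x = gen k n a (eval k n ws x)

Represents : Kind → ℕ → (ℤ → ℤ) → Word → Set
Represents k n w ws = Valid k n ws × (∀ x → eval k n ws x ≡ w x)

ReducedWord : Kind → ℕ → (ℤ → ℤ) → Word → Set
ReducedWord k n w ws =
  Represents k n w ws ×
  (∀ vs → Represents k n w vs → length ws ℕ.≤ length vs)

HasLength : Kind → ℕ → (ℤ → ℤ) → ℕ → Set
HasLength k n w ℓ = ∃[ ws ] (ReducedWord k n w ws × length ws ≡ ℓ)

-- letters denoting the same generator (in \tilde S_n, letters 0 and n
-- denote the same generator)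
SameLetter : Kind → ℕ → ℕ → ℕ → Set
SameLetter typeÃ n a b = (a ≡ b) ⊎ (a ≡ 0 × b ≡ n) ⊎ (a ≡ n × b ≡ 0)
SameLetter typeA n a b = a ≡ b
SameLetter typeB n a b = a ≡ b
SameLetter typeC̃ n a b = a ≡ b

dis : ℕ → (ℤ → ℤ) → ℕ
dis n w = sumℕ1to n (λ i → ∣ w (+ i) ℤ.- + i ∣)

Contains321 : Kind → ℕ → (ℤ → ℤ) → Set
Contains321 k n w =
  ∃[ i ] ∃[ j ] ∃[ l ]
    (Unfrozen k n i × Unfrozen k n j × Unfrozen k n l ×
     i ℤ.< j × j ℤ.< l × w j ℤ.< w i × w l ℤ.< w j)

Avoids321 : Kind → ℕ → (ℤ → ℤ) → Set
Avoids321 k n w = ¬ Contains321 k n w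

CondA : Kind → ℕ → (ℤ → ℤ) → Set
CondA k n w = ∃[ ℓ ] (HasLength k n w ℓ × dis n w ≡ 2 ℕ.* ℓ)

BetweenCopies : Kind → ℕ → Word → ℕ → Set
BetweenCopies k n ws i =
  ∀ p a m b s → ws ≡ p ++ [ a ] ++ m ++ [ b ] ++ s →
  SameLetter k n a i → SameLetter k n b i →
  Any (λ c → SameLetter k n c (i ∸ 1)) m ×
  Any (λ c → SameLetter k n c (suc i)) m

CondB : Kind → ℕ → (ℤ → ℤ) → Set
CondB k n w =
  ∀ ws → ReducedWord k n w ws →
  ∀ i → 1 ℕ.≤ i → i ℕ.≤ n ∸ 1 → BetweenCopies k n ws i

CondB' : Kind → ℕ → (ℤ → ℤ) → Set
CondB' k n w =
  ∀ ws → ReducedWord k n w ws →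
  ∀ i → 1 ℕ.≤ i → i ℕ.≤ n ∸ 1 →
  ¬ (∃[ p ] ∃[ a ] ∃[ b ] ∃[ c ] ∃[ s ]
       (ws ≡ p ++ a ∷ b ∷ c ∷ s × SameLetter k n a i × SameLetter k n c i ×
        (SameLetter k n b (suc i) ⊎ SameLetter k n b (i ∸ 1))))

{-# OPTIONS --safe #-}

-- All four groups consist of bijections of ℤ that commute with translations by a period (0 for the
-- finite groups) and, in types B and C̃, with reflections; a generator swaps the symmetric images of
-- one pair p < q of adjacent unfrozen integers. Right multiplication by it raises the disarray by at
-- most 2, with equality exactly when w(p) ≤ p and q ≤ w(q) ("tight"), so dis(w)/2 = ℓ(w) iff every step
-- of a reduced word is tight.
--
-- As many integers are moved up across a cut as down. At a descent of a 321-avoiding element that is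
-- not undone by a tight step this flow would supply a third entry of a pattern, so sorting such an
-- element takes dis(w)/2 steps; by the same argument a tight step creates no pattern. Between two tight
-- occurrences of s_i the values at i and at i + 1 must both have been changed by other letters, which
-- are s_{i-1} and s_{i+1}.
--
-- Conversely, take a shortest element with a pattern and no braid i (i±1) i in a reduced word. By the
-- exchange property every pattern (i , j , l) has (i , j) or (j , l) swapped by any given descent.
-- Choosing the last entry before j above w(j), and the first one after j below w(j), yields either
-- three consecutive decreasing entries, hence a braid, or a pair and its mirror image under the same
-- generator with adjacent inner entries, hence a braid again.

module Submission where

open import Defs
open import Data.Bool using (Bool; true; false; T; if_then_else_; _∧_; _∨_)
open import Data.Empty using (⊥; ⊥-elim)
open import Data.Fin using (Fin; zero; suc)
open import Data.Integer using (ℤ; +_; -[1+_]; -_; _+_; _-_; _*_; _≤_; _<_; ∣_∣; +≤+; -≤+; _≟_; _≤?_; _<?_)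
import Data.Integer as ℤ
open import Data.Integer.DivMod using (_%ℕ_; _/ℕ_; a≡a%ℕn+[a/ℕn]*n; n%ℕd<d)
open import Data.Integer.Divisibility using (_∣_)
import Data.Integer.Divisibility.Signed as Signed
open import Data.Integer.Properties
open import Data.Integer.Tactic.RingSolver using (solve-∀)
open import Data.List using (List; []; _∷_; _++_; length)
import Data.List.Properties as List
open import Data.List.Relation.Unary.All using (All; []; _∷_)
import Data.List.Relation.Unary.All.Properties as All
open import Data.List.Relation.Unary.Any using (Any; any?; here)
open import Data.Nat as ℕ using (ℕ; zero; suc; _∸_; _≡ᵇ_; z≤n; s≤s)
open import Data.Nat.Combinatorics using (_C_; nC1≡n; nCk+nC[k+1]≡[n+1]C[k+1])
open import Data.Nat.Divisibility using (_∣?_)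
import Data.Nat.Properties as ℕ
import Data.Nat.Tactic.RingSolver as ℕSolver
open import Data.Product using (∃-syntax; _×_; _,_; proj₁; proj₂)
open import Data.Sum using (_⊎_; inj₁; inj₂; [_,_]′)
open import Data.Unit using (⊤; tt)
open import Data.Vec using (Vec; []; _∷_; lookup; tail; zipWith)
open import Function using (_∘_)
open import Function.Bundles using (_⇔_; mk⇔)
open import Relation.Binary using (tri<; tri≈; tri>)
open import Relation.Binary.PropositionalEquality
open import Relation.Nullary using (¬_; Dec; yes; no; does; proof; contradiction)
open import Relation.Nullary.Decidable using (_×-dec_; _⊎-dec_; ¬?; dec-true; dec-false)
open import Relation.Nullary.Reflects using (Reflects; ofʸ; ofⁿ)

-- Linear integer arithmetic by Fourier–Motzkin elimination

-- Since elements commute with the symmetries, a condition on a generator is checked at one of its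
-- pairs and transported to the orbit. The change of a sum over the window is computed once for an
-- arbitrary displacement function and used three times: the identity serves the normalisation of
-- affine permutations, the absolute value the disarray, and the square the termination of sorting.
-- The square is needed because a descent can leave the disarray unchanged: 321 and 231 both have
-- disarray 4. (B) returns to (C) only through (B'), so the degenerate groups need an argument of
-- their own. The obstacle in types B and C̃ is that one generator can swap two different pairs
-- inside the same pattern, one the mirror image of the other. The reduction to three consecutive
-- entries then fails.

infixl 7 _⊕_ _⊖_
infixl 8 _⊛_
data Expr (n : ℕ) : Set where
  var     : Fin n → Expr n
  con     : ℤ → Expr n
  _⊕_ _⊖_ : Expr n → Expr n → Expr n
  ⊝_      : Expr n → Expr n
  _⊛_     : ℤ → Expr n → Expr n

⟦_⟧ : ∀ {n} → Expr n → Vec ℤ n → ℤ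
⟦ var i ⟧ ρ = lookup ρ i
⟦ con c ⟧ ρ = c
⟦ e ⊕ f ⟧ ρ = ⟦ e ⟧ ρ + ⟦ f ⟧ ρ
⟦ e ⊖ f ⟧ ρ = ⟦ e ⟧ ρ - ⟦ f ⟧ ρ
⟦ ⊝ e ⟧ ρ = - ⟦ e ⟧ ρ
⟦ c ⊛ e ⟧ ρ = c * ⟦ e ⟧ ρ

-- A form lists the coefficients of the variables, followed by the constant term.
Form : ℕ → Set
Form n = Vec ℤ (suc n)

value : ∀ {n} → Form n → Vec ℤ n → ℤ
value {zero}  (c ∷ []) []      = c
value {suc n} (c ∷ f)  (x ∷ ρ) = c * x + value f ρ

combine : ∀ {n} → ℤ → Vec ℤ n → ℤ → Vec ℤ n → Vec ℤ n
combine s f t g = zipWith (λ a b → s * a + t * b) f g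

constant : ∀ n → ℤ → Form n
constant zero    c = c ∷ []
constant (suc n) c = + 0 ∷ constant n c

unit : ∀ {n} → Fin n → Form n
unit zero    = + 1 ∷ constant _ (+ 0)
unit (suc i) = + 0 ∷ unit i

normalise : ∀ {n} → Expr n → Form n
normalise (var i) = unit i
normalise (con c) = constant _ c
normalise (e ⊕ f) = combine (+ 1) (normalise e) (+ 1) (normalise f)
normalise (e ⊖ f) = combine (+ 1) (normalise e) (-[1+ 0 ]) (normalise f)
normalise (⊝ e)   = combine (-[1+ 0 ]) (normalise e) (+ 0) (normalise e)
normalise (c ⊛ e) = combine c (normalise e) (+ 0) (normalise e)

value-combine : ∀ {n} s (f : Form n) t g ρ →
  value (combine s f t g) ρ ≡ s * value f ρ + t * value g ρ
value-combine {zero}  s (a ∷ []) t (b ∷ []) [] = refl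
value-combine {suc n} s (a ∷ f) t (b ∷ g) (x ∷ ρ) =
  trans (cong (λ v → (s * a + t * b) * x + v) (value-combine s f t g ρ))
        (rearrange s a t b x (value f ρ) (value g ρ))
  where
  rearrange : ∀ s a t b x F G →
    (s * a + t * b) * x + (s * F + t * G) ≡ s * (a * x + F) + t * (b * x + G)
  rearrange = solve-∀

value-constant : ∀ {n} c (ρ : Vec ℤ n) → value (constant n c) ρ ≡ c
value-constant c []      = refl
value-constant c (x ∷ ρ) = trans (+-identityˡ _) (value-constant c ρ)

value-unit : ∀ {n} (i : Fin n) ρ → value (unit i) ρ ≡ lookup ρ i
value-unit zero    (x ∷ ρ) =
  trans (cong₂ _+_ (*-identityˡ x) (value-constant (+ 0) ρ)) (+-identityʳ x)
value-unit (suc i) (x ∷ ρ) = trans (+-identityˡ _) (value-unit i ρ)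

value-normalise : ∀ {n} (e : Expr n) ρ → value (normalise e) ρ ≡ ⟦ e ⟧ ρ
value-normalise (var i) ρ = value-unit i ρ
value-normalise (con c) ρ = value-constant c ρ
value-normalise (e ⊕ f) ρ
  rewrite value-combine (+ 1) (normalise e) (+ 1) (normalise f) ρ
        | value-normalise e ρ | value-normalise f ρ
  = cong₂ _+_ (*-identityˡ (⟦ e ⟧ ρ)) (*-identityˡ (⟦ f ⟧ ρ))
value-normalise (e ⊖ f) ρ
  rewrite value-combine (+ 1) (normalise e) -[1+ 0 ] (normalise f) ρ
        | value-normalise e ρ | value-normalise f ρ
  = cong₂ _+_ (*-identityˡ (⟦ e ⟧ ρ)) (-1*i≡-i (⟦ f ⟧ ρ))
value-normalise (⊝ e) ρ
  rewrite value-combine -[1+ 0 ] (normalise e) (+ 0) (normalise e) ρ | value-normalise e ρ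
  = trans (+-identityʳ _) (-1*i≡-i (⟦ e ⟧ ρ))
value-normalise (c ⊛ e) ρ
  rewrite value-combine c (normalise e) (+ 0) (normalise e) ρ | value-normalise e ρ
  = +-identityʳ _

NonNeg : ∀ {n} → Vec ℤ n → Form n → Set
NonNeg ρ f = + 0 ≤ value f ρ

-- Positive multiples of the two forms cancel the first variable. Only the order positive, negative
-- is matched, since `eliminate` runs over all ordered pairs and would otherwise produce each
-- combination twice.
resolve : ∀ {n} → Form (suc n) → Form (suc n) → List (Form n)
resolve (+ suc a ∷ f) (-[1+ b ] ∷ g) = combine (+ suc b) f (+ suc a) g ∷ []
resolve _ _ = []

resolveAll : ∀ {n} → Form (suc n) → List (Form (suc n)) → List (Form n)
resolveAll f []       = []
resolveAll f (g ∷ gs) = resolve f g ++ resolveAll f gs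

independent : ∀ {n} → Form (suc n) → List (Form n)
independent (+ 0 ∷ f) = f ∷ []
independent _         = []

eliminate : ∀ {n} → List (Form (suc n)) → List (Form (suc n)) → List (Form n)
eliminate []       all = []
eliminate (f ∷ fs) all = independent f ++ (resolveAll f all ++ eliminate fs all)

negative : Form 0 → Bool
negative (-[1+ _ ] ∷ []) = true
negative _               = false

refutes : ∀ {n} → List (Form n) → Bool
refutes {zero}  []       = false
refutes {zero}  (f ∷ fs) = negative f ∨ refutes fs
refutes {suc n} fs       = refutes (eliminate fs fs)

0≤* : ∀ a {i} → + 0 ≤ i → + 0 ≤ + a * i
0≤* a {i} p = subst (_≤ + a * i) (*-zeroʳ (+ a)) (*-monoˡ-≤-nonNeg (+ a) p)

resolve-sound : ∀ {n} (f g : Form (suc n)) {ρ} →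
  NonNeg ρ f → NonNeg ρ g → All (NonNeg (tail ρ)) (resolve f g)
resolve-sound (+ suc a ∷ f) (-[1+ b ] ∷ g) {x ∷ ρ} p q =
  subst (+ 0 ≤_)
    (trans (cancel (+ suc a) (+ suc b) x (value f ρ) (value g ρ))
           (sym (value-combine (+ suc b) f (+ suc a) g ρ)))
    (+-mono-≤ (0≤* (suc b) p) (0≤* (suc a) q)) ∷ []
  where
  cancel : ∀ a b x F G → b * (a * x + F) + a * ((- b) * x + G) ≡ b * F + a * G
  cancel = solve-∀
resolve-sound (+ zero ∷ f) g p q = []
resolve-sound (+ suc a ∷ f) (+ b ∷ g) p q = []
resolve-sound (-[1+ a ] ∷ f) g p q = []

resolveAll-sound : ∀ {n} (f : Form (suc n)) gs {ρ} →
  NonNeg ρ f → All (NonNeg ρ) gs → All (NonNeg (tail ρ)) (resolveAll f gs)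
resolveAll-sound f []       p []       = []
resolveAll-sound f (g ∷ gs) p (q ∷ qs) =
  All.++⁺ (resolve-sound f g p q) (resolveAll-sound f gs p qs)

independent-sound : ∀ {n} (f : Form (suc n)) {ρ} →
  NonNeg ρ f → All (NonNeg (tail ρ)) (independent f)
independent-sound (+ 0 ∷ f) {x ∷ ρ} p = subst (+ 0 ≤_) (+-identityˡ _) p ∷ []
independent-sound (+ suc _ ∷ f) p = []
independent-sound (-[1+ _ ] ∷ f) p = []

eliminate-sound : ∀ {n} (fs all : List (Form (suc n))) {ρ} →
  All (NonNeg ρ) fs → All (NonNeg ρ) all → All (NonNeg (tail ρ)) (eliminate fs all)
eliminate-sound []       all []       qs = []
eliminate-sound (f ∷ fs) all (p ∷ ps) qs =
  All.++⁺ (independent-sound f p)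
    (All.++⁺ (resolveAll-sound f all p qs) (eliminate-sound fs all ps qs))

refutes-sound : ∀ {n} (fs : List (Form n)) ρ → T (refutes fs) → All (NonNeg ρ) fs → ⊥
refutes-sound {zero} ((-[1+ _ ] ∷ []) ∷ fs) [] t (() ∷ ps)
refutes-sound {zero} ((+ _ ∷ []) ∷ fs) [] t (p ∷ ps) = refutes-sound fs [] t ps
refutes-sound {suc n} fs ρ t ps =
  refutes-sound (eliminate fs fs) (tail ρ) t (eliminate-sound fs fs ps ps)

infix 6 _≼_ _≺_ _≈_
data Atom (n : ℕ) : Set where
  _≼_ _≺_ _≈_ : Expr n → Expr n → Atom n
  absurd      : Atom n

Holds : ∀ {n} → Vec ℤ n → Atom n → Set
Holds ρ (e ≼ f) = ⟦ e ⟧ ρ ≤ ⟦ f ⟧ ρ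
Holds ρ (e ≺ f) = ⟦ e ⟧ ρ < ⟦ f ⟧ ρ
Holds ρ (e ≈ f) = ⟦ e ⟧ ρ ≡ ⟦ f ⟧ ρ
Holds ρ absurd  = ⊥

-- The singleton case is separate so that one hypothesis is passed as it stands and several as a
-- plain tuple, without a trailing unit.
HoldAll : ∀ {n} → Vec ℤ n → List (Atom n) → Set
HoldAll ρ []             = ⊤
HoldAll ρ (a ∷ [])       = Holds ρ a
HoldAll ρ (a ∷ as@(_ ∷ _)) = Holds ρ a × HoldAll ρ as

-- Over the integers `e ≺ f` means that `f - e - 1` is nonnegative. Integrality enters here; the
-- elimination afterwards is the rational one.
forms : ∀ {n} → Atom n → List (Form n)
forms (e ≼ f) = normalise (f ⊖ e) ∷ []
forms (e ≺ f) = normalise (f ⊖ e ⊖ con (+ 1)) ∷ []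
forms (e ≈ f) = normalise (f ⊖ e) ∷ normalise (e ⊖ f) ∷ []
forms absurd  = []

formsAll : ∀ {n} → List (Atom n) → List (Form n)
formsAll []       = []
formsAll (a ∷ as) = forms a ++ formsAll as

-- The negated goal joins the hypotheses. An equation has two negations, one for each strict order,
-- and both must be refuted. Nonlinear terms, such as values of `w`, enter as variables through the
-- environment.
derives : ∀ {n} → List (Atom n) → Atom n → Bool
derives as (e ≼ f) = refutes (forms (f ≺ e) ++ formsAll as)
derives as (e ≺ f) = refutes (forms (f ≼ e) ++ formsAll as)
derives as (e ≈ f) = refutes (forms (f ≺ e) ++ formsAll as)
  ∧ refutes (forms (e ≺ f) ++ formsAll as)
derives as absurd  = refutes (formsAll as)

≤-forms : ∀ {n} (e f : Expr n) ρ → Holds ρ (e ≼ f) → NonNeg ρ (normalise (f ⊖ e))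
≤-forms e f ρ p = subst (+ 0 ≤_) (sym (value-normalise (f ⊖ e) ρ)) (i≤j⇒0≤j-i p)

forms-sound : ∀ {n} (a : Atom n) ρ → Holds ρ a → All (NonNeg ρ) (forms a)
forms-sound (e ≼ f) ρ p = ≤-forms e f ρ p ∷ []
forms-sound (e ≺ f) ρ p =
  subst (+ 0 ≤_) (sym (value-normalise (f ⊖ e ⊖ con (+ 1)) ρ))
    (subst (+ 0 ≤_) (shift (⟦ f ⟧ ρ) (⟦ e ⟧ ρ)) (i≤j⇒0≤j-i (i<j⇒suc[i]≤j p))) ∷ []
  where
  shift : ∀ x y → x - (+ 1 + y) ≡ x - y - + 1
  shift = solve-∀
forms-sound (e ≈ f) ρ p =
  ≤-forms e f ρ (≤-reflexive p) ∷ ≤-forms f e ρ (≤-reflexive (sym p)) ∷ []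
forms-sound absurd ρ ()

formsAll-sound : ∀ {n} (as : List (Atom n)) ρ → HoldAll ρ as → All (NonNeg ρ) (formsAll as)
formsAll-sound []       ρ hs       = []
formsAll-sound (a ∷ []) ρ h        = All.++⁺ (forms-sound a ρ h) []
formsAll-sound (a ∷ as@(_ ∷ _)) ρ (h , hs) = All.++⁺ (forms-sound a ρ h) (formsAll-sound as ρ hs)

refute-with : ∀ {n} (b : Atom n) as ρ → T (refutes (forms b ++ formsAll as)) →
  HoldAll ρ as → Holds ρ b → ⊥
refute-with b as ρ t hs h =
  refutes-sound _ ρ t (All.++⁺ (forms-sound b ρ h) (formsAll-sound as ρ hs))

-- Opaque because a with-abstraction would otherwise normalise the elimination.
abstract
  lin : ∀ {n} (as : List (Atom n)) (g : Atom n) (ρ : Vec ℤ n) {_ : T (derives as g)} →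
    HoldAll ρ as → Holds ρ g
  lin as (e ≼ f) ρ {t} hs = ≮⇒≥ (refute-with (f ≺ e) as ρ t hs)
  lin as (e ≺ f) ρ {t} hs = ≰⇒> (refute-with (f ≼ e) as ρ t hs)
  lin as (e ≈ f) ρ {t} hs with refutes (forms (f ≺ e) ++ formsAll as) in eq
  ... | true = ≤-antisym
    (≮⇒≥ (refute-with (f ≺ e) as ρ (subst T (sym eq) tt) hs))
    (≮⇒≥ (refute-with (e ≺ f) as ρ t hs))
  lin as absurd ρ {t} hs = refutes-sound _ ρ t (formsAll-sound as ρ hs)

𝕒 : ∀ {n} → Expr (1 ℕ.+ n)
𝕒 = var zero
𝕓 : ∀ {n} → Expr (2 ℕ.+ n)
𝕓 = var (suc zero)
𝕔 : ∀ {n} → Expr (3 ℕ.+ n)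
𝕔 = var (suc (suc zero))
𝕕 : ∀ {n} → Expr (4 ℕ.+ n)
𝕕 = var (suc (suc (suc zero)))
𝕖 : ∀ {n} → Expr (5 ℕ.+ n)
𝕖 = var (suc (suc (suc (suc zero))))
𝕗 : ∀ {n} → Expr (6 ℕ.+ n)
𝕗 = var (suc (suc (suc (suc (suc zero)))))
𝕘 : ∀ {n} → Expr (7 ℕ.+ n)
𝕘 = var (suc (suc (suc (suc (suc (suc zero))))))

-- Congruence modulo a period, where modulus 0 stands for equality

Multiple : ℕ → ℤ → Set
Multiple p c = ∃[ t ] c ≡ t * + p

multiple-≡ : ∀ {p c d} → c ≡ d → Multiple p c → Multiple p d
multiple-≡ = subst (Multiple _)

multiple-0 : ∀ {p} → Multiple p (+ 0)
multiple-0 = + 0 , refl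

multiple-self : ∀ {p} → Multiple p (+ p)
multiple-self = + 1 , sym (*-identityˡ _)

multiple-neg : ∀ {p c} → Multiple p c → Multiple p (- c)
multiple-neg (t , refl) = - t , neg-distribˡ-* t _

multiple-+ : ∀ {p c d} → Multiple p c → Multiple p d → Multiple p (c + d)
multiple-+ {p} (t , refl) (u , refl) = t + u , sym (*-distribʳ-+ (+ p) t u)

multiple-∸ : ∀ {p c d} → Multiple p c → Multiple p d → Multiple p (c - d)
multiple-∸ m m′ = multiple-+ m (multiple-neg m′)

multiple-of-0 : ∀ {c} → Multiple 0 c → c ≡ + 0
multiple-of-0 (t , eq) = trans eq (*-zeroʳ t)

multiple-small : ∀ {p c} → Multiple p c → c < + p → - + p < c → c ≡ + 0
multiple-small (+ zero , eq) _ _ = eq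
multiple-small {p} {c} (+ suc m , eq) c<p _ = ⊥-elim
  (lin (𝕒 ≈ 𝕓 ∷ 𝕓 ≈ 𝕔 ⊕ 𝕕 ∷ con (+ 0) ≼ 𝕕 ∷ 𝕒 ≺ 𝕔 ∷ []) absurd
    (c ∷ + suc m * + p ∷ + p ∷ + m * + p ∷ [])
    (eq , [1+m]*n≡n+m*n m (+ p) , 0≤* m (+≤+ ℕ.z≤n) , c<p))
  where
  [1+m]*n≡n+m*n : ∀ m n → + suc m * n ≡ n + + m * n
  [1+m]*n≡n+m*n m n = suc-* (+ m) n
multiple-small {p} {c} (-[1+ m ] , eq) _ -p<c = ⊥-elim
  (lin (𝕒 ≈ 𝕓 ∷ 𝕓 ≈ ⊝ (𝕔 ⊕ 𝕕) ∷ con (+ 0) ≼ 𝕕 ∷ ⊝ 𝕔 ≺ 𝕒 ∷ []) absurd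
    (c ∷ -[1+ m ] * + p ∷ + p ∷ + m * + p ∷ [])
    (eq , trans (sym (neg-distribˡ-* (+ suc m) (+ p))) (cong -_ (suc-* (+ m) (+ p)))
        , 0≤* m (+≤+ ℕ.z≤n) , -p<c))

remainder-reflects : ∀ m c → Reflects (Multiple (suc m) c) (c %ℕ suc m ≡ᵇ 0)
remainder-reflects m c with c %ℕ suc m in eq | a≡a%ℕn+[a/ℕn]*n c (suc m) | n%ℕd<d c (suc m)
... | zero  | c≡ | _ = ofʸ (c /ℕ suc m , trans c≡ (+-identityˡ _))
... | suc r | c≡ | r< = ofⁿ λ mult → contradiction
  (multiple-small {suc m} {+ suc r}
    (subst (Multiple (suc m))
      (lin (𝕒 ≈ 𝕓 ⊕ 𝕔 ∷ []) (𝕒 ⊖ 𝕔 ≈ 𝕓) (c ∷ + suc r ∷ c /ℕ suc m * + suc m ∷ []) c≡)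
      (multiple-∸ mult (c /ℕ suc m , refl)))
    (ℤ.+<+ r<) ℤ.-<+)
  λ ()

cong?-reflects : ∀ p x y → Reflects (Multiple p (x - y)) (cong? p x y)
cong?-reflects zero x y with x ≟ y
... | yes x≡y = ofʸ (subst (Multiple 0) (lin (𝕒 ≈ 𝕓 ∷ []) (con (+ 0) ≈ 𝕒 ⊖ 𝕓) (x ∷ y ∷ []) x≡y) multiple-0)
... | no x≢y = ofⁿ λ m →
  x≢y (lin (𝕒 ⊖ 𝕓 ≈ con (+ 0) ∷ []) (𝕒 ≈ 𝕓) (x ∷ y ∷ []) (multiple-of-0 m))
cong?-reflects (suc m) x y = remainder-reflects m (x - y)

-- The symmetries of each group and the pairs swapped by a generator

period : Kind → ℕ → ℕ
period typeA n = 0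
period typeB n = 0
period typeÃ n = n
period typeC̃ n = 2 ℕ.* suc n

Reflective : Kind → Set
Reflective typeA = ⊥
Reflective typeB = ⊤
Reflective typeÃ = ⊥
Reflective typeC̃ = ⊤

-- The elements of the group commute with the symmetries x ↦ x + c for c in Tr, and
-- x ↦ c - x for c in Rf.
Tr Rf : Kind → ℕ → ℤ → Set
Tr k n c = Multiple (period k n) c
Rf k n c = Reflective k × Tr k n c

lo : Kind → ℕ → ℤ
lo typeA a       = + a
lo typeB zero    = - + 1
lo typeB (suc a) = + suc a
lo typeÃ a       = + a
lo typeC̃ zero    = - + 1
lo typeC̃ (suc a) = + suc a

gap : Kind → ℕ → ℕ → ℤ
gap typeA n a       = + 1
gap typeB n zero    = + 2
gap typeB n (suc a) = + 1
gap typeÃ n a       = + 1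
gap typeC̃ n zero    = + 2
gap typeC̃ n (suc a) = if does (suc a ℕ.≟ n) then + 2 else + 1

-- The symmetric images (x , x + g) of the pair (l , l + g), given by their lower ends; a generator
-- swaps the pairs of one orbit.
data Orbit (k : Kind) (n : ℕ) (l g x : ℤ) : Set where
  translate : Tr k n (x - l) → Orbit k n l g x
  reflect   : Rf k n (x + (l + g)) → Orbit k n l g x

Lower : Kind → ℕ → ℕ → ℤ → Set
Lower k n a = Orbit k n (lo k a) (gap k n a)

data GenView (k : Kind) (n : ℕ) (l g x : ℤ) : ℤ → Set where
  up    : Orbit k n l g x → GenView k n l g x (x + g)
  down  : Orbit k n l g (x - g) → GenView k n l g x (x - g)
  still : ¬ Orbit k n l g x → ¬ Orbit k n l g (x - g) → GenView k n l g x x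

double : ∀ n → + (2 ℕ.* suc n) ≡ + n + + n + + 2
double n = lin (𝕒 ≈ con (+ 1) ⊕ 𝕓 ⊕ (con (+ 1) ⊕ 𝕓 ⊕ con (+ 0)) ∷ []) (𝕒 ≈ 𝕓 ⊕ 𝕓 ⊕ con (+ 2))
  (+ (2 ℕ.* suc n) ∷ + n ∷ []) refl

-- This trades the nested tests of `gen` for membership in one orbit of pairs, so that later
-- arguments about the action need not distinguish the four groups. A pair across a mirror is its
-- own reflection, and both constructors of `Orbit` then come down to the same test.
gen-view : ∀ k n a x → GenView k n (lo k a) (gap k n a) x (gen k n a x)
gen-view typeA n a x
  with x == + a | cong?-reflects 0 x (+ a) | x == + suc a | cong?-reflects 0 x (+ suc a)
... | true | ofʸ m | _ | _ =
  subst (GenView _ _ _ _ _)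
    (lin (𝕒 ⊖ 𝕓 ≈ con (+ 0) ∷ []) (𝕒 ⊕ con (+ 1) ≈ con (+ 1) ⊕ 𝕓) (x ∷ + a ∷ []) (multiple-of-0 m))
    (up (translate m))
... | false | ofⁿ ¬m | true | ofʸ m =
  subst (GenView _ _ _ _ _)
    (lin (𝕒 ⊖ (con (+ 1) ⊕ 𝕓) ≈ con (+ 0) ∷ []) (𝕒 ⊖ con (+ 1) ≈ 𝕓) (x ∷ + a ∷ []) (multiple-of-0 m))
    (down (translate (multiple-≡ (lin [] (𝕒 ⊖ (con (+ 1) ⊕ 𝕓) ≈ 𝕒 ⊖ con (+ 1) ⊖ 𝕓) (x ∷ + a ∷ []) tt) m)))
... | false | ofⁿ ¬m | false | ofⁿ ¬m′ = still
  (λ { (translate m) → ¬m m })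
  (λ { (translate m) → ¬m′ (multiple-≡ (lin [] (𝕒 ⊖ con (+ 1) ⊖ 𝕓 ≈ 𝕒 ⊖ (con (+ 1) ⊕ 𝕓)) (x ∷ + a ∷ []) tt) m) })
gen-view typeÃ n a x
  with cong? n x (+ a) | cong?-reflects n x (+ a) | cong? n x (+ suc a) | cong?-reflects n x (+ suc a)
... | true | ofʸ m | _ | _ = up (translate m)
... | false | ofⁿ ¬m | true | ofʸ m =
  down (translate (multiple-≡ (lin [] (𝕒 ⊖ (con (+ 1) ⊕ 𝕓) ≈ 𝕒 ⊖ con (+ 1) ⊖ 𝕓) (x ∷ + a ∷ []) tt) m))
... | false | ofⁿ ¬m | false | ofⁿ ¬m′ = still
  (λ { (translate m) → ¬m m })
  (λ { (translate m) → ¬m′ (multiple-≡ (lin [] (𝕒 ⊖ con (+ 1) ⊖ 𝕓 ≈ 𝕒 ⊖ (con (+ 1) ⊕ 𝕓)) (x ∷ + a ∷ []) tt) m) })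
gen-view typeB n zero x
  with x == + 1 | cong?-reflects 0 x (+ 1) | x == - + 1 | cong?-reflects 0 x (- + 1)
... | true | ofʸ m | _ | _ =
  subst (GenView _ _ _ _ _)
    (lin (𝕒 ⊖ con (+ 1) ≈ con (+ 0) ∷ []) (𝕒 ⊖ con (+ 2) ≈ con (- + 1)) (x ∷ []) (multiple-of-0 m))
    (down (translate (multiple-≡ (lin [] (𝕒 ⊖ con (+ 1) ≈ 𝕒 ⊖ con (+ 2) ⊖ con (- + 1)) (x ∷ []) tt) m)))
... | false | ofⁿ ¬m | true | ofʸ m =
  subst (GenView _ _ _ _ _)
    (lin (𝕒 ⊖ con (- + 1) ≈ con (+ 0) ∷ []) (𝕒 ⊕ con (+ 2) ≈ con (+ 1)) (x ∷ []) (multiple-of-0 m))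
    (up (translate m))
... | false | ofⁿ ¬m | false | ofⁿ ¬m′ = still
  (λ { (translate m) → ¬m′ m ; (reflect (_ , m)) → ¬m′ m })
  (λ { (translate m) → ¬m (multiple-≡ (lin [] (𝕒 ⊖ con (+ 2) ⊖ con (- + 1) ≈ 𝕒 ⊖ con (+ 1)) (x ∷ []) tt) m)
     ; (reflect (_ , m)) → ¬m (multiple-≡ (lin [] (𝕒 ⊖ con (+ 2) ⊕ con (+ 1) ≈ 𝕒 ⊖ con (+ 1)) (x ∷ []) tt) m) })
gen-view typeB n (suc i) x
  with x == + suc i | cong?-reflects 0 x (+ suc i)
     | x == + suc (suc i) | cong?-reflects 0 x (+ suc (suc i))
     | x == - + suc i | cong?-reflects 0 x (- + suc i)
     | x == - + suc (suc i) | cong?-reflects 0 x (- + suc (suc i))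
... | true | ofʸ m | _ | _ | _ | _ | _ | _ =
  subst (GenView _ _ _ _ _)
    (lin (𝕒 ⊖ 𝕓 ≈ con (+ 0) ∷ []) (𝕒 ⊕ con (+ 1) ≈ con (+ 1) ⊕ 𝕓) (x ∷ + suc i ∷ []) (multiple-of-0 m))
    (up (translate m))
... | false | ofⁿ _ | true | ofʸ m | _ | _ | _ | _ =
  subst (GenView _ _ _ _ _)
    (lin (𝕒 ⊖ (con (+ 1) ⊕ 𝕓) ≈ con (+ 0) ∷ []) (𝕒 ⊖ con (+ 1) ≈ 𝕓) (x ∷ + suc i ∷ []) (multiple-of-0 m))
    (down (translate (multiple-≡ (lin [] (𝕒 ⊖ (con (+ 1) ⊕ 𝕓) ≈ 𝕒 ⊖ con (+ 1) ⊖ 𝕓) (x ∷ + suc i ∷ []) tt) m)))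
... | false | ofⁿ _ | false | ofⁿ _ | true | ofʸ m | _ | _ =
  subst (GenView _ _ _ _ _)
    (lin (𝕒 ⊖ ⊝ 𝕓 ≈ con (+ 0) ∷ []) (𝕒 ⊖ con (+ 1) ≈ ⊝ (con (+ 1) ⊕ 𝕓)) (x ∷ + suc i ∷ []) (multiple-of-0 m))
    (down (reflect (tt , multiple-≡
      (lin [] (𝕒 ⊖ ⊝ 𝕓 ≈ 𝕒 ⊖ con (+ 1) ⊕ (𝕓 ⊕ con (+ 1))) (x ∷ + suc i ∷ []) tt) m)))
... | false | ofⁿ _ | false | ofⁿ _ | false | ofⁿ _ | true | ofʸ m =
  subst (GenView _ _ _ _ _)
    (lin (𝕒 ⊖ ⊝ (con (+ 1) ⊕ 𝕓) ≈ con (+ 0) ∷ []) (𝕒 ⊕ con (+ 1) ≈ ⊝ 𝕓) (x ∷ + suc i ∷ []) (multiple-of-0 m))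
    (up (reflect (tt , multiple-≡
      (lin [] (𝕒 ⊖ ⊝ (con (+ 1) ⊕ 𝕓) ≈ 𝕒 ⊕ (𝕓 ⊕ con (+ 1))) (x ∷ + suc i ∷ []) tt) m)))
... | false | ofⁿ ¬1 | false | ofⁿ ¬2 | false | ofⁿ ¬3 | false | ofⁿ ¬4 = still
  (λ { (translate m) → ¬1 m
     ; (reflect (_ , m)) → ¬4 (multiple-≡
         (lin [] (𝕒 ⊕ (𝕓 ⊕ con (+ 1)) ≈ 𝕒 ⊖ ⊝ (con (+ 1) ⊕ 𝕓)) (x ∷ + suc i ∷ []) tt) m) })
  (λ { (translate m) → ¬2 (multiple-≡ (lin [] (𝕒 ⊖ con (+ 1) ⊖ 𝕓 ≈ 𝕒 ⊖ (con (+ 1) ⊕ 𝕓)) (x ∷ + suc i ∷ []) tt) m)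
     ; (reflect (_ , m)) → ¬3 (multiple-≡
         (lin [] (𝕒 ⊖ con (+ 1) ⊕ (𝕓 ⊕ con (+ 1)) ≈ 𝕒 ⊖ ⊝ 𝕓) (x ∷ + suc i ∷ []) tt) m) })
gen-view typeC̃ n zero x
  with cong? (2 ℕ.* suc n) x (+ 1) | cong?-reflects (2 ℕ.* suc n) x (+ 1)
     | cong? (2 ℕ.* suc n) x (- + 1) | cong?-reflects (2 ℕ.* suc n) x (- + 1)
... | true | ofʸ m | _ | _ =
    (down (translate (multiple-≡ (lin [] (𝕒 ⊖ con (+ 1) ≈ 𝕒 ⊖ con (+ 2) ⊖ con (- + 1)) (x ∷ []) tt) m)))
... | false | ofⁿ ¬m | true | ofʸ m = up (translate m)
... | false | ofⁿ ¬m | false | ofⁿ ¬m′ = still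
  (λ { (translate m) → ¬m′ m ; (reflect (_ , m)) → ¬m′ m })
  (λ { (translate m) → ¬m (multiple-≡ (lin [] (𝕒 ⊖ con (+ 2) ⊖ con (- + 1) ≈ 𝕒 ⊖ con (+ 1)) (x ∷ []) tt) m)
     ; (reflect (_ , m)) → ¬m (multiple-≡ (lin [] (𝕒 ⊖ con (+ 2) ⊕ con (+ 1) ≈ 𝕒 ⊖ con (+ 1)) (x ∷ []) tt) m) })
gen-view typeC̃ n (suc i) x with does (suc i ℕ.≟ n) | proof (suc i ℕ.≟ n)
... | true | ofʸ refl = view
  where
  N = 2 ℕ.* suc (suc i)

  view : GenView typeC̃ (suc i) (+ suc i) (+ 2) x
    (if cong? N x (+ suc i) then x + + 2
     else if cong? N x (+ suc (suc (suc i))) then x - + 2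
     else x)
  view with cong? N x (+ suc i) | cong?-reflects N x (+ suc i)
          | cong? N x (+ suc (suc (suc i))) | cong?-reflects N x (+ suc (suc (suc i)))
  ... | true | ofʸ m | _ | _ = up (translate m)
  ... | false | ofⁿ ¬m | true | ofʸ m = down (translate (multiple-≡
    (lin [] (𝕒 ⊖ (con (+ 2) ⊕ 𝕓) ≈ 𝕒 ⊖ con (+ 2) ⊖ 𝕓) (x ∷ + suc i ∷ []) tt) m))
  -- The pair `n`, `n + 2` is its own mirror image at `n + 1`, so a reflected image is also a
  -- translated one; the two conditions differ by one period `N`.
  ... | false | ofⁿ ¬m | false | ofⁿ ¬m′ = still
    (λ { (translate m) → ¬m m
       ; (reflect (_ , m)) → ¬m (multiple-≡
           (lin (𝕔 ≈ 𝕓 ⊕ 𝕓 ⊕ con (+ 2) ∷ []) (𝕒 ⊕ (𝕓 ⊕ con (+ 2)) ⊖ 𝕔 ≈ 𝕒 ⊖ 𝕓)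
             (x ∷ + suc i ∷ + N ∷ []) (double (suc i)))
           (multiple-∸ m (multiple-self {N}))) })
    (λ { (translate m) → ¬m′ (multiple-≡
           (lin [] (𝕒 ⊖ con (+ 2) ⊖ 𝕓 ≈ 𝕒 ⊖ (con (+ 2) ⊕ 𝕓)) (x ∷ + suc i ∷ []) tt) m)
       ; (reflect (_ , m)) → ¬m′ (multiple-≡
           (lin (𝕔 ≈ 𝕓 ⊕ 𝕓 ⊕ con (+ 2) ∷ []) (𝕒 ⊖ con (+ 2) ⊕ (𝕓 ⊕ con (+ 2)) ⊖ 𝕔 ≈ 𝕒 ⊖ (con (+ 2) ⊕ 𝕓))
             (x ∷ + suc i ∷ + N ∷ []) (double (suc i)))
           (multiple-∸ m (multiple-self {N}))) })
... | false | ofⁿ _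
  with cong? (2 ℕ.* suc n) x (+ suc i) | cong?-reflects (2 ℕ.* suc n) x (+ suc i)
     | cong? (2 ℕ.* suc n) x (+ suc (suc i)) | cong?-reflects (2 ℕ.* suc n) x (+ suc (suc i))
     | cong? (2 ℕ.* suc n) x (- + suc i) | cong?-reflects (2 ℕ.* suc n) x (- + suc i)
     | cong? (2 ℕ.* suc n) x (- + suc (suc i)) | cong?-reflects (2 ℕ.* suc n) x (- + suc (suc i))
... | true | ofʸ m | _ | _ | _ | _ | _ | _ = up (translate m)
... | false | ofⁿ _ | true | ofʸ m | _ | _ | _ | _ =
  down (translate (multiple-≡ (lin [] (𝕒 ⊖ (con (+ 1) ⊕ 𝕓) ≈ 𝕒 ⊖ con (+ 1) ⊖ 𝕓) (x ∷ + suc i ∷ []) tt) m))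
... | false | ofⁿ _ | false | ofⁿ _ | true | ofʸ m | _ | _ =
  down (reflect (tt , multiple-≡ (lin [] (𝕒 ⊖ ⊝ 𝕓 ≈ 𝕒 ⊖ con (+ 1) ⊕ (𝕓 ⊕ con (+ 1))) (x ∷ + suc i ∷ []) tt) m))
... | false | ofⁿ _ | false | ofⁿ _ | false | ofⁿ _ | true | ofʸ m =
  up (reflect (tt , multiple-≡ (lin [] (𝕒 ⊖ ⊝ (con (+ 1) ⊕ 𝕓) ≈ 𝕒 ⊕ (𝕓 ⊕ con (+ 1))) (x ∷ + suc i ∷ []) tt) m))
... | false | ofⁿ ¬1 | false | ofⁿ ¬2 | false | ofⁿ ¬3 | false | ofⁿ ¬4 = still
  (λ { (translate m) → ¬1 m
     ; (reflect (_ , m)) → ¬4 (multiple-≡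
         (lin [] (𝕒 ⊕ (𝕓 ⊕ con (+ 1)) ≈ 𝕒 ⊖ ⊝ (con (+ 1) ⊕ 𝕓)) (x ∷ + suc i ∷ []) tt) m) })
  (λ { (translate m) → ¬2 (multiple-≡ (lin [] (𝕒 ⊖ con (+ 1) ⊖ 𝕓 ≈ 𝕒 ⊖ (con (+ 1) ⊕ 𝕓)) (x ∷ + suc i ∷ []) tt) m)
     ; (reflect (_ , m)) → ¬3 (multiple-≡
         (lin [] (𝕒 ⊖ con (+ 1) ⊕ (𝕓 ⊕ con (+ 1)) ≈ 𝕒 ⊖ ⊝ 𝕓) (x ∷ + suc i ∷ []) tt) m) })

-- Unfrozen integers

admissible⇒1≤n : ∀ k {n} → Admissible k n → 1 ℕ.≤ n
admissible⇒1≤n typeA p = p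
admissible⇒1≤n typeB p = p
admissible⇒1≤n typeÃ p = ℕ.<⇒≤ p
admissible⇒1≤n typeC̃ p = p

pos-≤ : ∀ {m n} → m ℕ.≤ n → + m ≤ + n
pos-≤ = +≤+

≤-pos : ∀ {m n} → + m ≤ + n → m ℕ.≤ n
≤-pos (+≤+ p) = p

∣∣≤⇒ : ∀ {x n} → ∣ x ∣ ℕ.≤ n → - + n ≤ x × x ≤ + n
∣∣≤⇒ {+ m} {n} p = lin (con (+ 0) ≼ 𝕒 ∷ 𝕒 ≼ 𝕓 ∷ []) (⊝ 𝕓 ≼ 𝕒) (+ m ∷ + n ∷ []) (+≤+ z≤n , pos-≤ p) , pos-≤ p
∣∣≤⇒ { -[1+ m ]} {n} p =
  lin (𝕒 ≼ 𝕓 ∷ []) (⊝ 𝕓 ≼ ⊝ 𝕒) (+ suc m ∷ + n ∷ []) (pos-≤ p) , -≤+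

⇒∣∣≤ : ∀ {x n} → - + n ≤ x → x ≤ + n → ∣ x ∣ ℕ.≤ n
⇒∣∣≤ {+ m} l u = ≤-pos u
⇒∣∣≤ { -[1+ m ]} {n} l u =
  ≤-pos (lin (⊝ 𝕓 ≼ ⊝ 𝕒 ∷ []) (𝕒 ≼ 𝕓) (+ suc m ∷ + n ∷ []) l)

multiple⇒∣ : ∀ {m x} → Multiple (suc m) x → (+ suc m) ∣ x
multiple⇒∣ (t , eq) = Signed.∣⇒∣ᵤ (Signed.divides t eq)

∣⇒multiple : ∀ {m x} → (+ suc m) ∣ x → Multiple (suc m) x
∣⇒multiple {m} {x} d with Signed.∣ᵤ⇒∣ {+ suc m} {x} d
... | Signed.divides t eq = t , eq

*-twice : ∀ t {s p} → s ≡ p + p → t * s ≡ t * p + t * p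
*-twice t {p = p} refl = *-distribˡ-+ t p p

twice : ∀ n → + (2 ℕ.* suc n) ≡ + suc n + + suc n
twice n = cong (λ m → + (suc n ℕ.+ m)) (ℕ.+-identityʳ (suc n))

halve : ∀ {n c} → Multiple (2 ℕ.* suc n) c → ∃[ e ] c ≡ e + e × Multiple (suc n) e
halve {n} (t , eq) = t * + suc n , trans eq (*-twice t (twice n)) , (t , refl)

coarsen : ∀ {n c} → Multiple (2 ℕ.* suc n) c → Multiple (suc n) c
coarsen m with halve m
... | e , refl , h = multiple-+ h h

multiple-frozen : ∀ {n x} → Multiple (suc n) x → ¬ Unfrozen typeC̃ n x
multiple-frozen m u = u (multiple⇒∣ m)

unf? : ∀ k n x → Dec (Unfrozen k n x)
unf? typeA n x = (+ 1 ≤? x) ×-dec (x ≤? + n)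
unf? typeB n x = ¬? (x ≟ + 0) ×-dec (∣ x ∣ ℕ.≤? n)
unf? typeÃ n x = yes tt
unf? typeC̃ n x = ¬? (suc n ∣? ∣ x ∣)

tr-unf : ∀ k {n c x} → Tr k n c → Unfrozen k n x → Unfrozen k n (x + c)
tr-unf typeA {x = x} m u rewrite multiple-of-0 m | +-identityʳ x = u
tr-unf typeB {x = x} m u rewrite multiple-of-0 m | +-identityʳ x = u
tr-unf typeÃ m u = tt
tr-unf typeC̃ {n} {c} {x} m u d = u (multiple⇒∣ (multiple-≡
  (lin [] (𝕒 ⊕ 𝕓 ⊖ 𝕓 ≈ 𝕒) (x ∷ c ∷ []) tt) (multiple-∸ (∣⇒multiple {x = x + c} d) (coarsen m))))

rf-unf : ∀ k {n c x} → Rf k n c → Unfrozen k n x → Unfrozen k n (c - x)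
rf-unf typeB {c = c} {x} (_ , m) (x≢0 , x≤n) rewrite multiple-of-0 m =
  (λ eq → x≢0 (lin (con (+ 0) ⊖ 𝕒 ≈ con (+ 0) ∷ []) (𝕒 ≈ con (+ 0)) (x ∷ []) eq)) ,
  subst (ℕ._≤ _) (sym (trans (cong ∣_∣ (+-identityˡ (- x))) (∣-i∣≡∣i∣ x))) x≤n
rf-unf typeC̃ {n} {c} {x} (_ , m) u d = u (multiple⇒∣ (multiple-≡
  (lin [] (𝕓 ⊖ (𝕓 ⊖ 𝕒) ≈ 𝕒) (x ∷ c ∷ []) tt) (multiple-∸ (coarsen m) (∣⇒multiple {x = c - x} d))))

-- Used in two ways: frozenness of the centre `e` rules out an unfrozen integer that is its own
-- mirror image, and evenness of `c` rules out a pair of gap 1 that is reflected onto itself.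
rf-even : ∀ k {n c} → Rf k n c → ∃[ e ] c ≡ e + e × ¬ Unfrozen k n e
rf-even typeB (_ , m) = + 0 , multiple-of-0 m , λ (0≢0 , _) → 0≢0 refl
rf-even typeC̃ (_ , m) with halve m
... | e , eq , h = e , eq , multiple-frozen h

unf-window : ∀ k {n y} → 1 ℕ.≤ y → y ℕ.≤ n → Unfrozen k n (+ y)
unf-window typeA 1≤y y≤n = pos-≤ 1≤y , pos-≤ y≤n
unf-window typeB (s≤s _) y≤n = (λ ()) , y≤n
unf-window typeÃ _ _ = tt
unf-window typeC̃ {n} {y} 1≤y y≤n d = contradiction
  (multiple-small (∣⇒multiple d) (ℤ.+<+ (s≤s y≤n))
    (lin (con (+ 1) ≼ 𝕒 ∷ con (+ 0) ≼ 𝕓 ∷ []) (⊝ (con (+ 1) ⊕ 𝕓) ≺ 𝕒) (+ y ∷ + n ∷ []) (pos-≤ 1≤y , +≤+ z≤n)))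
  λ { refl → contradiction 1≤y λ () }

-- Letters

valid? : ∀ k n a → Dec (ValidLetter k n a)
valid? typeA n a = (1 ℕ.≤? a) ×-dec (a ℕ.≤? n ∸ 1)
valid? typeB n a = a ℕ.≤? n ∸ 1
valid? typeÃ n a = a ℕ.≤? n
valid? typeC̃ n a = a ℕ.≤? n

valid⇒≤n : ∀ k {n a} → ValidLetter k n a → a ℕ.≤ n
valid⇒≤n typeA {n} (_ , a≤) = ℕ.≤-trans a≤ (ℕ.m∸n≤m n 1)
valid⇒≤n typeB {n} a≤ = ℕ.≤-trans a≤ (ℕ.m∸n≤m n 1)
valid⇒≤n typeÃ a≤ = a≤
valid⇒≤n typeC̃ a≤ = a≤

-- An `inner` letter has gap 1 and both ends of its pair in the window. The others cross an end of
-- the window: `affine` wraps around it, and in the last three cases the pair lies across a mirror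
-- and has gap 2.
data LetterView : Kind → ℕ → ℕ → Set where
  inner   : ∀ {k n a} → suc a ℕ.< n → LetterView k n (suc a)
  affine  : ∀ {n a} → a ≡ 0 ⊎ a ≡ n → LetterView typeÃ n a
  bottomB : ∀ {n} → LetterView typeB n 0
  bottomC : ∀ {n} → LetterView typeC̃ n 0
  topC    : ∀ {a} → LetterView typeC̃ (suc a) (suc a)

1≤⇒pred< : ∀ {n a} → 1 ℕ.≤ n → a ℕ.≤ n ∸ 1 → a ℕ.< n
1≤⇒pred< (s≤s _) a≤ = s≤s a≤

letter-view : ∀ k {n} a → Admissible k n → ValidLetter k n a → LetterView k n a
letter-view typeA (suc a) adm (_ , a≤) = inner (1≤⇒pred< adm a≤)
letter-view typeB zero adm a≤ = bottomB
letter-view typeB (suc a) adm a≤ = inner (1≤⇒pred< adm a≤)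
letter-view typeÃ zero adm a≤ = affine (inj₁ refl)
letter-view typeÃ (suc a) adm a≤ with ℕ.m≤n⇒m<n∨m≡n a≤
... | inj₁ a<n = inner a<n
... | inj₂ a≡n = affine (inj₂ a≡n)
letter-view typeC̃ zero adm a≤ = bottomC
letter-view typeC̃ (suc a) adm a≤ with ℕ.m≤n⇒m<n∨m≡n a≤
... | inj₁ a<n = inner a<n
... | inj₂ refl = topC

lo-suc : ∀ k a → lo k (suc a) ≡ + suc a
lo-suc typeA a = refl
lo-suc typeB a = refl
lo-suc typeÃ a = refl
lo-suc typeC̃ a = refl

gap-inner : ∀ k {n a} → suc a ℕ.< n → gap k n (suc a) ≡ + 1
gap-inner typeA _ = refl
gap-inner typeB _ = refl
gap-inner typeÃ _ = refl
gap-inner typeC̃ {n} {a} a<n rewrite dec-false (suc a ℕ.≟ n) (ℕ.<⇒≢ a<n) = refl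

gap-top : ∀ a → gap typeC̃ (suc a) (suc a) ≡ + 2
gap-top a rewrite dec-true (suc a ℕ.≟ suc a) refl = refl

gap-1-or-2 : ∀ k n a → gap k n a ≡ + 1 ⊎ gap k n a ≡ + 2
gap-1-or-2 typeA n a = inj₁ refl
gap-1-or-2 typeB n zero = inj₂ refl
gap-1-or-2 typeB n (suc a) = inj₁ refl
gap-1-or-2 typeÃ n a = inj₁ refl
gap-1-or-2 typeC̃ n zero = inj₂ refl
gap-1-or-2 typeC̃ n (suc a) with does (suc a ℕ.≟ n)
... | true  = inj₂ refl
... | false = inj₁ refl

gap>0 : ∀ k n a → + 0 < gap k n a
gap>0 k n a with gap k n a | gap-1-or-2 k n a
... | _ | inj₁ refl = ℤ.+<+ (s≤s z≤n)
... | _ | inj₂ refl = ℤ.+<+ (s≤s z≤n)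

rf-period : ∀ {n} → Rf typeC̃ n (+ (2 ℕ.* suc n))
rf-period {n} = tt , multiple-self {2 ℕ.* suc n}

lo-unf : ∀ k {n a} → Admissible k n → LetterView k n a → Unfrozen k n (lo k a)
lo-unf k adm (inner {a = a} a<n) rewrite lo-suc k a = unf-window k (s≤s z≤n) (ℕ.<⇒≤ a<n)
lo-unf k adm (affine _) = tt
lo-unf k adm bottomB = (λ ()) , adm
lo-unf k {n} adm bottomC =
  rf-unf typeC̃ {n} {+ 0} {+ 1} (tt , multiple-0 {2 ℕ.* suc n}) (unf-window typeC̃ (s≤s z≤n) adm)
lo-unf k adm topC = unf-window typeC̃ (s≤s z≤n) ℕ.≤-refl

hi-unf : ∀ k {n a} → Admissible k n → LetterView k n a → Unfrozen k n (lo k a + gap k n a)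
hi-unf k {n} adm (inner {a = a} a<n) rewrite lo-suc k a | gap-inner k a<n | ℕ.+-comm a 1 =
  unf-window k (s≤s z≤n) a<n
hi-unf k adm (affine _) = tt
hi-unf k adm bottomB = (λ ()) , adm
hi-unf k adm bottomC = unf-window typeC̃ (s≤s z≤n) adm
hi-unf k adm (topC {a}) rewrite gap-top a = subst (Unfrozen typeC̃ (suc a))
  (lin (𝕒 ≈ 𝕓 ⊕ 𝕓 ⊕ con (+ 2) ∷ []) (𝕒 ⊖ 𝕓 ≈ 𝕓 ⊕ con (+ 2)) (+ (2 ℕ.* suc (suc a)) ∷ + suc a ∷ []) (double (suc a)))
  (rf-unf typeC̃ {suc a} {+ (2 ℕ.* suc (suc a))} {+ suc a} (rf-period {suc a}) (unf-window typeC̃ (s≤s z≤n) ℕ.≤-refl))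

between-frozen : ∀ k {n a y} → LetterView k n a → lo k a < y → y < lo k a + gap k n a →
  ¬ Unfrozen k n y
between-frozen k {n} {y = y} (inner {a = a} a<n) l<y y<h _ rewrite gap-inner k a<n =
  lin (𝕒 ≺ 𝕓 ∷ 𝕓 ≺ 𝕒 ⊕ con (+ 1) ∷ []) absurd (lo k (suc a) ∷ y ∷ []) (l<y , y<h)
between-frozen k {y = y} (affine {a = a} _) l<y y<h _ =
  lin (𝕒 ≺ 𝕓 ∷ 𝕓 ≺ 𝕒 ⊕ con (+ 1) ∷ []) absurd (+ a ∷ y ∷ []) (l<y , y<h)
between-frozen k {y = y} bottomB l<y y<h (y≢0 , _) =
  y≢0 (lin (con (- + 1) ≺ 𝕒 ∷ 𝕒 ≺ con (+ 1) ∷ []) (𝕒 ≈ con (+ 0)) (y ∷ []) (l<y , y<h))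
between-frozen k {n} {y = y} bottomC l<y y<h = multiple-frozen (multiple-≡
  (lin (con (- + 1) ≺ 𝕒 ∷ 𝕒 ≺ con (+ 1) ∷ []) (con (+ 0) ≈ 𝕒) (y ∷ []) (l<y , y<h)) (multiple-0 {suc n}))
between-frozen k {y = y} (topC {a}) l<y y<h rewrite gap-top a = multiple-frozen (multiple-≡
  (lin (𝕓 ≺ 𝕒 ∷ 𝕒 ≺ 𝕓 ⊕ con (+ 2) ∷ []) (con (+ 1) ⊕ 𝕓 ≈ 𝕒) (y ∷ + suc a ∷ []) (l<y , y<h)) (multiple-self {suc (suc a)}))

-- The bounds on `n` keep the gap below every nonzero period: `2 ≤ n` for the affine symmetric
-- group, and `2n + 2 ≥ 4` in type C̃.
tr-gap : ∀ k {n a} → Admissible k n → ¬ Tr k n (gap k n a)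
tr-gap typeA adm m = contradiction (multiple-of-0 m) λ ()
tr-gap typeB {a = zero} adm m = contradiction (multiple-of-0 m) λ ()
tr-gap typeB {a = suc a} adm m = contradiction (multiple-of-0 m) λ ()
tr-gap typeÃ {n} adm m = contradiction
  (multiple-small m (ℤ.+<+ adm) (lin (con (+ 0) ≼ 𝕒 ∷ []) (⊝ 𝕒 ≺ con (+ 1)) (+ n ∷ []) (+≤+ z≤n))) λ ()
tr-gap typeC̃ {n} {a} adm m with gap typeC̃ n a | gap-1-or-2 typeC̃ n a
... | _ | inj₁ refl = contradiction
  (multiple-small m
    (lin (𝕓 ≈ 𝕒 ⊕ 𝕒 ⊕ con (+ 2) ∷ con (+ 1) ≼ 𝕒 ∷ []) (con (+ 1) ≺ 𝕓) (+ n ∷ + (2 ℕ.* suc n) ∷ []) (double n , pos-≤ adm))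
    (lin (𝕓 ≈ 𝕒 ⊕ 𝕒 ⊕ con (+ 2) ∷ con (+ 1) ≼ 𝕒 ∷ []) (⊝ 𝕓 ≺ con (+ 1)) (+ n ∷ + (2 ℕ.* suc n) ∷ []) (double n , pos-≤ adm)))
  λ ()
... | _ | inj₂ refl = contradiction
  (multiple-small m
    (lin (𝕓 ≈ 𝕒 ⊕ 𝕒 ⊕ con (+ 2) ∷ con (+ 1) ≼ 𝕒 ∷ []) (con (+ 2) ≺ 𝕓) (+ n ∷ + (2 ℕ.* suc n) ∷ []) (double n , pos-≤ adm))
    (lin (𝕓 ≈ 𝕒 ⊕ 𝕒 ⊕ con (+ 2) ∷ con (+ 1) ≼ 𝕒 ∷ []) (⊝ 𝕓 ≺ con (+ 2)) (+ n ∷ + (2 ℕ.* suc n) ∷ []) (double n , pos-≤ adm)))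
  λ ()

tr-small : ∀ k {n c} → Admissible k n → Tr k n c → - + n < c → c < + n → c ≡ + 0
tr-small typeA adm m _ _ = multiple-of-0 m
tr-small typeB adm m _ _ = multiple-of-0 m
tr-small typeÃ adm m l u = multiple-small m u l
tr-small typeC̃ {n} {c} adm m l u = multiple-small m
  (lin (𝕒 ≺ 𝕓 ∷ con (+ 0) ≼ 𝕓 ∷ 𝕔 ≈ 𝕓 ⊕ 𝕓 ⊕ con (+ 2) ∷ []) (𝕒 ≺ 𝕔) (c ∷ + n ∷ + (2 ℕ.* suc n) ∷ [])
    (u , +≤+ z≤n , double n))
  (lin (⊝ 𝕓 ≺ 𝕒 ∷ con (+ 0) ≼ 𝕓 ∷ 𝕔 ≈ 𝕓 ⊕ 𝕓 ⊕ con (+ 2) ∷ []) (⊝ 𝕔 ≺ 𝕒) (c ∷ + n ∷ + (2 ℕ.* suc n) ∷ [])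
    (l , +≤+ z≤n , double n))

-- Mirror images of each other have sum `0` in type B and a multiple of `2n + 2` in type C̃, whereas
-- two window positions have a sum strictly between `0` and `2n + 2`.
rf-large : ∀ k {n c} → Rf k n c → + 0 < c → c < + n + + n + + 2 → ⊥
rf-large typeB (_ , m) l u = <-irrefl (sym (multiple-of-0 m)) l
rf-large typeC̃ {n} {c} (_ , m) l u = <-irrefl (sym (multiple-small m
  (subst (c <_) (sym (double n)) u)
  (lin (con (+ 0) ≺ 𝕒 ∷ con (+ 0) ≼ 𝕓 ∷ []) (⊝ 𝕓 ≺ 𝕒) (c ∷ + (2 ℕ.* suc n) ∷ []) (l , +≤+ z≤n)))) l

same-≡ : ∀ k {n a b} → a ≡ b → SameLetter k n a b
same-≡ typeA eq = eq
same-≡ typeB eq = eq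
same-≡ typeÃ eq = inj₁ eq
same-≡ typeC̃ eq = eq

pos-injective : ∀ {m n} → + m ≡ + n → m ≡ n
pos-injective refl = refl

-- With `upper-letter` this limits the letters that move a window position `y` to `y` and `y - 1`:
-- no translation relates two different window positions, and a reflection leads out of the window.
lower-letter : ∀ k {n a y} → Admissible k n → LetterView k n a → 1 ℕ.≤ y → y ℕ.≤ n →
  Lower k n a (+ y) → SameLetter k n a y
lower-letter k {n} {y = y} adm (inner {a = a} a<n) 1≤y y≤n L
  rewrite lo-suc k a | gap-inner k a<n with L
... | translate m = same-≡ k (pos-injective (lin (𝕒 ⊖ 𝕓 ≈ con (+ 0) ∷ []) (𝕓 ≈ 𝕒) (+ y ∷ + suc a ∷ [])
  (tr-small k adm m
    (lin (con (+ 1) ≼ 𝕒 ∷ 𝕓 ⊕ con (+ 1) ≼ 𝕔 ∷ []) (⊝ 𝕔 ≺ 𝕒 ⊖ 𝕓) (+ y ∷ + suc a ∷ + n ∷ [])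
      (pos-≤ 1≤y , subst (λ m → + m ≤ + n) (ℕ.+-comm 1 (suc a)) (pos-≤ a<n)))
    (lin (𝕒 ≼ 𝕔 ∷ con (+ 1) ≼ 𝕓 ∷ []) (𝕒 ⊖ 𝕓 ≺ 𝕔) (+ y ∷ + suc a ∷ + n ∷ []) (pos-≤ y≤n , pos-≤ (s≤s z≤n))))))
... | reflect r = ⊥-elim (rf-large k r
    (lin (con (+ 1) ≼ 𝕒 ∷ con (+ 1) ≼ 𝕓 ∷ []) (con (+ 0) ≺ 𝕒 ⊕ (𝕓 ⊕ con (+ 1))) (+ y ∷ + suc a ∷ [])
      (pos-≤ 1≤y , pos-≤ (s≤s z≤n)))
    (lin (𝕒 ≼ 𝕔 ∷ 𝕓 ⊕ con (+ 1) ≼ 𝕔 ∷ []) (𝕒 ⊕ (𝕓 ⊕ con (+ 1)) ≺ 𝕔 ⊕ 𝕔 ⊕ con (+ 2)) (+ y ∷ + suc a ∷ + n ∷ [])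
      (pos-≤ y≤n , subst (λ m → + m ≤ + n) (ℕ.+-comm 1 (suc a)) (pos-≤ a<n))))
lower-letter typeÃ {n} {y = y} adm (affine a≡) 1≤y y≤n (translate m) with a≡
... | inj₁ refl = inj₂ (inj₁ (refl , pos-injective
  (lin (𝕒 ⊖ 𝕓 ≈ con (+ 0) ∷ []) (𝕒 ≈ 𝕓) (+ y ∷ + n ∷ []) (tr-small typeÃ adm
    (multiple-≡ (lin [] (𝕒 ⊖ con (+ 0) ⊖ 𝕓 ≈ 𝕒 ⊖ 𝕓) (+ y ∷ + n ∷ []) tt)
      (multiple-∸ m (multiple-self {n})))
    (lin (con (+ 1) ≼ 𝕒 ∷ []) (⊝ 𝕓 ≺ 𝕒 ⊖ 𝕓) (+ y ∷ + n ∷ []) (pos-≤ 1≤y))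
    (lin (𝕒 ≼ 𝕓 ∷ con (+ 2) ≼ 𝕓 ∷ []) (𝕒 ⊖ 𝕓 ≺ 𝕓) (+ y ∷ + n ∷ []) (pos-≤ y≤n , pos-≤ adm))))))
... | inj₂ refl = inj₁ (pos-injective
  (lin (𝕒 ⊖ 𝕓 ≈ con (+ 0) ∷ []) (𝕓 ≈ 𝕒) (+ y ∷ + n ∷ []) (tr-small typeÃ adm m
    (lin (con (+ 1) ≼ 𝕒 ∷ []) (⊝ 𝕓 ≺ 𝕒 ⊖ 𝕓) (+ y ∷ + n ∷ []) (pos-≤ 1≤y))
    (lin (𝕒 ≼ 𝕓 ∷ con (+ 2) ≼ 𝕓 ∷ []) (𝕒 ⊖ 𝕓 ≺ 𝕓) (+ y ∷ + n ∷ []) (pos-≤ y≤n , pos-≤ adm)))))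
lower-letter typeB {n} {y = y} adm bottomB 1≤y y≤n L = ⊥-elim (rf-large typeB {n} (tt , congruent L)
  (lin (con (+ 1) ≼ 𝕒 ∷ []) (con (+ 0) ≺ 𝕒 ⊕ con (+ 1)) (+ y ∷ []) (pos-≤ 1≤y))
  (lin (𝕒 ≼ 𝕓 ∷ con (+ 1) ≼ 𝕒 ∷ []) (𝕒 ⊕ con (+ 1) ≺ 𝕓 ⊕ 𝕓 ⊕ con (+ 2)) (+ y ∷ + n ∷ []) (pos-≤ y≤n , pos-≤ 1≤y)))
  where
  congruent : Orbit typeB n (- + 1) (+ 2) (+ y) → Multiple 0 (+ y + + 1)
  congruent (translate m)     = m
  congruent (reflect (_ , m)) = m
lower-letter typeC̃ {n} {y = y} adm bottomC 1≤y y≤n L = ⊥-elim (rf-large typeC̃ {n} (tt , congruent L)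
  (lin (con (+ 1) ≼ 𝕒 ∷ []) (con (+ 0) ≺ 𝕒 ⊕ con (+ 1)) (+ y ∷ []) (pos-≤ 1≤y))
  (lin (𝕒 ≼ 𝕓 ∷ con (+ 1) ≼ 𝕒 ∷ []) (𝕒 ⊕ con (+ 1) ≺ 𝕓 ⊕ 𝕓 ⊕ con (+ 2)) (+ y ∷ + n ∷ []) (pos-≤ y≤n , pos-≤ 1≤y)))
  where
  congruent : Orbit typeC̃ n (- + 1) (+ 2) (+ y) → Multiple (2 ℕ.* suc n) (+ y + + 1)
  congruent (translate m)     = m
  congruent (reflect (_ , m)) = m
lower-letter typeC̃ {n} {y = y} adm (topC {a}) 1≤y y≤n L rewrite gap-top a =
  pos-injective (lin (𝕒 ⊖ 𝕓 ≈ con (+ 0) ∷ []) (𝕓 ≈ 𝕒) (+ y ∷ + suc a ∷ []) (tr-small typeC̃ adm (congruent L)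
    (lin (con (+ 1) ≼ 𝕒 ∷ []) (⊝ 𝕓 ≺ 𝕒 ⊖ 𝕓) (+ y ∷ + suc a ∷ []) (pos-≤ 1≤y))
    (lin (𝕒 ≼ 𝕓 ∷ con (+ 1) ≼ 𝕒 ∷ []) (𝕒 ⊖ 𝕓 ≺ 𝕓) (+ y ∷ + suc a ∷ []) (pos-≤ y≤n , pos-≤ 1≤y))))
  where
  N = 2 ℕ.* suc (suc a)
  congruent : Orbit typeC̃ (suc a) (+ suc a) (+ 2) (+ y) → Multiple N (+ y - + suc a)
  congruent (translate m)       = m
  congruent (reflect (_ , m)) = multiple-≡
    (lin (𝕔 ≈ 𝕓 ⊕ 𝕓 ⊕ con (+ 2) ∷ []) (𝕒 ⊕ (𝕓 ⊕ con (+ 2)) ⊖ 𝕔 ≈ 𝕒 ⊖ 𝕓) (+ y ∷ + suc a ∷ + N ∷ []) (double (suc a)))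
    (multiple-∸ m (multiple-self {N}))

upper-letter : ∀ k {n a y} → Admissible k n → LetterView k n a → y ℕ.< n →
  Lower k n a (+ suc y - gap k n a) → SameLetter k n a y
upper-letter k {n} {y = y} adm (inner {a = a} a<n) y<n L
  rewrite lo-suc k a | gap-inner k a<n with L
... | translate m = same-≡ k (pos-injective (lin (𝕒 ⊖ 𝕓 ≈ con (+ 0) ∷ []) (𝕓 ≈ 𝕒) (+ y ∷ + suc a ∷ [])
  (tr-small k adm m
    (lin (con (+ 0) ≼ 𝕒 ∷ con (+ 1) ⊕ 𝕓 ≼ 𝕔 ∷ []) (⊝ 𝕔 ≺ 𝕒 ⊖ 𝕓) (+ y ∷ + suc a ∷ + n ∷ []) (+≤+ z≤n , pos-≤ a<n))
    (lin (con (+ 1) ⊕ 𝕒 ≼ 𝕔 ∷ con (+ 1) ≼ 𝕓 ∷ []) (𝕒 ⊖ 𝕓 ≺ 𝕔) (+ y ∷ + suc a ∷ + n ∷ []) (pos-≤ y<n , pos-≤ (s≤s z≤n))))))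
... | reflect r = ⊥-elim (rf-large k r
    (lin (con (+ 0) ≼ 𝕒 ∷ con (+ 1) ≼ 𝕓 ∷ []) (con (+ 0) ≺ 𝕒 ⊕ (𝕓 ⊕ con (+ 1))) (+ y ∷ + suc a ∷ [])
      (+≤+ z≤n , pos-≤ (s≤s z≤n)))
    (lin (con (+ 1) ⊕ 𝕒 ≼ 𝕔 ∷ con (+ 1) ⊕ 𝕓 ≼ 𝕔 ∷ []) (𝕒 ⊕ (𝕓 ⊕ con (+ 1)) ≺ 𝕔 ⊕ 𝕔 ⊕ con (+ 2)) (+ y ∷ + suc a ∷ + n ∷ [])
      (pos-≤ y<n , pos-≤ a<n)))
upper-letter typeÃ {n} {y = y} adm (affine a≡) y<n (translate m) with a≡
... | inj₁ refl = inj₁ (sym (pos-injective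
  (lin (𝕒 ⊖ con (+ 0) ≈ con (+ 0) ∷ []) (𝕒 ≈ con (+ 0)) (+ y ∷ []) (tr-small typeÃ adm m
    (lin (con (+ 0) ≼ 𝕒 ∷ con (+ 1) ⊕ 𝕒 ≼ 𝕓 ∷ []) (⊝ 𝕓 ≺ 𝕒 ⊖ con (+ 0)) (+ y ∷ + n ∷ []) (+≤+ z≤n , pos-≤ y<n))
    (lin (con (+ 1) ⊕ 𝕒 ≼ 𝕓 ∷ []) (𝕒 ⊖ con (+ 0) ≺ 𝕓) (+ y ∷ + n ∷ []) (pos-≤ y<n))))))
... | inj₂ refl = inj₂ (inj₂ (refl , pos-injective (tr-small typeÃ adm
    (multiple-≡ (lin [] (𝕒 ⊖ 𝕓 ⊕ 𝕓 ≈ 𝕒) (+ y ∷ + n ∷ []) tt) (multiple-+ m (multiple-self {n})))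
    (lin (con (+ 0) ≼ 𝕒 ∷ con (+ 1) ⊕ 𝕒 ≼ 𝕓 ∷ []) (⊝ 𝕓 ≺ 𝕒) (+ y ∷ + n ∷ []) (+≤+ z≤n , pos-≤ y<n))
    (ℤ.+<+ y<n))))
upper-letter typeB {n} {y = y} adm bottomB y<n L = sym (pos-injective (multiple-of-0 (congruent L)))
  where
  congruent : Orbit typeB n (- + 1) (+ 2) (+ suc y - + 2) → Multiple 0 (+ y)
  congruent (translate m)       = multiple-≡ (lin [] (con (+ 1) ⊕ 𝕒 ⊖ con (+ 2) ⊖ con (- + 1) ≈ 𝕒) (+ y ∷ []) tt) m
  congruent (reflect (_ , m)) = multiple-≡ (lin [] (con (+ 1) ⊕ 𝕒 ⊖ con (+ 2) ⊕ con (+ 1) ≈ 𝕒) (+ y ∷ []) tt) m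
upper-letter typeC̃ {n} {y = y} adm bottomC y<n L = sym (pos-injective (tr-small typeC̃ {n} {+ y} adm (congruent L)
    (lin (con (+ 0) ≼ 𝕒 ∷ con (+ 1) ⊕ 𝕒 ≼ 𝕓 ∷ []) (⊝ 𝕓 ≺ 𝕒) (+ y ∷ + n ∷ []) (+≤+ z≤n , pos-≤ y<n))
    (ℤ.+<+ y<n)))
  where
  congruent : Orbit typeC̃ n (- + 1) (+ 2) (+ suc y - + 2) → Multiple (2 ℕ.* suc n) (+ y)
  congruent (translate m)       = multiple-≡ (lin [] (con (+ 1) ⊕ 𝕒 ⊖ con (+ 2) ⊖ con (- + 1) ≈ 𝕒) (+ y ∷ []) tt) m
  congruent (reflect (_ , m)) = multiple-≡ (lin [] (con (+ 1) ⊕ 𝕒 ⊖ con (+ 2) ⊕ con (+ 1) ≈ 𝕒) (+ y ∷ []) tt) m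
upper-letter typeC̃ {n} {y = y} adm (topC {a}) y<n L rewrite gap-top a = ⊥-elim
  (rf-large typeC̃ {suc a} (tt , congruent L)
    (lin (con (+ 0) ≼ 𝕒 ∷ con (+ 1) ≼ 𝕓 ∷ []) (con (+ 0) ≺ 𝕒 ⊕ con (+ 1) ⊕ 𝕓) (+ y ∷ + suc a ∷ []) (+≤+ z≤n , pos-≤ (s≤s z≤n)))
    (lin (con (+ 1) ⊕ 𝕒 ≼ 𝕓 ∷ con (+ 1) ≼ 𝕓 ∷ []) (𝕒 ⊕ con (+ 1) ⊕ 𝕓 ≺ 𝕓 ⊕ 𝕓 ⊕ con (+ 2)) (+ y ∷ + suc a ∷ []) (pos-≤ y<n , pos-≤ (s≤s z≤n))))
  where
  N = 2 ℕ.* suc (suc a)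
  congruent : Orbit typeC̃ (suc a) (+ suc a) (+ 2) (+ suc y - + 2) → Multiple N (+ y + + 1 + + suc a)
  congruent (translate m)       = multiple-≡
    (lin (𝕔 ≈ 𝕓 ⊕ 𝕓 ⊕ con (+ 2) ∷ []) (con (+ 1) ⊕ 𝕒 ⊖ con (+ 2) ⊖ 𝕓 ⊕ 𝕔 ≈ 𝕒 ⊕ con (+ 1) ⊕ 𝕓) (+ y ∷ + suc a ∷ + N ∷ []) (double (suc a)))
    (multiple-+ m (multiple-self {N}))
  congruent (reflect (_ , m)) = multiple-≡
    (lin [] (con (+ 1) ⊕ 𝕒 ⊖ con (+ 2) ⊕ (𝕓 ⊕ con (+ 2)) ≈ 𝕒 ⊕ con (+ 1) ⊕ 𝕓) (+ y ∷ + suc a ∷ []) tt) m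

same-inner : ∀ k {n a i} → i ℕ.< n → 1 ℕ.≤ i → SameLetter k n a i → a ≡ i
same-inner typeA _ _ eq = eq
same-inner typeB _ _ eq = eq
same-inner typeÃ _ _ (inj₁ eq) = eq
same-inner typeÃ i<n _ (inj₂ (inj₁ (_ , i≡n))) = contradiction i≡n (ℕ.<⇒≢ i<n)
same-inner typeÃ _ (s≤s _) (inj₂ (inj₂ (_ , ())))
same-inner typeC̃ _ _ eq = eq

same? : ∀ k n a b → Dec (SameLetter k n a b)
same? typeA n a b = a ℕ.≟ b
same? typeB n a b = a ℕ.≟ b
same? typeÃ n a b =
  (a ℕ.≟ b) ⊎-dec ((a ℕ.≟ 0) ×-dec (b ℕ.≟ n)) ⊎-dec ((a ℕ.≟ n) ×-dec (b ℕ.≟ 0))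
same? typeC̃ n a b = a ℕ.≟ b

cong?-wrap : ∀ n c x → cong? n x (+ c) ≡ cong? n x (+ (c ℕ.+ n))
cong?-wrap n c x with cong? n x (+ c) | cong?-reflects n x (+ c)
                    | cong? n x (+ (c ℕ.+ n)) | cong?-reflects n x (+ (c ℕ.+ n))
... | true  | _ | true  | _ = refl
... | false | _ | false | _ = refl
... | true  | ofʸ m | false | ofⁿ ¬m = contradiction
  (multiple-≡ (lin [] (𝕒 ⊖ 𝕓 ⊖ 𝕔 ≈ 𝕒 ⊖ (𝕓 ⊕ 𝕔)) (x ∷ + c ∷ + n ∷ []) tt) (multiple-∸ m (multiple-self {n}))) ¬m
... | false | ofⁿ ¬m | true | ofʸ m = contradiction
  (multiple-≡ (lin [] (𝕒 ⊖ (𝕓 ⊕ 𝕔) ⊕ 𝕔 ≈ 𝕒 ⊖ 𝕓) (x ∷ + c ∷ + n ∷ []) tt) (multiple-+ m (multiple-self {n}))) ¬m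

gen-wrap : ∀ n x → gen typeÃ n 0 x ≡ gen typeÃ n n x
gen-wrap n x rewrite cong?-wrap n 0 x | cong?-wrap n 1 x = refl

same-gen : ∀ k {n a b c} x → SameLetter k n a c → SameLetter k n b c → gen k n a x ≡ gen k n b x
same-gen typeA x refl refl = refl
same-gen typeB x refl refl = refl
same-gen typeC̃ x refl refl = refl
same-gen typeÃ x (inj₁ refl) (inj₁ refl) = refl
same-gen typeÃ {n} x (inj₁ refl) (inj₂ (inj₁ (refl , refl))) = sym (gen-wrap n x)
same-gen typeÃ {n} x (inj₁ refl) (inj₂ (inj₂ (refl , refl))) = gen-wrap n x
same-gen typeÃ {n} x (inj₂ (inj₁ (refl , refl))) (inj₁ refl) = gen-wrap n x
same-gen typeÃ {n} x (inj₂ (inj₂ (refl , refl))) (inj₁ refl) = sym (gen-wrap n x)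
same-gen typeÃ x (inj₂ (inj₁ (refl , refl))) (inj₂ (inj₁ (refl , refl))) = refl
same-gen typeÃ x (inj₂ (inj₂ (refl , refl))) (inj₂ (inj₂ (refl , refl))) = refl
same-gen typeÃ x (inj₂ (inj₁ (refl , refl))) (inj₂ (inj₂ (refl , refl))) = refl
same-gen typeÃ x (inj₂ (inj₂ (refl , refl))) (inj₂ (inj₁ (refl , refl))) = refl

-- Representatives in the window

residue : ∀ m c → ∃[ r ] r ℕ.< suc m × Multiple (suc m) (c - + r)
residue m c = c %ℕ suc m , n%ℕd<d c (suc m) , c /ℕ suc m ,
  lin (𝕒 ≈ 𝕓 ⊕ 𝕔 ∷ []) (𝕒 ⊖ 𝕓 ≈ 𝕔) (c ∷ + (c %ℕ suc m) ∷ c /ℕ suc m * + suc m ∷ []) (a≡a%ℕn+[a/ℕn]*n c (suc m))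

pos-∸ : ∀ {m n} → m ℕ.≤ n → + (n ∸ m) ≡ + n - + m
pos-∸ {m} {n} m≤n = sym (trans (m-n≡m⊖n n m) (⊖-≥ m≤n))

-- Residues above `n + 1` are replaced by their negatives, which a reflection carries back into the
-- window; `0` and `n + 1` are the two frozen classes.
signed-residue : ∀ m n → + suc m ≡ + n + + n + + 2 → ∀ y →
  Multiple (suc m) y ⊎ Multiple (suc m) (y - + suc n) ⊎
  ∃[ z ] suc z ℕ.≤ n × (Multiple (suc m) (y - + suc z) ⊎ Multiple (suc m) (y + + suc z))
signed-residue m n eq y with residue m y
... | zero  , _ , mult = inj₁ (multiple-≡ (lin [] (𝕒 ⊖ con (+ 0) ≈ 𝕒) (y ∷ []) tt) mult)
... | suc r , r< , mult with ℕ.<-cmp r n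
... | tri< r<n _ _ = inj₂ (inj₂ (r , r<n , inj₁ mult))
... | tri≈ _ refl _ = inj₂ (inj₁ mult)
... | tri> _ _ n<r with suc m ∸ suc r | pos-∸ (ℕ.<⇒≤ r<)
... | zero  | c = ⊥-elim (lin (con (+ 0) ≈ 𝕒 ⊖ 𝕓 ∷ 𝕓 ≺ 𝕒 ∷ []) absurd (+ suc m ∷ + suc r ∷ []) (c , ℤ.+<+ r<))
... | suc z | c = inj₂ (inj₂ (z ,
  ≤-pos (lin (con (+ 1) ⊕ 𝕒 ≈ 𝕓 ⊖ 𝕔 ∷ con (+ 1) ⊕ con (+ 1) ⊕ 𝕕 ≼ 𝕔 ∷ 𝕓 ≈ 𝕕 ⊕ 𝕕 ⊕ con (+ 2) ∷ []) (con (+ 1) ⊕ 𝕒 ≼ 𝕕)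
    (+ z ∷ + suc m ∷ + suc r ∷ + n ∷ []) (c , pos-≤ (s≤s n<r) , eq)) ,
  inj₂ (multiple-≡
    (lin (𝕔 ≈ 𝕓 ⊖ 𝕕 ∷ []) (𝕒 ⊖ 𝕕 ⊕ 𝕓 ≈ 𝕒 ⊕ 𝕔) (y ∷ + suc m ∷ + suc z ∷ + suc r ∷ []) c)
    (multiple-+ mult (multiple-self {suc m})))))

-- The window [1 , n] is a fundamental domain for the symmetries acting on the unfrozen integers.
window-representative : ∀ k {n y} → Admissible k n → Unfrozen k n y →
  ∃[ z ] suc z ℕ.≤ n × (Tr k n (y - + suc z) ⊎ Rf k n (y + + suc z))
window-representative typeA {y = + zero} adm (+≤+ () , _)
window-representative typeA {y = + suc z} adm (_ , +≤+ z<n) = z , z<n ,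
  inj₁ (multiple-≡ (lin [] (con (+ 0) ≈ 𝕒 ⊖ 𝕒) (+ suc z ∷ []) tt) multiple-0)
window-representative typeB {y = + zero} adm (0≢0 , _) = contradiction refl 0≢0
window-representative typeB {y = + suc z} adm (_ , z<n) = z , z<n ,
  inj₁ (multiple-≡ (lin [] (con (+ 0) ≈ 𝕒 ⊖ 𝕒) (+ suc z ∷ []) tt) multiple-0)
window-representative typeB {y = -[1+ z ]} adm (_ , z<n) = z , z<n ,
  inj₂ (tt , multiple-≡ (lin [] (con (+ 0) ≈ ⊝ 𝕒 ⊕ 𝕒) (+ suc z ∷ []) tt) multiple-0)
window-representative typeÃ {suc m} {y} adm _
  with residue m y
... | zero  , _ , mult = m , ℕ.≤-refl , inj₁ (multiple-≡
  (lin [] (𝕒 ⊖ con (+ 0) ⊖ 𝕓 ≈ 𝕒 ⊖ 𝕓) (y ∷ + suc m ∷ []) tt) (multiple-∸ mult (multiple-self {suc m})))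
... | suc z , z<m , mult = z , ℕ.<⇒≤ z<m , inj₁ mult
window-representative typeC̃ {n} {y} adm u with signed-residue (n ℕ.+ 1 ℕ.* suc n) n (double n) y
... | inj₁ m                            = contradiction u (multiple-frozen (coarsen {n} m))
... | inj₂ (inj₁ m)                     = contradiction u (multiple-frozen (multiple-≡
  (lin [] (𝕒 ⊖ 𝕓 ⊕ 𝕓 ≈ 𝕒) (y ∷ + suc n ∷ []) tt) (multiple-+ (coarsen {n} m) (multiple-self {suc n}))))
... | inj₂ (inj₂ (z , z<n , inj₁ m))    = z , z<n , inj₁ m
... | inj₂ (inj₂ (z , z<n , inj₂ m))    = z , z<n , inj₂ (tt , m)

hi-pred : ∀ k {n b} → Reflective k → b ℕ.< n → lo k b + gap k n b ≡ + suc b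
hi-pred typeB {b = zero}  _ _ = refl
hi-pred typeB {b = suc b} _ _ = cong +_ (ℕ.+-comm (suc b) 1)
hi-pred typeC̃ {b = zero}  _ _ = refl
hi-pred typeC̃ {n} {suc b} _ b<n rewrite gap-inner typeC̃ b<n = cong +_ (ℕ.+-comm (suc b) 1)

-- In the finite groups the letter `n` is missing; the unfrozen integer `y` above `x` shows that `x`
-- is not the position `n`.
valid-representative : ∀ k {n x y z} → Unfrozen k n y → x < y → suc z ℕ.≤ n →
  Tr k n (x - + suc z) → ValidLetter k n (suc z)
valid-representative typeA {n} {x} {y} {z} (_ , y≤n) x<y z<n m = s≤s z≤n , ℕ.≤-pred (ℕ.≤-trans
  (≤-pos (lin (𝕒 ⊖ 𝕓 ≈ con (+ 0) ∷ 𝕒 ≺ 𝕔 ∷ 𝕔 ≼ 𝕕 ∷ []) (con (+ 1) ⊕ 𝕓 ≼ 𝕕) (x ∷ + suc z ∷ y ∷ + n ∷ [])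
    (multiple-of-0 m , x<y , y≤n))) (ℕ.≤-reflexive (sym (ℕ.m+[n∸m]≡n {1} (ℕ.≤-trans (s≤s z≤n) z<n)))))
valid-representative typeB {n} {x} {y} {z} (_ , y≤n) x<y z<n m = ℕ.≤-pred (ℕ.≤-trans
  (≤-pos (lin (𝕒 ⊖ 𝕓 ≈ con (+ 0) ∷ 𝕒 ≺ 𝕔 ∷ 𝕔 ≼ 𝕕 ∷ []) (con (+ 1) ⊕ 𝕓 ≼ 𝕕) (x ∷ + suc z ∷ y ∷ + n ∷ [])
    (multiple-of-0 m , x<y , proj₂ (∣∣≤⇒ y≤n)))) (ℕ.≤-reflexive (sym (ℕ.m+[n∸m]≡n {1} (ℕ.≤-trans (s≤s z≤n) z<n)))))
valid-representative typeÃ _ _ z<n _ = z<n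
valid-representative typeC̃ _ _ z<n _ = z<n

valid-reflected : ∀ k {n z} → Reflective k → suc z ℕ.≤ n → ValidLetter k n z
valid-reflected typeB _ (s≤s z≤) = z≤
valid-reflected typeC̃ _ z<n = ℕ.<⇒≤ z<n

-- This allows walking through the unfrozen integers from pair to pair. A representative reached by
-- a reflection is the upper end of the pair of the letter below it, and the reflection turns upper
-- ends into lower ones.
successor : ∀ k {n x y} → Admissible k n → Unfrozen k n x → Unfrozen k n y → x < y →
  ∃[ a ] ValidLetter k n a × Lower k n a x
successor k {n} {x} {y} adm ux uy x<y with window-representative k adm ux
... | z , z<n , inj₁ m = suc z , valid-representative k uy x<y z<n m ,
  translate (subst (λ l → Tr k n (x - l)) (sym (lo-suc k z)) m)
... | z , z<n , inj₂ (r , m) = z , valid-reflected k r z<n ,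
  reflect (r , subst (λ h → Tr k n (x + h)) (sym (hi-pred k r z<n)) m)

frozen-centre : ∀ {n f} → ¬ Unfrozen typeC̃ n f → Rf typeC̃ n (f + f)
frozen-centre {n} {f} ¬u with suc n ∣? ∣ f ∣
... | no ¬d = contradiction ¬d ¬u
... | yes d with ∣⇒multiple {x = f} d
...   | t , refl = tt , t , sym (*-twice t (twice n))

-- Order can thus be compared with frozen integers too: such an integer either is a mirror,
-- separating each `y` from its image, or lies beyond all unfrozen integers.
frozen-shape : ∀ k {n f} → ¬ Unfrozen k n f →
  Rf k n (f + f) ⊎ (∀ y → Unfrozen k n y → y < f) ⊎ (∀ y → Unfrozen k n y → f < y)
frozen-shape typeA {n} {f} ¬u with + 1 ≤? f | f ≤? + n
... | yes p | yes q = contradiction (p , q) ¬u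
... | yes p | no ¬q = inj₂ (inj₁ λ y (_ , y≤n) → ≤-<-trans y≤n (≰⇒> ¬q))
... | no ¬p | _     = inj₂ (inj₂ λ y (1≤y , _) → <-≤-trans (≰⇒> ¬p) 1≤y)
frozen-shape typeB {n} {f} ¬u with f ≟ + 0
... | yes refl = inj₁ (tt , multiple-0)
... | no f≢0 with f ≤? + n | - + n ≤? f
... | yes p | yes q = contradiction (f≢0 , ⇒∣∣≤ q p) ¬u
... | no ¬p | _     = inj₂ (inj₁ λ y (_ , y≤n) → ≤-<-trans (proj₂ (∣∣≤⇒ y≤n)) (≰⇒> ¬p))
... | yes _ | no ¬q = inj₂ (inj₂ λ y (_ , y≤n) → <-≤-trans (≰⇒> ¬q) (proj₁ (∣∣≤⇒ y≤n)))
frozen-shape typeÃ ¬u = contradiction tt ¬u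
frozen-shape typeC̃ {n} {f} ¬u = inj₁ (frozen-centre {n} {f} ¬u)

frozen-exists : ∀ k n → (∃[ f ] ¬ Unfrozen k n f) ⊎ k ≡ typeÃ
frozen-exists typeA n = inj₁ (+ 0 , λ { (+≤+ () , _) })
frozen-exists typeB n = inj₁ (+ 0 , λ (0≢0 , _) → 0≢0 refl)
frozen-exists typeÃ n = inj₂ refl
frozen-exists typeC̃ n = inj₁ (+ 0 , multiple-frozen (multiple-0 {suc n}))

nondegenerate⇒2≤n : ∀ k {n} → Nondegenerate k n → 2 ℕ.≤ n ⊎ (∀ a → ValidLetter k n a → a ≡ 0)
nondegenerate⇒2≤n typeA {suc zero} _ = inj₂ λ _ (_ , a≤0) → ℕ.n≤0⇒n≡0 a≤0
nondegenerate⇒2≤n typeA {suc (suc n)} _ = inj₁ (s≤s (s≤s z≤n))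
nondegenerate⇒2≤n typeB {suc zero} _ = inj₂ λ _ a≤0 → ℕ.n≤0⇒n≡0 a≤0
nondegenerate⇒2≤n typeB {suc (suc n)} _ = inj₁ (s≤s (s≤s z≤n))
nondegenerate⇒2≤n typeÃ 3≤n = inj₁ (ℕ.<⇒≤ 3≤n)
nondegenerate⇒2≤n typeC̃ 2≤n = inj₁ 2≤n

-- The degenerate groups are the affine symmetric group with `n = 2` and type C̃ with `n = 1`. There
-- the unfrozen integers form only two classes modulo the period, and congruent positions keep their
-- order.
TwoCongruent : Kind → ℕ → Set
TwoCongruent k n = ∀ x y z → Unfrozen k n x → Unfrozen k n y → Unfrozen k n z →
  Tr k n (y - x) ⊎ Tr k n (z - y) ⊎ Tr k n (z - x)

pigeonhole : ∀ {p c d x y z} →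
  Multiple p (x - c) ⊎ Multiple p (x - d) → Multiple p (y - c) ⊎ Multiple p (y - d) →
  Multiple p (z - c) ⊎ Multiple p (z - d) →
  Multiple p (y - x) ⊎ Multiple p (z - y) ⊎ Multiple p (z - x)
pigeonhole {p} {c} {d} {x} {y} {z} = go
  where
  difference : ∀ e u v → Multiple p (u - e) → Multiple p (v - e) → Multiple p (v - u)
  difference e u v m m′ =
    multiple-≡ (lin [] (𝕔 ⊖ 𝕒 ⊖ (𝕓 ⊖ 𝕒) ≈ 𝕔 ⊖ 𝕓) (e ∷ u ∷ v ∷ []) tt) (multiple-∸ m′ m)
  go : Multiple p (x - c) ⊎ Multiple p (x - d) → Multiple p (y - c) ⊎ Multiple p (y - d) →
    Multiple p (z - c) ⊎ Multiple p (z - d) →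
    Multiple p (y - x) ⊎ Multiple p (z - y) ⊎ Multiple p (z - x)
  go (inj₁ l) (inj₁ m) _        = inj₁ (difference c x y l m)
  go (inj₂ l) (inj₂ m) _        = inj₁ (difference d x y l m)
  go (inj₁ _) (inj₂ m) (inj₂ r) = inj₂ (inj₁ (difference d y z m r))
  go (inj₂ _) (inj₁ m) (inj₁ r) = inj₂ (inj₁ (difference c y z m r))
  go (inj₁ l) (inj₂ _) (inj₁ r) = inj₂ (inj₂ (difference c x z l r))
  go (inj₂ l) (inj₁ _) (inj₂ r) = inj₂ (inj₂ (difference d x z l r))

degenerate : ∀ k {n} → Admissible k n → Nondegenerate k n ⊎ TwoCongruent k n
degenerate typeA adm = inj₁ adm
degenerate typeB adm = inj₁ adm
degenerate typeÃ {suc zero} (s≤s ())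
degenerate typeÃ {suc (suc (suc n))} adm = inj₁ (s≤s (s≤s (s≤s z≤n)))
degenerate typeÃ {suc (suc zero)} adm =
  inj₂ λ x y z _ _ _ → pigeonhole {x = x} {y} {z} (parity x) (parity y) (parity z)
  where
  parity : ∀ x → Multiple 2 (x - + 1) ⊎ Multiple 2 (x - + 2)
  parity x with window-representative typeÃ {y = x} adm tt
  ... | zero , _ , inj₁ m = inj₁ m
  ... | suc zero , _ , inj₁ m = inj₂ m
  ... | suc (suc _) , s≤s (s≤s ()) , _
degenerate typeC̃ {suc (suc n)} adm = inj₁ (s≤s (s≤s z≤n))
degenerate typeC̃ {suc zero} adm =
  inj₂ λ x y z ux uy uz → pigeonhole {c = + 1} { - + 1} {x} {y} {z} (odd x ux) (odd y uy) (odd z uz)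
  where
  odd : ∀ x → Unfrozen typeC̃ 1 x → Multiple 4 (x - + 1) ⊎ Multiple 4 (x - (- + 1))
  odd x u with window-representative typeC̃ {y = x} adm u
  ... | zero , _ , inj₁ m = inj₁ m
  ... | zero , _ , inj₂ (_ , m) = inj₂ m
  ... | suc _ , s≤s () , _

-- Generators

module _ {k : Kind} {n : ℕ} where

  orbit-shift : ∀ {l g c x} → Orbit k n l g x → Tr k n c → Orbit k n l g (x + c)
  orbit-shift {l} {g} {c} {x} (translate m) t = translate (multiple-≡
    (lin [] (𝕒 ⊖ 𝕓 ⊕ 𝕔 ≈ 𝕒 ⊕ 𝕔 ⊖ 𝕓) (x ∷ l ∷ c ∷ []) tt) (multiple-+ m t))
  orbit-shift {l} {g} {c} {x} (reflect (r , m)) t = reflect (r , multiple-≡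
    (lin [] (𝕒 ⊕ (𝕓 ⊕ 𝕕) ⊕ 𝕔 ≈ 𝕒 ⊕ 𝕔 ⊕ (𝕓 ⊕ 𝕕)) (x ∷ l ∷ c ∷ g ∷ []) tt) (multiple-+ m t))

  orbit-flip : ∀ {l g c x} → Orbit k n l g x → Rf k n c → Orbit k n l g (c - (x + g))
  orbit-flip {l} {g} {c} {x} (translate m) (r , t) = reflect (r , multiple-≡
    (lin [] (𝕔 ⊖ (𝕒 ⊖ 𝕓) ≈ 𝕔 ⊖ (𝕒 ⊕ 𝕕) ⊕ (𝕓 ⊕ 𝕕)) (x ∷ l ∷ c ∷ g ∷ []) tt) (multiple-∸ t m))
  orbit-flip {l} {g} {c} {x} (reflect (_ , m)) (_ , t) = translate (multiple-≡
    (lin [] (𝕔 ⊖ (𝕒 ⊕ (𝕓 ⊕ 𝕕)) ≈ 𝕔 ⊖ (𝕒 ⊕ 𝕕) ⊖ 𝕓) (x ∷ l ∷ c ∷ g ∷ []) tt) (multiple-∸ t m))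

  orbit-related : ∀ {l g x y} → Orbit k n l g x → Orbit k n l g y →
    Tr k n (y - x) ⊎ Rf k n (y + x + g)
  orbit-related {l} {g} {x} {y} (translate m) (translate m′) = inj₁ (multiple-≡
    (lin [] (𝕔 ⊖ 𝕒 ⊖ (𝕓 ⊖ 𝕒) ≈ 𝕔 ⊖ 𝕓) (l ∷ x ∷ y ∷ []) tt) (multiple-∸ m′ m))
  orbit-related {l} {g} {x} {y} (translate m) (reflect (r , m′)) = inj₂ (r , multiple-≡
    (lin [] (𝕔 ⊕ (𝕒 ⊕ 𝕕) ⊕ (𝕓 ⊖ 𝕒) ≈ 𝕔 ⊕ 𝕓 ⊕ 𝕕) (l ∷ x ∷ y ∷ g ∷ []) tt) (multiple-+ m′ m))
  orbit-related {l} {g} {x} {y} (reflect (r , m)) (translate m′) = inj₂ (r , multiple-≡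
    (lin [] (𝕔 ⊖ 𝕒 ⊕ (𝕓 ⊕ (𝕒 ⊕ 𝕕)) ≈ 𝕔 ⊕ 𝕓 ⊕ 𝕕) (l ∷ x ∷ y ∷ g ∷ []) tt) (multiple-+ m′ m))
  orbit-related {l} {g} {x} {y} (reflect (_ , m)) (reflect (_ , m′)) = inj₁ (multiple-≡
    (lin [] (𝕔 ⊕ (𝕒 ⊕ 𝕕) ⊖ (𝕓 ⊕ (𝕒 ⊕ 𝕕)) ≈ 𝕔 ⊖ 𝕓) (l ∷ x ∷ y ∷ g ∷ []) tt) (multiple-∸ m′ m))

record Commutes (k : Kind) (n : ℕ) (w : ℤ → ℤ) : Set where
  field
    shift : ∀ {c} x → Tr k n c → w (x + c) ≡ w x + c
    flip  : ∀ {c} x → Rf k n c → w (c - x) ≡ c - w x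

open Commutes public

module Generators (k : Kind) (n : ℕ) (adm : Admissible k n) where

  Unf : ℤ → Set
  Unf = Unfrozen k n

  V : ℕ → Set
  V = ValidLetter k n

  s : ℕ → ℤ → ℤ
  s = gen k n

  g : ℕ → ℤ
  g = gap k n

  L : ℕ → ℤ → Set
  L = Lower k n

  view : ∀ {a} → V a → LetterView k n a
  view = letter-view k _ adm

  lower-unf : ∀ {a x} → V a → L a x → Unf x
  lower-unf {a} {x} v (translate m) = subst Unf
    (lin [] (𝕓 ⊕ (𝕒 ⊖ 𝕓) ≈ 𝕒) (x ∷ lo k a ∷ []) tt) (tr-unf k m (lo-unf k adm (view v)))
  lower-unf {a} {x} v (reflect r) = subst Unf
    (lin [] (𝕒 ⊕ 𝕓 ⊖ 𝕓 ≈ 𝕒) (x ∷ lo k a + g a ∷ []) tt) (rf-unf k r (hi-unf k adm (view v)))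

  upper-unf : ∀ {a x} → V a → L a x → Unf (x + g a)
  upper-unf {a} {x} v (translate m) = subst Unf
    (lin [] (𝕓 ⊕ 𝕔 ⊕ (𝕒 ⊖ 𝕓) ≈ 𝕒 ⊕ 𝕔) (x ∷ lo k a ∷ g a ∷ []) tt) (tr-unf k m (hi-unf k adm (view v)))
  upper-unf {a} {x} v (reflect r) = subst Unf
    (lin [] (𝕒 ⊕ (𝕓 ⊕ 𝕔) ⊖ 𝕓 ≈ 𝕒 ⊕ 𝕔) (x ∷ lo k a ∷ g a ∷ []) tt) (rf-unf k r (lo-unf k adm (view v)))

  lower-adjacent : ∀ {a x y} → V a → L a x → Unf y → x < y → x + g a ≤ y
  lower-adjacent {a} {x} {y} v (translate m) u x<y = ≮⇒≥ λ y<x+g → between-frozen k (view v)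
    (lin (𝕒 ≺ 𝕓 ∷ []) (𝕔 ≺ 𝕓 ⊕ ⊝ (𝕒 ⊖ 𝕔)) (x ∷ y ∷ lo k a ∷ []) x<y)
    (lin (𝕓 ≺ 𝕒 ⊕ 𝕕 ∷ []) (𝕓 ⊕ ⊝ (𝕒 ⊖ 𝕔) ≺ 𝕔 ⊕ 𝕕) (x ∷ y ∷ lo k a ∷ g a ∷ []) y<x+g)
    (tr-unf k (multiple-neg m) u)
  lower-adjacent {a} {x} {y} v (reflect r) u x<y = ≮⇒≥ λ y<x+g → between-frozen k (view v)
    (lin (𝕓 ≺ 𝕒 ⊕ 𝕕 ∷ []) (𝕔 ≺ 𝕒 ⊕ (𝕔 ⊕ 𝕕) ⊖ 𝕓) (x ∷ y ∷ lo k a ∷ g a ∷ []) y<x+g)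
    (lin (𝕒 ≺ 𝕓 ∷ []) (𝕒 ⊕ (𝕔 ⊕ 𝕕) ⊖ 𝕓 ≺ 𝕔 ⊕ 𝕕) (x ∷ y ∷ lo k a ∷ g a ∷ []) x<y)
    (rf-unf k r u)

  upper-adjacent : ∀ {a x y} → V a → L a x → Unf y → y < x + g a → y ≤ x
  upper-adjacent v l u y<x+g = ≮⇒≥ λ x<y → <⇒≱ y<x+g (lower-adjacent v l u x<y)

  lower<upper : ∀ a x → x < x + g a
  lower<upper a x = lin (con (+ 0) ≺ 𝕓 ∷ []) (𝕒 ≺ 𝕒 ⊕ 𝕓) (x ∷ g a ∷ []) (gap>0 k n a)

  -- Otherwise the pairs at `x` and `x + g a` would differ by the translation by `g a`, excluded by
  -- `tr-gap`, or by a reflection with the unfrozen integer `x + g a` as centre. Hence the pairs of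
  -- one orbit do not overlap.
  lower-not-upper : ∀ {a x} → V a → L a x → ¬ L a (x + g a)
  lower-not-upper {a} {x} v l l′ with orbit-related l l′
  ... | inj₁ t = tr-gap k {n} {a} adm (multiple-≡ (lin [] (𝕒 ⊕ 𝕓 ⊖ 𝕒 ≈ 𝕓) (x ∷ g a ∷ []) tt) t)
  ... | inj₂ r with rf-even k r
  ...   | e , eq , ¬u = ¬u (subst Unf
    (lin (𝕒 ⊕ 𝕓 ⊕ 𝕒 ⊕ 𝕓 ≈ 𝕔 ⊕ 𝕔 ∷ []) (𝕒 ⊕ 𝕓 ≈ 𝕔) (x ∷ g a ∷ e ∷ []) eq) (upper-unf v l))

  x+g-g : ∀ a x → x + g a - g a ≡ x
  x+g-g a x = lin [] (𝕒 ⊕ 𝕓 ⊖ 𝕓 ≈ 𝕒) (x ∷ g a ∷ []) tt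

  x-g+g : ∀ a x → x - g a + g a ≡ x
  x-g+g a x = lin [] (𝕒 ⊖ 𝕓 ⊕ 𝕓 ≈ 𝕒) (x ∷ g a ∷ []) tt

  s-lower : ∀ {a x} → V a → L a x → s a x ≡ x + g a
  s-lower {a} {x} v l with s a x | gen-view k n a x
  ... | _ | up _      = refl
  ... | _ | down l′   = contradiction (subst (L a) (sym (x-g+g a x)) l) (lower-not-upper v l′)
  ... | _ | still ¬l _ = contradiction l ¬l

  s-upper : ∀ {a x} → V a → L a x → s a (x + g a) ≡ x
  s-upper {a} {x} v l with s a (x + g a) | gen-view k n a (x + g a)
  ... | _ | up l′      = contradiction l′ (lower-not-upper v l)
  ... | _ | down _     = x+g-g a x
  ... | _ | still _ ¬l = contradiction (subst (L a) (sym (x+g-g a x)) l) ¬l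

  data Moves (a : ℕ) (x : ℤ) : Set where
    up    : L a x → s a x ≡ x + g a → Moves a x
    down  : ∀ y → L a y → x ≡ y + g a → s a x ≡ y → Moves a x
    still : ¬ L a x → (∀ y → L a y → x ≢ y + g a) → s a x ≡ x → Moves a x

  moves : ∀ a x → Moves a x
  moves a x with s a x in eq | gen-view k n a x
  ... | _ | up l       = up l eq
  ... | _ | down l     = down (x - g a) l (sym (x-g+g a x)) eq
  ... | _ | still ¬l ¬u = still ¬l (λ { y l refl → ¬u (subst (L a) (sym (x+g-g a y)) l) }) eq

  s-involutive : ∀ {a} → V a → ∀ x → s a (s a x) ≡ x
  s-involutive {a} v x with moves a x
  ... | up l eq       = trans (cong (s a) eq) (s-upper v l)
  ... | down y l refl eq = trans (cong (s a) eq) (s-lower v l)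
  ... | still _ _ eq  = trans (cong (s a) eq) eq

  s-injective : ∀ {a} → V a → ∀ {x y} → s a x ≡ s a y → x ≡ y
  s-injective v {x} {y} eq = trans (sym (s-involutive v x)) (trans (cong (s _) eq) (s-involutive v y))

  lower-unshift : ∀ {a c x} → Tr k n c → L a (x + c) → L a x
  lower-unshift {a} {c} {x} t l = subst (L a) (lin [] (𝕒 ⊕ 𝕓 ⊕ ⊝ 𝕓 ≈ 𝕒) (x ∷ c ∷ []) tt)
    (orbit-shift l (multiple-neg t))

  s-commutes : ∀ {a} → V a → Commutes k n (s a)
  s-commutes {a} v .shift {c} x t with moves a x
  ... | up l eq = trans (s-lower v (orbit-shift l t))
    (trans (lin [] (𝕒 ⊕ 𝕓 ⊕ 𝕔 ≈ 𝕒 ⊕ 𝕔 ⊕ 𝕓) (x ∷ c ∷ g a ∷ []) tt) (cong (_+ c) (sym eq)))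
  ... | down y l refl eq = trans
    (cong (s a) (lin [] (𝕒 ⊕ 𝕔 ⊕ 𝕓 ≈ 𝕒 ⊕ 𝕓 ⊕ 𝕔) (y ∷ c ∷ g a ∷ []) tt))
    (trans (s-upper v (orbit-shift l t)) (cong (_+ c) (sym eq)))
  ... | still ¬l ¬u eq with moves a (x + c)
  ...   | up l _ = contradiction (lower-unshift t l) ¬l
  ...   | down y l eq′ _ = contradiction
    (lin (𝕒 ⊕ 𝕓 ≈ 𝕔 ⊕ 𝕕 ∷ []) (𝕒 ≈ 𝕔 ⊕ ⊝ 𝕓 ⊕ 𝕕) (x ∷ c ∷ y ∷ g a ∷ []) eq′)
    (¬u (y + - c) (orbit-shift l (multiple-neg t)))
  ...   | still _ _ eq′ = trans eq′ (cong (_+ c) (sym eq))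
  s-commutes {a} v .flip {c} x r with moves a x
  ... | up l eq = trans
    (cong (s a) (lin [] (𝕓 ⊖ 𝕒 ≈ 𝕓 ⊖ (𝕒 ⊕ 𝕔) ⊕ 𝕔) (x ∷ c ∷ g a ∷ []) tt))
    (trans (s-upper v (orbit-flip l r)) (cong (λ z → c - z) (sym eq)))
  ... | down y l refl eq = trans (s-lower v (orbit-flip l r))
    (trans (lin [] (𝕓 ⊖ (𝕒 ⊕ 𝕔) ⊕ 𝕔 ≈ 𝕓 ⊖ 𝕒) (y ∷ c ∷ g a ∷ []) tt) (cong (λ z → c - z) (sym eq)))
  ... | still ¬l ¬u eq with moves a (c - x)
  ...   | up l _ = contradiction
    (lin [] (𝕒 ≈ 𝕓 ⊖ (𝕓 ⊖ 𝕒 ⊕ 𝕔) ⊕ 𝕔) (x ∷ c ∷ g a ∷ []) tt)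
    (¬u _ (orbit-flip l r))
  ...   | down y l eq′ _ = contradiction
    (subst (L a) (lin (𝕓 ⊖ 𝕒 ≈ 𝕕 ⊕ 𝕔 ∷ []) (𝕓 ⊖ (𝕕 ⊕ 𝕔) ≈ 𝕒) (x ∷ c ∷ g a ∷ y ∷ []) eq′)
      (orbit-flip l r)) ¬l
  ...   | still _ _ eq′ = trans eq′ (cong (λ z → c - z) (sym eq))

  s-unf : ∀ {a x} → V a → Unf x → Unf (s a x)
  s-unf {a} {x} v u with moves a x
  ... | up l eq          = subst Unf (sym eq) (upper-unf v l)
  ... | down y l refl eq = subst Unf (sym eq) (lower-unf v l)
  ... | still _ _ eq     = subst Unf (sym eq) u

  s-frozen : ∀ {a x} → V a → ¬ Unf x → s a x ≡ x
  s-frozen {a} {x} v ¬u with moves a x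
  ... | up l eq          = contradiction (lower-unf v l) ¬u
  ... | down y l refl eq = contradiction (upper-unf v l) ¬u
  ... | still _ _ eq     = eq

  s-bounded : ∀ a x → s a x ≤ x + + 2 × x ≤ s a x + + 2
  s-bounded a x with moves a x | gap-1-or-2 k n a
  ... | up l eq | inj₁ g≡ =
    lin (𝕓 ≈ 𝕒 ⊕ 𝕔 ∷ 𝕔 ≈ con (+ 1) ∷ []) (𝕓 ≼ 𝕒 ⊕ con (+ 2)) (x ∷ s a x ∷ g a ∷ []) (eq , g≡) ,
    lin (𝕓 ≈ 𝕒 ⊕ 𝕔 ∷ 𝕔 ≈ con (+ 1) ∷ []) (𝕒 ≼ 𝕓 ⊕ con (+ 2)) (x ∷ s a x ∷ g a ∷ []) (eq , g≡)
  ... | up l eq | inj₂ g≡ =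
    lin (𝕓 ≈ 𝕒 ⊕ 𝕔 ∷ 𝕔 ≈ con (+ 2) ∷ []) (𝕓 ≼ 𝕒 ⊕ con (+ 2)) (x ∷ s a x ∷ g a ∷ []) (eq , g≡) ,
    lin (𝕓 ≈ 𝕒 ⊕ 𝕔 ∷ 𝕔 ≈ con (+ 2) ∷ []) (𝕒 ≼ 𝕓 ⊕ con (+ 2)) (x ∷ s a x ∷ g a ∷ []) (eq , g≡)
  ... | down y l x≡ eq | inj₁ g≡ =
    lin (𝕓 ≈ 𝕕 ∷ 𝕒 ≈ 𝕕 ⊕ 𝕔 ∷ 𝕔 ≈ con (+ 1) ∷ []) (𝕓 ≼ 𝕒 ⊕ con (+ 2)) (x ∷ s a x ∷ g a ∷ y ∷ []) (eq , x≡ , g≡) ,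
    lin (𝕓 ≈ 𝕕 ∷ 𝕒 ≈ 𝕕 ⊕ 𝕔 ∷ 𝕔 ≈ con (+ 1) ∷ []) (𝕒 ≼ 𝕓 ⊕ con (+ 2)) (x ∷ s a x ∷ g a ∷ y ∷ []) (eq , x≡ , g≡)
  ... | down y l x≡ eq | inj₂ g≡ =
    lin (𝕓 ≈ 𝕕 ∷ 𝕒 ≈ 𝕕 ⊕ 𝕔 ∷ 𝕔 ≈ con (+ 2) ∷ []) (𝕓 ≼ 𝕒 ⊕ con (+ 2)) (x ∷ s a x ∷ g a ∷ y ∷ []) (eq , x≡ , g≡) ,
    lin (𝕓 ≈ 𝕕 ∷ 𝕒 ≈ 𝕕 ⊕ 𝕔 ∷ 𝕔 ≈ con (+ 2) ∷ []) (𝕒 ≼ 𝕓 ⊕ con (+ 2)) (x ∷ s a x ∷ g a ∷ y ∷ []) (eq , x≡ , g≡)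
  ... | still _ _ eq | _ =
    lin (𝕓 ≈ 𝕒 ∷ []) (𝕓 ≼ 𝕒 ⊕ con (+ 2)) (x ∷ s a x ∷ []) eq ,
    lin (𝕓 ≈ 𝕒 ∷ []) (𝕒 ≼ 𝕓 ⊕ con (+ 2)) (x ∷ s a x ∷ []) eq

  s-monotone : ∀ {a x y} → V a → Unf x → Unf y → x < y → s a x ≢ y → s a x < s a y
  s-monotone {a} {x} {y} v ux uy x<y sx≢y with moves a x | moves a y
  ... | up l eq | up _ eq′ = subst₂ _<_ (sym eq) (sym eq′)
    (lin (𝕒 ≺ 𝕓 ∷ []) (𝕒 ⊕ 𝕔 ≺ 𝕓 ⊕ 𝕔) (x ∷ y ∷ g a ∷ []) x<y)
  ... | up l eq | still _ _ eq′ = ≤∧≢⇒<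
    (subst₂ _≤_ (sym eq) (sym eq′) (lower-adjacent v l uy x<y))
    (λ e → sx≢y (trans e eq′))
  ... | up l eq | down z l′ refl eq′ = subst₂ _<_ (sym eq) (sym eq′) (≤∧≢⇒<
    (lower-adjacent v l (lower-unf v l′) (≤∧≢⇒< (upper-adjacent v l′ ux x<y)
      (λ { refl → sx≢y eq })))
    (λ { refl → lower-not-upper v l l′ }))
  ... | down z l refl eq | up _ eq′ = subst₂ _<_ (sym eq) (sym eq′)
    (<-trans (lower<upper a z) (<-trans x<y (lower<upper a y)))
  ... | down z l refl eq | still _ _ eq′ = subst₂ _<_ (sym eq) (sym eq′) (<-trans (lower<upper a z) x<y)
  ... | down z l refl eq | down z′ l′ refl eq′ = subst₂ _<_ (sym eq) (sym eq′)
    (lin (𝕒 ⊕ 𝕔 ≺ 𝕓 ⊕ 𝕔 ∷ []) (𝕒 ≺ 𝕓) (z ∷ z′ ∷ g a ∷ []) x<y)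
  ... | still _ _ eq | up _ eq′ = subst₂ _<_ (sym eq) (sym eq′) (<-trans x<y (lower<upper a y))
  ... | still _ _ eq | still _ _ eq′ = subst₂ _<_ (sym eq) (sym eq′) x<y
  ... | still ¬l _ eq | down z l′ refl eq′ = subst₂ _<_ (sym eq) (sym eq′)
    (≤∧≢⇒< (upper-adjacent v l′ ux x<y) (λ { refl → ¬l l′ }))

commutes-id : ∀ {k n} → Commutes k n (λ x → x)
commutes-id .shift x t = refl
commutes-id .flip x r = refl

commutes-∘ : ∀ {k n u v} → Commutes k n u → Commutes k n v → Commutes k n (λ x → u (v x))
commutes-∘ {u = u} {v} cu cv .shift x t = trans (cong u (cv .shift x t)) (cu .shift (v x) t)
commutes-∘ {u = u} {v} cu cv .flip x r = trans (cong u (cv .flip x r)) (cu .flip (v x) r)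

-- Counting over an interval of integers

count : (ℤ → ℕ) → ℤ → ℕ → ℕ
count f b zero    = 0
count f b (suc m) = count f b m ℕ.+ f (b + + m)

Within : ℤ → ℕ → ℤ → Set
Within b m x = b ≤ x × x < b + + m

within-split : ∀ {b m x} → Within b (suc m) x → x ≡ b + + m ⊎ Within b m x
within-split {b} {m} {x} (b≤x , x<) with x <? b + + m
... | yes p = inj₂ (b≤x , p)
... | no ¬p = inj₁ (lin (𝕒 ≺ 𝕓 ⊕ (con (+ 1) ⊕ 𝕔) ∷ 𝕓 ⊕ 𝕔 ≼ 𝕒 ∷ []) (𝕒 ≈ 𝕓 ⊕ 𝕔) (x ∷ b ∷ + m ∷ []) (x< , ≮⇒≥ ¬p))

within-empty : ∀ {b x} → ¬ Within b 0 x
within-empty {b} {x} (b≤x , x<) =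
  lin (𝕓 ≼ 𝕒 ∷ 𝕒 ≺ 𝕓 ⊕ con (+ 0) ∷ []) absurd (x ∷ b ∷ []) (b≤x , x<)

count-cong : ∀ {f h} b m → (∀ x → f x ≡ h x) → count f b m ≡ count h b m
count-cong b zero    eq = refl
count-cong b (suc m) eq = cong₂ ℕ._+_ (count-cong b m eq) (eq _)

count-+ : ∀ f h b m → count (λ x → f x ℕ.+ h x) b m ≡ count f b m ℕ.+ count h b m
count-+ f h b zero    = refl
count-+ f h b (suc m) rewrite count-+ f h b m =
  interchange (count f b m) (count h b m) (f (b + + m)) (h (b + + m))
  where
  interchange : ∀ p q r t → p ℕ.+ q ℕ.+ (r ℕ.+ t) ≡ p ℕ.+ r ℕ.+ (q ℕ.+ t)
  interchange = ℕSolver.solve-∀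

search : ∀ f h b m → (∃[ i ] f i ℕ.< h i) ⊎ count h b m ℕ.≤ count f b m
search f h b zero = inj₂ z≤n
search f h b (suc m) with f (b + + m) ℕ.<? h (b + + m) | search f h b m
... | yes p | _      = inj₁ (_ , p)
... | no _  | inj₁ p = inj₁ p
... | no ¬p | inj₂ q = inj₂ (ℕ.+-mono-≤ q (ℕ.≮⇒≥ ¬p))

-- The pigeonhole principle behind the flow: when the counts agree, an excess of `f` at one place
-- forces an excess of `h` at another. The place itself is returned because it becomes an entry of a
-- pattern.
search-strict : ∀ f h b m {x} → Within b m x → h x ℕ.< f x →
  (∃[ i ] f i ℕ.< h i) ⊎ count h b m ℕ.< count f b m
search-strict f h b zero {x} w _ = contradiction w (within-empty {x = x})
search-strict f h b (suc m) {x} w h<f with within-split {b} {m} {x} w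
... | inj₁ refl with search f h b m
...   | inj₁ p = inj₁ p
...   | inj₂ q = inj₂ (ℕ.+-mono-≤-< q h<f)
search-strict f h b (suc m) {x} w h<f | inj₂ w′
  with f (b + + m) ℕ.<? h (b + + m) | search-strict f h b m w′ h<f
... | yes p | _      = inj₁ (_ , p)
... | no _  | inj₁ p = inj₁ p
... | no ¬p | inj₂ q = inj₂ (ℕ.+-mono-<-≤ q (ℕ.≮⇒≥ ¬p))

le is : ℤ → ℤ → ℕ
le c x = if does (x ≤? c) then 1 else 0
is c x = if does (x ≟ c) then 1 else 0

le-yes : ∀ {c x} → x ≤ c → le c x ≡ 1
le-yes {c} {x} p rewrite dec-true (x ≤? c) p = refl

le-no : ∀ {c x} → c < x → le c x ≡ 0
le-no {c} {x} p rewrite dec-false (x ≤? c) (<⇒≱ p) = refl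

le-< : ∀ {c x y} → le c x ℕ.< le c y → c < x × y ≤ c
le-< {c} {x} {y} p with x ≤? c | y ≤? c
... | no ¬q | yes r = ≰⇒> ¬q , r
le-< (s≤s ()) | yes _ | yes _
le-< () | yes _ | no _
le-< () | no _ | no _

is-yes : ∀ {c x} → x ≡ c → is c x ≡ 1
is-yes {c} {x} p rewrite dec-true (x ≟ c) p = refl

is-no : ∀ {c x} → x ≢ c → is c x ≡ 0
is-no {c} {x} p rewrite dec-false (x ≟ c) p = refl

count-is-outside : ∀ {c b} m → b + + m ≤ c → count (is c) b m ≡ 0
count-is-outside zero _ = refl
count-is-outside {c} {b} (suc m) p = cong₂ ℕ._+_
  (count-is-outside m (<⇒≤ end<c)) (is-no {c} {b + + m} λ { refl → <-irrefl refl end<c })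
  where
  end<c : b + + m < c
  end<c = lin (𝕓 ⊕ (con (+ 1) ⊕ 𝕔) ≼ 𝕒 ∷ []) (𝕓 ⊕ 𝕔 ≺ 𝕒) (c ∷ b ∷ + m ∷ []) p

count-is : ∀ {c b} m → Within b m c → count (is c) b m ≡ 1
count-is {c} zero w = contradiction w (within-empty {x = c})
count-is {c} {b} (suc m) w with within-split {b} {m} {c} w
... | inj₁ refl = cong₂ ℕ._+_ (count-is-outside m ≤-refl) (is-yes {c} refl)
... | inj₂ w′ = cong₂ ℕ._+_ (count-is m w′) (is-no {c} {b + + m} λ { refl → <-irrefl refl (proj₂ w′) })

-- Words and the exchange property

module Words (k : Kind) (n : ℕ) (adm : Admissible k n) where
  open Generators k n adm public

  ev : Word → ℤ → ℤ
  ev = eval k n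

  ev-++ : ∀ us vs x → ev (us ++ vs) x ≡ ev us (ev vs x)
  ev-++ []       vs x = refl
  ev-++ (a ∷ us) vs x = cong (s a) (ev-++ us vs x)

  ev-commutes : ∀ {ws} → All V ws → Commutes k n (ev ws)
  ev-commutes []       = commutes-id
  ev-commutes (v ∷ vs) = commutes-∘ (s-commutes v) (ev-commutes vs)

  ev-injective : ∀ {ws} → All V ws → ∀ {x y} → ev ws x ≡ ev ws y → x ≡ y
  ev-injective []       eq = eq
  ev-injective (v ∷ vs) eq = ev-injective vs (s-injective v eq)

  ev-unf : ∀ {ws} → All V ws → ∀ {x} → Unf x → Unf (ev ws x)
  ev-unf []       u = u
  ev-unf (v ∷ vs) u = s-unf v (ev-unf vs u)

  ev-frozen : ∀ {ws} → All V ws → ∀ {x} → ¬ Unf x → ev ws x ≡ x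
  ev-frozen []       ¬u = refl
  ev-frozen (v ∷ vs) ¬u = trans (cong (s _) (ev-frozen vs ¬u)) (s-frozen v ¬u)

  preimage : ∀ {ws} → All V ws → ∀ y → ∃[ x ] ev ws x ≡ y
  preimage []       y = y , refl
  preimage {a ∷ ws} (v ∷ vs) y with preimage vs (s a y)
  ... | x , eq = x , trans (cong (s a) eq) (s-involutive v y)

  -- A bound for how far a word moves any integer; each letter contributes 2, the largest gap.
  span : Word → ℤ
  span []       = + 0
  span (a ∷ ws) = + 2 + span ws

  span≥0 : ∀ ws → + 0 ≤ span ws
  span≥0 []       = ≤-refl
  span≥0 (a ∷ ws) = lin (con (+ 0) ≼ 𝕒 ∷ []) (con (+ 0) ≼ con (+ 2) ⊕ 𝕒) (span ws ∷ []) (span≥0 ws)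

  ev-bounded : ∀ ws x → ev ws x ≤ x + span ws × x ≤ ev ws x + span ws
  ev-bounded [] x = lin [] (𝕒 ≼ 𝕒 ⊕ con (+ 0)) (x ∷ []) tt , lin [] (𝕒 ≼ 𝕒 ⊕ con (+ 0)) (x ∷ []) tt
  ev-bounded (a ∷ ws) x with ev-bounded ws x | s-bounded a (ev ws x)
  ... | p , q | p′ , q′ =
    lin (𝕓 ≼ 𝕒 ⊕ 𝕕 ∷ 𝕔 ≼ 𝕓 ⊕ con (+ 2) ∷ []) (𝕔 ≼ 𝕒 ⊕ (con (+ 2) ⊕ 𝕕))
      (x ∷ ev ws x ∷ s a (ev ws x) ∷ span ws ∷ []) (p , p′) ,
    lin (𝕒 ≼ 𝕓 ⊕ 𝕕 ∷ 𝕓 ≼ 𝕔 ⊕ con (+ 2) ∷ []) (𝕒 ≼ 𝕔 ⊕ (con (+ 2) ⊕ 𝕕))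
      (x ∷ ev ws x ∷ s a (ev ws x) ∷ span ws ∷ []) (q , q′)

  -- Two pairs exchanged by the same generator differ by a symmetry, which carries the
  -- values of w on the one to the values on the other.
  related : ∀ {w} → Commutes k n w → ∀ {a x y} → L a x → L a y →
    (∃[ c ] Tr k n c × y ≡ x + c × w y ≡ w x + c × w (y + g a) ≡ w (x + g a) + c) ⊎
    (∃[ c ] Rf k n c × y ≡ c - (x + g a) × w y ≡ c - w (x + g a) × w (y + g a) ≡ c - w x)
  related {w} cw {a} {x} {y} l l′ with orbit-related l l′
  ... | inj₁ t = inj₁ (y - x , t , y≡ , trans (cong w y≡) (cw .shift x t) ,
    trans (cong w (lin [] (𝕓 ⊕ 𝕔 ≈ 𝕒 ⊕ 𝕔 ⊕ (𝕓 ⊖ 𝕒)) (x ∷ y ∷ g a ∷ []) tt)) (cw .shift (x + g a) t))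
    where
    y≡ : y ≡ x + (y - x)
    y≡ = lin [] (𝕓 ≈ 𝕒 ⊕ (𝕓 ⊖ 𝕒)) (x ∷ y ∷ []) tt
  ... | inj₂ r = inj₂ (y + x + g a , r , y≡ , trans (cong w y≡) (cw .flip (x + g a) r) ,
    trans (cong w (lin [] (𝕓 ⊕ 𝕔 ≈ 𝕓 ⊕ 𝕒 ⊕ 𝕔 ⊖ 𝕒) (x ∷ y ∷ g a ∷ []) tt)) (cw .flip x r))
    where
    y≡ : y ≡ y + x + g a - (x + g a)
    y≡ = lin [] (𝕓 ≈ 𝕓 ⊕ 𝕒 ⊕ 𝕔 ⊖ (𝕒 ⊕ 𝕔)) (x ∷ y ∷ g a ∷ []) tt

  descent-transport : ∀ {w} → Commutes k n w → ∀ {a x y} → L a x → L a y →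
    w (x + g a) < w x → w (y + g a) < w y
  descent-transport {w} cw {a} {x} {y} l l′ d with related cw l l′
  ... | inj₁ (c , _ , _ , p , q) = subst₂ _<_ (sym q) (sym p)
    (lin (𝕒 ≺ 𝕓 ∷ []) (𝕒 ⊕ 𝕔 ≺ 𝕓 ⊕ 𝕔) (w (x + g a) ∷ w x ∷ c ∷ []) d)
  ... | inj₂ (c , _ , _ , p , q) = subst₂ _<_ (sym q) (sym p)
    (lin (𝕒 ≺ 𝕓 ∷ []) (𝕔 ⊖ 𝕓 ≺ 𝕔 ⊖ 𝕒) (w (x + g a) ∷ w x ∷ c ∷ []) d)

  -- Since `u` commutes with the symmetries, carrying one pair of `a` in order to a pair of `b`
  -- means carrying the whole orbit to the whole orbit. Hence `s b` after `u` is `u` after `s a`.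
  module Conjugation {u : ℤ → ℤ} (cu : Commutes k n u) (inj : ∀ {x y} → u x ≡ u y → x ≡ y)
    {a b : ℕ} {p : ℤ} (va : V a) (vb : V b) (lp : L a p) (lup : L b (u p)) (step : u (p + g a) ≡ u p + g b) where

    onPairs : ∀ {z} → L a z → L b (u z) × u (z + g a) ≡ u z + g b
    onPairs {z} l with related cu lp l
    ... | inj₁ (c , t , _ , eq , eq′) = subst (L b) (sym eq) (orbit-shift lup t) ,
      lin (𝕒 ≈ 𝕓 ⊕ 𝕔 ∷ 𝕓 ≈ 𝕕 ⊕ 𝕖 ∷ 𝕗 ≈ 𝕕 ⊕ 𝕔 ∷ []) (𝕒 ≈ 𝕗 ⊕ 𝕖)
        (u (z + g a) ∷ u (p + g a) ∷ c ∷ u p ∷ g b ∷ u z ∷ []) (eq′ , step , eq)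
    ... | inj₂ (c , r , _ , eq , eq′) =
      subst (L b) (trans (cong (λ v → c - v) (sym step)) (sym eq)) (orbit-flip lup r) ,
      lin (𝕒 ≈ 𝕔 ⊖ 𝕕 ∷ 𝕓 ≈ 𝕕 ⊕ 𝕖 ∷ 𝕗 ≈ 𝕔 ⊖ 𝕓 ∷ []) (𝕒 ≈ 𝕗 ⊕ 𝕖)
        (u (z + g a) ∷ u (p + g a) ∷ c ∷ u p ∷ g b ∷ u z ∷ []) (eq′ , step , eq)

    fromPairs : ∀ {y} → L b y → ∃[ z ] L a z × u z ≡ y
    fromPairs {y} l with related commutes-id lup l
    ... | inj₁ (c , t , eq , _) = p + c , orbit-shift lp t , trans (cu .shift p t) (sym eq)
    ... | inj₂ (c , r , eq , _) = c - (p + g a) , orbit-flip lp r ,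
      trans (cu .flip (p + g a) r) (trans (cong (λ v → c - v) step) (sym eq))

    conjugate : ∀ z → u (s a z) ≡ s b (u z)
    conjugate z with moves a z
    ... | up l eq = trans (cong u eq) (trans (proj₂ (onPairs l)) (sym (s-lower vb (proj₁ (onPairs l)))))
    ... | down y l refl eq = trans (cong u eq)
      (sym (trans (cong (s b) (proj₂ (onPairs l))) (s-upper vb (proj₁ (onPairs l)))))
    ... | still ¬l ¬u eq with moves b (u z)
    ...   | still _ _ eq′ = trans (cong u eq) (sym eq′)
    ...   | up l _ with fromPairs l
    ...     | x , lx , ux≡ = contradiction (subst (L a) (inj ux≡) lx) ¬l
    conjugate z | still ¬l ¬u eq | down y l uz≡ _ with fromPairs l
    ...     | x , lx , ux≡ = contradiction
      (inj (trans uz≡ (trans (cong (_+ g b) (sym ux≡)) (sym (proj₂ (onPairs lx)))))) (¬u x lx)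

  -- Follow the values at `p` and `p + g a` as letters are added from the right. They start in order
  -- and end reversed, so by `s-monotone` some letter `b` swaps exactly these two values. By
  -- `conjugate`, deleting it amounts to multiplying by `s a` on the right.
  exchange : ∀ {ws} → All V ws → ∀ {a p} → V a → L a p → ev ws (p + g a) < ev ws p →
    ∃[ vs ] All V vs × suc (length vs) ≡ length ws × (∀ x → ev vs x ≡ ev ws (s a x))
  exchange [] {a} {p} va lp d = contradiction (lower<upper a p) (<-asym d)
  exchange {b ∷ us} (vb ∷ vus) {a} {p} va lp d with <-cmp (ev us p) (ev us (p + g a))
  ... | tri≈ _ eq _ = contradiction (ev-injective vus eq) (<⇒≢ (lower<upper a p))
  ... | tri> _ _ d′ with exchange vus va lp d′
  ...   | vs , vvs , len , eq = b ∷ vs , vb ∷ vvs , cong suc len , λ x → cong (s b) (eq x)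
  exchange {b ∷ us} (vb ∷ vus) {a} {p} va lp d | tri< u<u′ _ _ with s b (ev us p) ≟ ev us (p + g a)
  ... | no neq = contradiction
    (s-monotone vb (ev-unf vus (lower-unf va lp)) (ev-unf vus (upper-unf va lp)) u<u′ neq) (<-asym d)
  ... | yes eq with moves b (ev us p)
  ...   | still _ _ eq′ = contradiction (trans (sym eq′) eq) (<⇒≢ u<u′)
  ...   | down y _ u≡ eq′ = contradiction u<u′ (<-asym
    (subst₂ _<_ (trans (sym eq′) eq) (sym u≡) (lower<upper b y)))
  ...   | up l eq′ = us , vus , refl , λ x → sym (trans (sym (conjugate (s a x))) (cong (ev us) (s-involutive va x)))
    where open Conjugation (ev-commutes vus) (ev-injective vus) va vb lp l (trans (sym eq) eq′)

  -- The flow across an unfrozen cut c: as many integers are moved up across c as down.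

  below : ∀ {a c} → V a → Unf c → ∀ {y} → y ≤ c → ¬ (y ≡ c × L a c) → s a y ≤ c
  below {a} {c} v u {y} y≤c ¬e with moves a y
  ... | up l eq = subst (_≤ c) (sym eq) (lower-adjacent v l u (≤∧≢⇒< y≤c λ { refl → ¬e (refl , l) }))
  ... | down z l refl eq = subst (_≤ c) (sym eq) (≤-trans (<⇒≤ (lower<upper a z)) y≤c)
  ... | still _ _ eq = subst (_≤ c) (sym eq) y≤c

  above : ∀ {a c} → V a → Unf c → ∀ {y} → c < y → ¬ (y ≡ c + g a × L a c) → c < s a y
  above {a} {c} v u {y} c<y ¬e with moves a y
  ... | up l eq = subst (c <_) (sym eq) (<-trans c<y (lower<upper a y))
  ... | down z l refl eq = subst (c <_) (sym eq)
    (≤∧≢⇒< (upper-adjacent v l u c<y) λ { refl → ¬e (refl , l) })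
  ... | still _ _ eq = subst (c <_) (sym eq) c<y

  -- Only two values cross the cut: `c` goes up and `c + g a` comes down. Each loss is written as a
  -- gain on the other side to avoid subtraction of natural numbers.
  le-step : ∀ {a c} → V a → Unf c → L a c → ∀ y →
    le c (s a y) ℕ.+ is c y ≡ le c y ℕ.+ is (c + g a) y
  le-step {a} {c} v u l y with <-cmp y c
  ... | tri< y<c y≢c _
    rewrite le-yes (below v u (<⇒≤ y<c) λ (e , _) → y≢c e) | is-no y≢c | le-yes (<⇒≤ y<c)
          | is-no (<⇒≢ (<-trans y<c (lower<upper a c))) = refl
  ... | tri≈ _ refl _
    rewrite s-lower v l | le-no (lower<upper a y) | is-yes {y} refl | le-yes {y} ≤-refl
          | is-no (<⇒≢ (lower<upper a y)) = refl
  ... | tri> _ y≢c c<y with y ≟ c + g a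
  ...   | yes refl
    rewrite s-upper v l | le-yes {c} ≤-refl | is-no y≢c | le-no (lower<upper a c) = refl
  ...   | no neq
    rewrite le-no (above v u c<y λ (e , _) → neq e) | is-no y≢c | le-no c<y = refl

  le-fixed : ∀ {a c} → V a → Unf c → ¬ L a c → ∀ y → le c (s a y) ≡ le c y
  le-fixed {a} {c} v u ¬l y with y ≤? c
  ... | yes p = le-yes (below v u p λ (_ , l) → ¬l l)
  ... | no ¬p = le-no (above v u (≰⇒> ¬p) λ (_ , l) → ¬l l)

  count-preimage : ∀ {ws} → All V ws → ∀ {y b m x} → ev ws x ≡ y → Within b m x →
    count (λ z → is y (ev ws z)) b m ≡ 1
  count-preimage {ws} vs {y} {b} {m} {x} refl w = trans (count-cong b m same) (count-is m w)
    where
    same : ∀ z → is (ev ws x) (ev ws z) ≡ is x z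
    same z with z ≟ x
    ... | yes refl = is-yes {ev ws x} refl
    ... | no z≢x = is-no λ e → z≢x (ev-injective vs e)

  -- A letter either leaves the cut alone or sends one value up across it and one down, and these
  -- cancel if both are taken at positions inside the interval. A position is within `span` of its
  -- value, and `c + g a` is at most 2 beyond `c`; hence the radius.
  balanced : ∀ {ws} → All V ws → ∀ {c} → Unf c → ∀ M → span ws + + 2 ≤ + M →
    count (λ x → le c (ev ws x)) (c - + M) (M ℕ.+ M) ≡ count (le c) (c - + M) (M ℕ.+ M)
  balanced [] u M _ = refl
  balanced {a ∷ us} (va ∷ vus) {c} u M bound with IH ← balanced vus u M
      (lin (con (+ 2) ⊕ 𝕒 ⊕ con (+ 2) ≼ 𝕓 ∷ []) (𝕒 ⊕ con (+ 2) ≼ 𝕓) (span us ∷ + M ∷ []) bound)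
    | moves a c
  ... | still ¬l _ _ = trans (count-cong _ (M ℕ.+ M) λ x → le-fixed va u ¬l (ev us x)) IH
  ... | down y l refl _ = trans (count-cong _ (M ℕ.+ M) λ x → le-fixed va u (lower-not-upper va l) (ev us x)) IH
  -- The added 1 counts the single position with value `c` on the left and the single one with value
  -- `c + g a` on the right.
  ... | up l _ = trans (ℕ.+-cancelʳ-≡ 1 _ _ (begin
      count (λ x → le c (s a (ev us x))) b m ℕ.+ 1
        ≡⟨ cong (count (λ x → le c (s a (ev us x))) b m ℕ.+_) (sym (hit c ≤-refl
             (lin (con (+ 0) ≺ 𝕓 ∷ 𝕓 ≼ con (+ 2) ∷ []) (𝕒 ≼ 𝕒 ⊕ con (+ 2)) (c ∷ g a ∷ []) (gap>0 k n a , gap≤2)))) ⟩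
      count (λ x → le c (s a (ev us x))) b m ℕ.+ count (λ x → is c (ev us x)) b m
        ≡⟨ sym (count-+ _ _ b m) ⟩
      count (λ x → le c (s a (ev us x)) ℕ.+ is c (ev us x)) b m
        ≡⟨ count-cong b m (λ x → le-step va u l (ev us x)) ⟩
      count (λ x → le c (ev us x) ℕ.+ is (c + g a) (ev us x)) b m
        ≡⟨ count-+ _ _ b m ⟩
      count (λ x → le c (ev us x)) b m ℕ.+ count (λ x → is (c + g a) (ev us x)) b m
        ≡⟨ cong (count (λ x → le c (ev us x)) b m ℕ.+_) (hit (c + g a)
             (<⇒≤ (lower<upper a c))
             (lin (𝕓 ≼ con (+ 2) ∷ []) (𝕒 ⊕ 𝕓 ≼ 𝕒 ⊕ con (+ 2)) (c ∷ g a ∷ []) gap≤2)) ⟩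
      count (λ x → le c (ev us x)) b m ℕ.+ 1 ∎)) IH
    where
    open ≡-Reasoning
    b = c - + M
    m = M ℕ.+ M

    gap≤2 : g a ≤ + 2
    gap≤2 with g a | gap-1-or-2 k n a
    ... | _ | inj₁ refl = +≤+ (s≤s z≤n)
    ... | _ | inj₂ refl = ≤-refl

    hit : ∀ y → c ≤ y → y ≤ c + + 2 → count (λ x → is y (ev us x)) b m ≡ 1
    hit y c≤y y≤c+2 with preimage vus y
    ... | x , refl = count-preimage vus refl
      ( lin (con (+ 2) ⊕ 𝕒 ⊕ con (+ 2) ≼ 𝕓 ∷ 𝕕 ≼ 𝕔 ⊕ 𝕒 ∷ 𝕖 ≼ 𝕕 ∷ []) (𝕖 ⊖ 𝕓 ≼ 𝕔)
          (span us ∷ + M ∷ x ∷ ev us x ∷ c ∷ []) (bound , proj₁ (ev-bounded us x) , c≤y)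
      , lin (con (+ 2) ⊕ 𝕒 ⊕ con (+ 2) ≼ 𝕓 ∷ 𝕔 ≼ 𝕕 ⊕ 𝕒 ∷ 𝕕 ≼ 𝕖 ⊕ con (+ 2) ∷ []) (𝕔 ≺ 𝕖 ⊖ 𝕓 ⊕ (𝕓 ⊕ 𝕓))
          (span us ∷ + M ∷ x ∷ ev us x ∷ c ∷ []) (bound , proj₂ (ev-bounded us x) , y≤c+2))

  module Flow {ws : Word} (vs : All V ws) {c : ℤ} (u : Unf c) where
    M : ℕ
    M = ∣ span ws + + 2 ∣

    M-bound : span ws + + 2 ≡ + M
    M-bound = sym (0≤i⇒+∣i∣≡i (lin (con (+ 0) ≼ 𝕒 ∷ []) (con (+ 0) ≼ 𝕒 ⊕ con (+ 2)) (span ws ∷ []) (span≥0 ws)))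

    equal : count (λ x → le c (ev ws x)) (c - + M) (M ℕ.+ M) ≡ count (le c) (c - + M) (M ℕ.+ M)
    equal = balanced vs u M (≤-reflexive M-bound)

    down⇒up : ∀ {x} → c < x → ev ws x ≤ c → ∃[ i ] i ≤ c × c < ev ws i
    down⇒up {x} c<x wx≤c with search-strict (λ x → le c (ev ws x)) (le c) (c - + M) (M ℕ.+ M) {x}
      ( lin (𝕓 ⊕ con (+ 2) ≈ 𝕔 ∷ con (+ 0) ≼ 𝕓 ∷ 𝕕 ≺ 𝕒 ∷ []) (𝕕 ⊖ 𝕔 ≼ 𝕒)
          (x ∷ span ws ∷ + M ∷ c ∷ []) (M-bound , span≥0 ws , c<x)
      , lin (𝕓 ⊕ con (+ 2) ≈ 𝕔 ∷ 𝕖 ≼ 𝕕 ∷ 𝕒 ≼ 𝕖 ⊕ 𝕓 ∷ []) (𝕒 ≺ 𝕕 ⊖ 𝕔 ⊕ (𝕔 ⊕ 𝕔))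
          (x ∷ span ws ∷ + M ∷ c ∷ ev ws x ∷ []) (M-bound , wx≤c , proj₂ (ev-bounded ws x)) )
      (subst₂ ℕ._<_ (sym (le-no c<x)) (sym (le-yes wx≤c)) (s≤s z≤n))
    ... | inj₁ (i , p) with le-< {c} {ev ws i} {i} p
    ...   | c<wi , i≤c = i , i≤c , c<wi
    down⇒up c<x wx≤c | inj₂ q = contradiction (sym equal) (ℕ.<⇒≢ q)

    up⇒down : ∀ {x} → x ≤ c → c < ev ws x → ∃[ i ] c < i × ev ws i ≤ c
    up⇒down {x} x≤c c<wx with search-strict (le c) (λ x → le c (ev ws x)) (c - + M) (M ℕ.+ M) {x}
      ( lin (𝕓 ⊕ con (+ 2) ≈ 𝕔 ∷ 𝕕 ≺ 𝕖 ∷ 𝕖 ≼ 𝕒 ⊕ 𝕓 ∷ []) (𝕕 ⊖ 𝕔 ≼ 𝕒)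
          (x ∷ span ws ∷ + M ∷ c ∷ ev ws x ∷ []) (M-bound , c<wx , proj₁ (ev-bounded ws x))
      , lin (𝕓 ⊕ con (+ 2) ≈ 𝕔 ∷ con (+ 0) ≼ 𝕓 ∷ 𝕒 ≼ 𝕕 ∷ []) (𝕒 ≺ 𝕕 ⊖ 𝕔 ⊕ (𝕔 ⊕ 𝕔))
          (x ∷ span ws ∷ + M ∷ c ∷ []) (M-bound , span≥0 ws , x≤c) )
      (subst₂ ℕ._<_ (sym (le-no c<wx)) (sym (le-yes x≤c)) (s≤s z≤n))
    ... | inj₁ (i , p) with le-< {c} {i} {ev ws i} p
    ...   | c<i , wi≤c = i , c<i , wi≤c
    up⇒down x≤c c<wx | inj₂ q = contradiction equal (ℕ.<⇒≢ q)

-- Disarray under right multiplication by a generator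

sum-zero : ∀ n {D} → (∀ j → j ℕ.< n → D (suc j) ≡ + 0) → sumℤ1to n D ≡ + 0
sum-zero zero    z = refl
sum-zero (suc n) z = cong₂ _+_ (sum-zero n λ j p → z j (ℕ.m<n⇒m<1+n p)) (z n ℕ.≤-refl)

sum-one : ∀ n {D i} → i ℕ.< n → (∀ j → j ℕ.< n → j ≢ i → D (suc j) ≡ + 0) →
  sumℤ1to n D ≡ D (suc i)
sum-one (suc n) {D} {i} i<n z with i ℕ.≟ n
... | yes refl = trans
  (cong (_+ D (suc n)) (sum-zero n λ j p → z j (ℕ.m<n⇒m<1+n p) (ℕ.<⇒≢ p))) (+-identityˡ _)
... | no i≢n = trans
  (cong₂ _+_ (sum-one n (ℕ.≤∧≢⇒< (ℕ.≤-pred i<n) i≢n) λ j p → z j (ℕ.m<n⇒m<1+n p)) (z n ℕ.≤-refl (i≢n ∘ sym)))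
  (+-identityʳ _)

sum-two : ∀ n {D i j} → i ℕ.< j → j ℕ.< n → (∀ h → h ℕ.< n → h ≢ i → h ≢ j → D (suc h) ≡ + 0) →
  sumℤ1to n D ≡ D (suc i) + D (suc j)
sum-two (suc n) {D} {i} {j} i<j j<n z with j ℕ.≟ n
... | yes refl = cong (_+ D (suc n))
  (sum-one n i<j λ h p h≢i → z h (ℕ.m<n⇒m<1+n p) h≢i (ℕ.<⇒≢ p))
... | no j≢n = trans
  (cong₂ _+_ (sum-two n i<j (ℕ.≤∧≢⇒< (ℕ.≤-pred j<n) j≢n) λ h p → z h (ℕ.m<n⇒m<1+n p))
    (z n ℕ.≤-refl (λ { refl → ℕ.<⇒≱ (ℕ.<-trans i<j (ℕ.≤∧≢⇒< (ℕ.≤-pred j<n) j≢n)) ℕ.≤-refl }) (j≢n ∘ sym)))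
  (+-identityʳ _)

same-inner′ : ∀ k {n a i} → suc a ℕ.< n → SameLetter k n (suc a) i → i ≡ suc a
same-inner′ typeA _ eq = sym eq
same-inner′ typeB _ eq = sym eq
same-inner′ typeÃ _ (inj₁ eq) = sym eq
same-inner′ typeÃ a<n (inj₂ (inj₂ (refl , _))) = contradiction a<n (ℕ.<-irrefl refl)
same-inner′ typeC̃ _ eq = sym eq

fixed : ∀ k {n a j} (adm : Admissible k n) → ValidLetter k n a → j ℕ.< n →
  ¬ SameLetter k n a (suc j) → ¬ SameLetter k n a j → gen k n a (+ suc j) ≡ + suc j
fixed k {n} {a} {j} adm v j<n ¬l ¬u with Generators.moves k n adm a (+ suc j)
... | Generators.up l _ = contradiction (lower-letter k adm (letter-view k a adm v) (s≤s z≤n) j<n l) ¬l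
... | Generators.down y l eq _ = contradiction (upper-letter k adm (letter-view k a adm v) j<n
  (subst (Lower k n a) (lin (𝕒 ≈ 𝕓 ⊕ 𝕔 ∷ []) (𝕓 ≈ 𝕒 ⊖ 𝕔) (+ suc j ∷ y ∷ gap k n a ∷ []) eq) l)) ¬u
... | Generators.still _ _ eq = eq

-- The change of the displacement term at position x when the value at y is moved to x.
change : (φ w : ℤ → ℤ) → ℤ → ℤ → ℤ
change φ w x y = φ (w y - x) - φ (w x - x)

change-self : ∀ φ w x → change φ w x x ≡ + 0
change-self φ w x = +-inverseʳ (φ (w x - x))

change-shift : ∀ {k n w} φ → Commutes k n w → ∀ {c} x y → Tr k n c →
  change φ w (x + c) (y + c) ≡ change φ w x y
change-shift {w = w} φ cw {c} x y t = cong₂ _-_ (cong φ (moved y)) (cong φ (moved x))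
  where
  moved : ∀ z → w (z + c) - (x + c) ≡ w z - x
  moved z = lin (𝕒 ≈ 𝕓 ⊕ 𝕔 ∷ []) (𝕒 ⊖ (𝕕 ⊕ 𝕔) ≈ 𝕓 ⊖ 𝕕) (w (z + c) ∷ w z ∷ c ∷ x ∷ []) (cw .shift z t)

change-flip : ∀ {k n w} φ → (∀ x → φ (- x) ≡ φ x) → Commutes k n w → ∀ {c} x y → Rf k n c →
  change φ w (c - x) (c - y) ≡ change φ w x y
change-flip {w = w} φ even cw {c} x y r = cong₂ _-_ (moved y) (moved x)
  where
  moved : ∀ z → φ (w (c - z) - (c - x)) ≡ φ (w z - x)
  moved z = trans
    (cong φ (lin (𝕒 ≈ 𝕔 ⊖ 𝕓 ∷ []) (𝕒 ⊖ (𝕔 ⊖ 𝕕) ≈ ⊝ (𝕓 ⊖ 𝕕)) (w (c - z) ∷ w z ∷ c ∷ x ∷ []) (cw .flip z r)))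
    (even (w z - x))

-- The letters `0` and `n` touch the window at both ends: `1` is the upper end of one pair and `n`
-- the lower end of the next. A shift by `n` brings these two halves together into one whole pair.
affine-case : ∀ {n a} → Admissible typeÃ n → a ≡ 0 ⊎ a ≡ n → ValidLetter typeÃ n a →
  ∀ {w φ} → Commutes typeÃ n w →
  (let D : ℕ → ℤ
       D i = change φ w (+ i) (gen typeÃ n a (+ i))) →
  (∀ {x} i → x ≡ + i → Lower typeÃ n a x → D i ≡ change φ w x (x + + 1)) →
  (∀ {x} i → x + + 1 ≡ + i → Lower typeÃ n a x → D i ≡ change φ w (x + + 1) x) →
  (∀ j → j ℕ.< n → ¬ SameLetter typeÃ n a (suc j) → ¬ SameLetter typeÃ n a j → D (suc j) ≡ + 0) →
  + 1 * sumℤ1to n D ≡ change φ w (+ a) (+ a + + 1) + change φ w (+ a + + 1) (+ a)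
affine-case {suc m} {a} (s≤s 1≤m) ends v {w} {φ} cw at-lower at-upper vanishes =
  trans (*-identityˡ _) (trans
    (sum-two (suc m) {i = 0} {m} 1≤m ℕ.≤-refl λ h h<n h≢0 h≢m →
      vanishes h h<n (¬first ends h≢m) (¬second ends h<n h≢0))
    (trans (cong₂ _+_ (at-upper 1 refl (at-0 ends)) (at-lower (suc m) refl (at-n ends))) (finish ends)))
  where
  at-0 : a ≡ 0 ⊎ a ≡ suc m → Lower typeÃ (suc m) a (+ 0)
  at-0 (inj₁ refl) = translate multiple-0
  at-0 (inj₂ refl) = translate (multiple-≡ (lin [] (⊝ 𝕒 ≈ con (+ 0) ⊖ 𝕒) (+ suc m ∷ []) tt) (multiple-neg (multiple-self {suc m})))
  at-n : a ≡ 0 ⊎ a ≡ suc m → Lower typeÃ (suc m) a (+ suc m)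
  at-n (inj₁ refl) = translate (multiple-≡ (lin [] (𝕒 ≈ 𝕒 ⊖ con (+ 0)) (+ suc m ∷ []) tt) (multiple-self {suc m}))
  at-n (inj₂ refl) = translate (multiple-≡ (lin [] (con (+ 0) ≈ 𝕒 ⊖ 𝕒) (+ suc m ∷ []) tt) multiple-0)
  ¬first : a ≡ 0 ⊎ a ≡ suc m → ∀ {h} → h ≢ m → ¬ SameLetter typeÃ (suc m) a (suc h)
  ¬first (inj₁ refl) h≢m (inj₂ (inj₁ (_ , eq))) = h≢m (ℕ.suc-injective eq)
  ¬first (inj₂ refl) h≢m (inj₁ eq) = h≢m (sym (ℕ.suc-injective eq))
  ¬first (inj₂ refl) h≢m (inj₂ (inj₁ ()))
  ¬first (inj₂ refl) h≢m (inj₂ (inj₂ ()))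
  ¬second : a ≡ 0 ⊎ a ≡ suc m → ∀ {h} → h ℕ.< suc m → h ≢ 0 → ¬ SameLetter typeÃ (suc m) a h
  ¬second (inj₁ refl) h<n h≢0 (inj₁ eq) = h≢0 (sym eq)
  ¬second (inj₁ refl) h<n h≢0 (inj₂ (inj₁ (_ , eq))) = ℕ.<⇒≢ h<n eq
  ¬second (inj₂ refl) h<n h≢0 (inj₁ eq) = ℕ.<⇒≢ h<n (sym eq)
  ¬second (inj₂ refl) h<n h≢0 (inj₂ (inj₂ (_ , eq))) = h≢0 eq
  finish : a ≡ 0 ⊎ a ≡ suc m → change φ w (+ 1) (+ 0) + change φ w (+ suc m) (+ suc m + + 1) ≡
    change φ w (+ a) (+ a + + 1) + change φ w (+ a + + 1) (+ a)
  finish (inj₁ refl) = trans (+-comm (change φ w (+ 1) (+ 0)) _)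
    (cong (_+ change φ w (+ 1) (+ 0)) (trans
      (cong₂ (change φ w) (sym (+-identityˡ (+ suc m))) (+-comm (+ suc m) (+ 1)))
      (change-shift φ cw {+ suc m} (+ 0) (+ 1) (multiple-self {suc m}))))
  finish (inj₂ refl) = trans (+-comm (change φ w (+ 1) (+ 0)) _)
    (cong (λ v → change φ w (+ suc m) (+ suc m + + 1) + v) (trans
      (sym (change-shift φ cw {+ suc m} (+ 1) (+ 0) (multiple-self {suc m})))
      (cong₂ (change φ w) (+-comm (+ 1) (+ suc m)) (+-identityˡ (+ suc m)))))

-- The window contains both positions of a pair of gap 1, but only one position of a pair of gap 2
-- (which lies across a mirror), hence the factor.
window-change : ∀ k {n a} → Admissible k n → ValidLetter k n a → ∀ {w} → Commutes k n w →
  ∀ φ → (Reflective k → ∀ x → φ (- x) ≡ φ x) →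
  gap k n a * sumℤ1to n (λ i → φ (w (gen k n a (+ i)) - + i) - φ (w (+ i) - + i)) ≡
  change φ w (lo k a) (lo k a + gap k n a) + change φ w (lo k a + gap k n a) (lo k a)
window-change k {n} {a} adm v {w} cw φ even = go (letter-view k a adm v)
  where
  D : ℕ → ℤ
  D i = change φ w (+ i) (gen k n a (+ i))

  vanishes : ∀ j → j ℕ.< n → ¬ SameLetter k n a (suc j) → ¬ SameLetter k n a j → D (suc j) ≡ + 0
  vanishes j j<n ¬l ¬u =
    trans (cong (change φ w (+ suc j)) (fixed k adm v j<n ¬l ¬u)) (change-self φ w (+ suc j))

  at-lower : ∀ {x} i → x ≡ + i → Lower k n a x → D i ≡ change φ w x (x + gap k n a)
  at-lower i refl l = cong (change φ w (+ i)) (Generators.s-lower k n adm v l)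

  at-upper : ∀ {x} i → x + gap k n a ≡ + i → Lower k n a x → D i ≡ change φ w (x + gap k n a) x
  at-upper {x} i eq l = subst (λ y → change φ w y (gen k n a y) ≡ change φ w (x + gap k n a) x) eq
    (cong (change φ w (x + gap k n a)) (Generators.s-upper k n adm v l))

  at-lo : Lower k n a (lo k a)
  at-lo = translate (multiple-≡ (lin [] (con (+ 0) ≈ 𝕒 ⊖ 𝕒) (lo k a ∷ []) tt) multiple-0)

  twice-same : ∀ {d x y} → gap k n a ≡ + 2 → d ≡ x → d ≡ y → gap k n a * d ≡ x + y
  twice-same {d} g≡2 refl refl rewrite g≡2 = lin [] ((+ 2) ⊛ 𝕒 ≈ 𝕒 ⊕ 𝕒) (d ∷ []) tt

  go : LetterView k n a → gap k n a * sumℤ1to n D ≡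
    change φ w (lo k a) (lo k a + gap k n a) + change φ w (lo k a + gap k n a) (lo k a)
  go (inner {a = b} a<n) = trans (cong (_* sumℤ1to n D) (gap-inner k a<n)) (trans (*-identityˡ _)
    (trans (sum-two n {D} {b} {suc b} ℕ.≤-refl a<n λ h h<n h≢b h≢sb → vanishes h h<n
        (λ same → h≢b (ℕ.suc-injective (same-inner′ k a<n same))) (λ same → h≢sb (same-inner′ k a<n same)))
      (cong₂ _+_ (at-lower (suc b) (lo-suc k b) at-lo)
        (at-upper (suc (suc b)) (trans (cong₂ _+_ (lo-suc k b) (gap-inner k a<n)) (cong +_ (ℕ.+-comm (suc b) 1))) at-lo))))
  go (affine ends) = affine-case adm ends v {w} {φ} cw at-lower at-upper vanishes
  go bottomB = twice-same refl
    (trans (sum-one n {D} {0} adm λ j j<n j≢0 → vanishes j j<n (λ ()) (j≢0 ∘ sym))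
      (trans (at-upper 1 refl at-lo) (change-flip φ (even tt) cw {+ 0} (- + 1) (+ 1) (tt , multiple-0))))
    (trans (sum-one n {D} {0} adm λ j j<n j≢0 → vanishes j j<n (λ ()) (j≢0 ∘ sym)) (at-upper 1 refl at-lo))
  go bottomC = twice-same refl
    (trans (sum-one n {D} {0} adm λ j j<n j≢0 → vanishes j j<n (λ ()) (j≢0 ∘ sym))
      (trans (at-upper 1 refl at-lo) (change-flip φ (even tt) cw {+ 0} (- + 1) (+ 1) (tt , multiple-0 {2 ℕ.* suc n}))))
    (trans (sum-one n {D} {0} adm λ j j<n j≢0 → vanishes j j<n (λ ()) (j≢0 ∘ sym)) (at-upper 1 refl at-lo))
  go (topC {b}) = twice-same (gap-top b) onTop (trans onTop (trans
    (sym (change-flip φ (even tt) cw {+ (2 ℕ.* suc (suc b))} (+ suc b) (+ suc b + gap typeC̃ (suc b) (suc b)) (rf-period {suc b})))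
    (cong₂ (change φ w) (mirror (gap-top b)) (mirror′ (gap-top b)))))
    where
    onTop : sumℤ1to n D ≡ change φ w (+ suc b) (+ suc b + gap typeC̃ (suc b) (suc b))
    onTop = trans (sum-one n {D} {b} ℕ.≤-refl λ j j<n j≢b → vanishes j j<n (j≢b ∘ sym ∘ ℕ.suc-injective) (ℕ.<⇒≢ j<n ∘ sym))
      (at-lower (suc b) refl at-lo)
    mirror : ∀ {h} → h ≡ + 2 → + (2 ℕ.* suc (suc b)) - + suc b ≡ + suc b + h
    mirror {h} eq = lin (𝕒 ≈ 𝕓 ⊕ 𝕓 ⊕ con (+ 2) ∷ 𝕔 ≈ con (+ 2) ∷ []) (𝕒 ⊖ 𝕓 ≈ 𝕓 ⊕ 𝕔)
      (+ (2 ℕ.* suc (suc b)) ∷ + suc b ∷ h ∷ []) (double (suc b) , eq)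
    mirror′ : ∀ {h} → h ≡ + 2 → + (2 ℕ.* suc (suc b)) - (+ suc b + h) ≡ + suc b
    mirror′ {h} eq = lin (𝕒 ≈ 𝕓 ⊕ 𝕓 ⊕ con (+ 2) ∷ 𝕔 ≈ con (+ 2) ∷ []) (𝕒 ⊖ (𝕓 ⊕ 𝕔) ≈ 𝕓)
      (+ (2 ℕ.* suc (suc b)) ∷ + suc b ∷ h ∷ []) (double (suc b) , eq)

-- Elements of the groups

-- A form of membership that right multiplication by generators preserves uniformly. `centred`
-- restates the window sum of the affine symmetric group as a vanishing total displacement, the
-- shape to which `window-change` applies.
record IsElement (k : Kind) (n : ℕ) (w : ℤ → ℤ) : Set where
  field
    commutes   : Commutes k n w
    injective  : ∀ {x y} → w x ≡ w y → x ≡ y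
    surjective : ∀ y → ∃[ x ] w x ≡ y
    frozen     : ∀ {x} → ¬ Unfrozen k n x → w x ≡ x
    centred    : k ≡ typeÃ → sumℤ1to n (λ i → w (+ i) - + i) ≡ + 0

open IsElement public

module _ {p : ℕ} {w : ℤ → ℤ} (shift-p : ∀ x → w (x + + p) ≡ w x + + p) where

  shift-ℕ : ∀ m x → w (x + + m * + p) ≡ w x + + m * + p
  shift-ℕ zero    x = trans (cong w (+-identityʳ x)) (sym (+-identityʳ (w x)))
  shift-ℕ (suc m) x = begin
    w (x + + suc m * + p)         ≡⟨ cong w (regroup x) ⟩
    w (x + + m * + p + + p)       ≡⟨ shift-p _ ⟩
    w (x + + m * + p) + + p       ≡⟨ cong (_+ + p) (shift-ℕ m x) ⟩
    w x + + m * + p + + p         ≡⟨ sym (regroup (w x)) ⟩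
    w x + + suc m * + p           ∎
    where
    open ≡-Reasoning
    regroup : ∀ y → y + + suc m * + p ≡ y + + m * + p + + p
    regroup y = lin (𝕓 ≈ 𝕔 ⊕ 𝕕 ∷ []) (𝕒 ⊕ 𝕓 ≈ 𝕒 ⊕ 𝕕 ⊕ 𝕔) (y ∷ + suc m * + p ∷ + p ∷ + m * + p ∷ []) (suc-* (+ m) (+ p))

  shift-multiple : ∀ {c} x → Multiple p c → w (x + c) ≡ w x + c
  shift-multiple x (+ m , refl) = shift-ℕ m x
  -- A negative shift is undone by a positive one that starts at `x + c`.
  shift-multiple {c} x (-[1+ m ] , eq) =
    lin (𝕒 ≈ 𝕓 ⊕ 𝕔 ∷ 𝕔 ≈ ⊝ 𝕕 ∷ []) (𝕓 ≈ 𝕒 ⊕ 𝕕) (w x ∷ w (x + c) ∷ + suc m * + p ∷ c ∷ [])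
      ( trans (cong w (lin (𝕓 ≈ ⊝ 𝕔 ∷ []) (𝕒 ≈ 𝕒 ⊕ 𝕔 ⊕ 𝕓) (x ∷ + suc m * + p ∷ c ∷ []) back)) (shift-ℕ (suc m) (x + c))
      , back )
    where
    back : + suc m * + p ≡ - c
    back = sym (trans (cong -_ eq) (neg-distribˡ-* -[1+ m ] (+ p)))

centre-fixed : ∀ {k n w f} → Commutes k n w → Rf k n (f + f) → w f ≡ f
centre-fixed {w = w} {f} cw r =
  lin (𝕒 ≈ 𝕓 ⊕ 𝕓 ⊖ 𝕒 ∷ []) (𝕒 ≈ 𝕓) (w f ∷ f ∷ [])
    (trans (cong w (lin [] (𝕒 ≈ 𝕒 ⊕ 𝕒 ⊖ 𝕒) (f ∷ []) tt)) (cw .flip f r))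

sum-∸ : ∀ n (f h : ℕ → ℤ) → sumℤ1to n (λ i → f i - h i) ≡ sumℤ1to n f - sumℤ1to n h
sum-∸ zero    f h = refl
sum-∸ (suc n) f h rewrite sum-∸ n f h =
  lin [] (𝕒 ⊖ 𝕓 ⊕ (𝕔 ⊖ 𝕕) ≈ 𝕒 ⊕ 𝕔 ⊖ (𝕓 ⊕ 𝕕)) (sumℤ1to n f ∷ sumℤ1to n h ∷ f (suc n) ∷ h (suc n) ∷ []) tt

sum-window : ∀ n → sumℤ1to n (λ i → + i) ≡ + (suc n C 2)
sum-window zero    = refl
sum-window (suc n) = trans (cong (_+ + suc n) (sum-window n)) (cong +_ (trans
  (ℕ.+-comm (suc n C 2) (suc n))
  (trans (cong (ℕ._+ (suc n C 2)) (sym (nC1≡n (suc n)))) (nCk+nC[k+1]≡[n+1]C[k+1] (suc n) 1))))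

InW⇒IsElement : ∀ k {n w} → InW k n w → IsElement k n w
InW⇒IsElement typeA {n} {w} ((inj , surj) , fixed) = record
  { commutes = record
    { shift = λ x t → translated x (multiple-of-0 t)
    ; flip = λ { x (() , _) } }
  ; injective = inj
  ; surjective = λ y → proj₁ (surj y) , proj₂ (surj y) refl
  ; frozen = λ {x} ¬u → fixed x (outside x ¬u)
  ; centred = λ () }
  where
  translated : ∀ x {c} → c ≡ + 0 → w (x + c) ≡ w x + c
  translated x refl = trans (cong w (+-identityʳ x)) (sym (+-identityʳ (w x)))
  outside : ∀ x → ¬ Unfrozen typeA n x → x < + 1 ⊎ + n < x
  outside x ¬u with + 1 ≤? x | x ≤? + n
  ... | yes p | yes q = contradiction (p , q) ¬u
  ... | no ¬p | _     = inj₁ (≰⇒> ¬p)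
  ... | yes _ | no ¬q = inj₂ (≰⇒> ¬q)
InW⇒IsElement typeB {n} {w} ((inj , surj) , odd , fixed) = record
  { commutes = cw
  ; injective = inj
  ; surjective = λ y → proj₁ (surj y) , proj₂ (surj y) refl
  ; frozen = λ {x} → fixes x
  ; centred = λ () }
  where
  cw : Commutes typeB n w
  cw .shift {c} x t with refl ← multiple-of-0 t = trans (cong w (+-identityʳ x)) (sym (+-identityʳ (w x)))
  cw .flip {c} x (_ , t) with refl ← multiple-of-0 t =
    trans (cong w (+-identityˡ (- x))) (trans (odd x) (sym (+-identityˡ (- w x))))
  fixes : ∀ x → ¬ Unfrozen typeB n x → w x ≡ x
  fixes x ¬u with x ≟ + 0 | ∣ x ∣ ℕ.≤? n
  ... | yes refl | _     = centre-fixed cw (tt , multiple-0)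
  ... | no x≢0   | yes p = contradiction (x≢0 , p) ¬u
  ... | no x≢0   | no ¬p = fixed x (ℕ.≰⇒> ¬p)
InW⇒IsElement typeÃ {n} {w} ((inj , surj) , per , norm) = record
  { commutes = record { shift = shift-multiple {w = w} per ; flip = λ { x (() , _) } }
  ; injective = inj
  ; surjective = λ y → proj₁ (surj y) , proj₂ (surj y) refl
  ; frozen = λ ¬u → contradiction tt ¬u
  ; centred = λ _ → trans (sum-∸ n (λ i → w (+ i)) (λ i → + i))
      (lin (𝕒 ≈ 𝕔 ∷ 𝕓 ≈ 𝕔 ∷ []) (𝕒 ⊖ 𝕓 ≈ con (+ 0)) (sumℤ1to n (λ i → w (+ i)) ∷ sumℤ1to n (λ i → + i) ∷ + (suc n C 2) ∷ [])
        (norm , sum-window n)) }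
InW⇒IsElement typeC̃ {n} {w} ((inj , surj) , odd , mirror) = record
  { commutes = cw
  ; injective = inj
  ; surjective = λ y → proj₁ (surj y) , proj₂ (surj y) refl
  ; frozen = λ {x} → fixes x
  ; centred = λ () }
  where
  N = 2 ℕ.* suc n
  -- The translation by the period is the composite of the reflections at `0` and at `n + 1`.
  per : ∀ x → w (x + + N) ≡ w x + + N
  per x = lin (𝕒 ≈ 𝕓 ⊖ 𝕔 ∷ 𝕔 ≈ ⊝ 𝕕 ∷ []) (𝕒 ≈ 𝕕 ⊕ 𝕓) (w (x + + N) ∷ + N ∷ w (- x) ∷ w x ∷ [])
    (trans (cong w (lin [] (𝕒 ⊕ 𝕓 ≈ 𝕓 ⊖ ⊝ 𝕒) (x ∷ + N ∷ []) tt)) (mirror (- x)) , odd x)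
  cw : Commutes typeC̃ n w
  cw .shift = shift-multiple {w = w} per
  cw .flip {c} x (_ , t) = trans (cong w (+-comm c (- x)))
    (trans (shift-multiple {w = w} per (- x) t) (trans (cong (_+ c) (odd x)) (+-comm (- w x) c)))
  fixes : ∀ x → ¬ Unfrozen typeC̃ n x → w x ≡ x
  fixes x ¬u = centre-fixed {typeC̃} {n} cw (frozen-centre {n} {x} ¬u)

sum-nonneg : ∀ n {f} → (∀ i → + 0 ≤ f i) → + 0 ≤ sumℤ1to n f
sum-nonneg zero    p = ≤-refl
sum-nonneg (suc n) p = +-mono-≤ (sum-nonneg n p) (p (suc n))

-- The substantial field is `centred`: with the identity as displacement function, the two terms of
-- `window-change` cancel.
element-∘ : ∀ k {n a w} → Admissible k n → ValidLetter k n a → IsElement k n w →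
  IsElement k n (λ x → w (gen k n a x))
element-∘ k {n} {a} {w} adm v e = record
  { commutes = commutes-∘ (e .commutes) (G.s-commutes v)
  ; injective = λ eq → G.s-injective v (e .injective eq)
  ; surjective = λ y → let (x , eq) = e .surjective y in
      gen k n a x , trans (cong w (G.s-involutive v x)) eq
  ; frozen = λ ¬u → trans (cong w (G.s-frozen v ¬u)) (e .frozen ¬u)
  ; centred = balance k adm v e }
  where
  module G = Generators k n adm
  balance : ∀ k {n a w} → Admissible k n → ValidLetter k n a → IsElement k n w →
    k ≡ typeÃ → sumℤ1to n (λ i → w (gen k n a (+ i)) - + i) ≡ + 0
  balance typeÃ {n} {a} {w} adm v e refl =
    lin (𝕒 ≈ 𝕓 ⊖ 𝕔 ∷ 𝕒 ≈ 𝕕 ⊖ 𝕖 ⊖ (𝕗 ⊖ 𝕖) ⊕ (𝕗 ⊖ (𝕖 ⊕ con (+ 1)) ⊖ (𝕕 ⊖ (𝕖 ⊕ con (+ 1)))) ∷ 𝕔 ≈ con (+ 0) ∷ [])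
      (𝕓 ≈ con (+ 0))
      (sumℤ1to n (λ i → w (gen typeÃ n a (+ i)) - + i - (w (+ i) - + i)) ∷
       sumℤ1to n (λ i → w (gen typeÃ n a (+ i)) - + i) ∷ sumℤ1to n (λ i → w (+ i) - + i) ∷
       w (+ a + + 1) ∷ + a ∷ w (+ a) ∷ [])
      ( sum-∸ n _ _
      , trans (sym (*-identityˡ _)) (window-change typeÃ adm v (e .commutes) (λ x → x) (λ ()))
      , e .centred refl )

-- Absolute values

abs-cases : ∀ x → (+ ∣ x ∣ ≡ x × + 0 ≤ x) ⊎ (+ ∣ x ∣ ≡ - x × x ≤ + 0)
abs-cases (+ n)      = inj₁ (refl , +≤+ z≤n)
abs-cases (-[1+ n ]) = inj₂ (refl , -≤+)

abs-drop : ∀ {g} y → + 0 < g → + ∣ y ∣ ≤ + ∣ y - g ∣ + g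
abs-drop {g} y 0<g with abs-cases y | abs-cases (y - g)
... | inj₁ (p , _) | inj₁ (q , _) =
  lin (𝕒 ≈ 𝕓 ∷ 𝕔 ≈ 𝕓 ⊖ 𝕕 ∷ []) (𝕒 ≼ 𝕔 ⊕ 𝕕) (+ ∣ y ∣ ∷ y ∷ + ∣ y - g ∣ ∷ g ∷ []) (p , q)
... | inj₁ (p , _) | inj₂ (q , r) =
  lin (𝕒 ≈ 𝕓 ∷ 𝕔 ≈ ⊝ (𝕓 ⊖ 𝕕) ∷ 𝕓 ⊖ 𝕕 ≼ con (+ 0) ∷ []) (𝕒 ≼ 𝕔 ⊕ 𝕕) (+ ∣ y ∣ ∷ y ∷ + ∣ y - g ∣ ∷ g ∷ []) (p , q , r)
... | inj₂ (p , r) | inj₁ (q , _) =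
  lin (𝕒 ≈ ⊝ 𝕓 ∷ 𝕔 ≈ 𝕓 ⊖ 𝕕 ∷ con (+ 0) ≼ 𝕔 ∷ 𝕓 ≼ con (+ 0) ∷ con (+ 0) ≺ 𝕕 ∷ []) (𝕒 ≼ 𝕔 ⊕ 𝕕) (+ ∣ y ∣ ∷ y ∷ + ∣ y - g ∣ ∷ g ∷ []) (p , q , +≤+ z≤n , r , 0<g)
... | inj₂ (p , _) | inj₂ (q , _) =
  lin (𝕒 ≈ ⊝ 𝕓 ∷ 𝕔 ≈ ⊝ (𝕓 ⊖ 𝕕) ∷ con (+ 0) ≺ 𝕕 ∷ []) (𝕒 ≼ 𝕔 ⊕ 𝕕) (+ ∣ y ∣ ∷ y ∷ + ∣ y - g ∣ ∷ g ∷ []) (p , q , 0<g)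

abs-drop-tight : ∀ {g} y → + 0 < g → + ∣ y ∣ ≡ + ∣ y - g ∣ + g → g ≤ y
abs-drop-tight {g} y 0<g eq with abs-cases y | abs-cases (y - g)
... | _ | inj₁ (q , r) =
  lin (con (+ 0) ≼ 𝕒 ⊖ 𝕓 ∷ []) (𝕓 ≼ 𝕒) (y ∷ g ∷ []) r
... | inj₁ (p , _) | inj₂ (q , r) =
  lin (𝕒 ≈ 𝕓 ∷ 𝕔 ≈ ⊝ (𝕓 ⊖ 𝕕) ∷ 𝕒 ≈ 𝕔 ⊕ 𝕕 ∷ []) (𝕕 ≼ 𝕓) (+ ∣ y ∣ ∷ y ∷ + ∣ y - g ∣ ∷ g ∷ []) (p , q , eq)
... | inj₂ (p , _) | inj₂ (q , _) =
  lin (𝕒 ≈ ⊝ 𝕓 ∷ 𝕔 ≈ ⊝ (𝕓 ⊖ 𝕕) ∷ 𝕒 ≈ 𝕔 ⊕ 𝕕 ∷ con (+ 0) ≺ 𝕕 ∷ []) (𝕕 ≼ 𝕓) (+ ∣ y ∣ ∷ y ∷ + ∣ y - g ∣ ∷ g ∷ []) (p , q , eq , 0<g)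

abs-drop-exact : ∀ {g} y → + 0 < g → g ≤ y → + ∣ y ∣ ≡ + ∣ y - g ∣ + g
abs-drop-exact {g} y 0<g g≤y = trans
  (0≤i⇒+∣i∣≡i (<⇒≤ (<-≤-trans 0<g g≤y)))
  (trans (lin [] (𝕒 ≈ 𝕒 ⊖ 𝕓 ⊕ 𝕓) (y ∷ g ∷ []) tt)
    (cong (_+ g) (sym (0≤i⇒+∣i∣≡i (lin (𝕓 ≼ 𝕒 ∷ []) (con (+ 0) ≼ 𝕒 ⊖ 𝕓) (y ∷ g ∷ []) g≤y)))))

dis-ℤ : ∀ n w → + dis n w ≡ sumℤ1to n (λ i → + ∣ w (+ i) - + i ∣)
dis-ℤ zero    w = refl
dis-ℤ (suc n) w = cong (_+ + ∣ w (+ suc n) - + suc n ∣) (dis-ℤ n w)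

dis-cong : ∀ n {w w′} → (∀ x → w x ≡ w′ x) → dis n w ≡ dis n w′
dis-cong zero    eq = refl
dis-cong (suc n) eq = cong₂ ℕ._+_ (dis-cong n eq) (cong (λ y → ∣ y - + suc n ∣) (eq (+ suc n)))

dis-id : ∀ n → dis n (λ x → x) ≡ 0
dis-id zero    = refl
dis-id (suc n) = cong₂ ℕ._+_ (dis-id n) (cong ∣_∣ (+-inverseʳ (+ suc n)))

module Disarray (k : Kind) (n : ℕ) (adm : Admissible k n) where
  open Words k n adm public

  hi : ℕ → ℤ
  hi a = lo k a + g a

  lo-lower : ∀ a → L a (lo k a)
  lo-lower a = translate (multiple-≡ (lin [] (con (+ 0) ≈ 𝕒 ⊖ 𝕒) (lo k a ∷ []) tt) multiple-0)

  -- The displacements of the values at `ℓ` and `h` grow by at most `g a` each, and by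
  -- `window-change` their total growth is `g a` times the gain in disarray. So the gain is at most
  -- 2 for either gap, and it is 2 exactly when the bounds in `rise` and `fall` are both attained.
  module Step {w : ℤ → ℤ} (cw : Commutes k n w) {a : ℕ} (v : V a) where
    ℓ h : ℤ
    ℓ = lo k a
    h = hi a

    gain : ℤ
    gain = + dis n (λ x → w (s a x)) - + dis n w

    swapped : g a * gain ≡ change (λ x → + ∣ x ∣) w ℓ h + change (λ x → + ∣ x ∣) w h ℓ
    swapped = trans
      (cong (g a *_) (trans (cong₂ _-_ (dis-ℤ n (λ x → w (s a x))) (dis-ℤ n w)) (sym (sum-∸ n _ _))))
      (window-change k adm v cw (λ x → + ∣ x ∣) λ _ x → cong +_ (∣-i∣≡∣i∣ x))

    rise : + ∣ w h - ℓ ∣ ≤ + ∣ w h - h ∣ + g a × (+ ∣ w h - ℓ ∣ ≡ + ∣ w h - h ∣ + g a → h ≤ w h)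
      × (h ≤ w h → + ∣ w h - ℓ ∣ ≡ + ∣ w h - h ∣ + g a)
    rise = subst (λ z → + ∣ w h - ℓ ∣ ≤ + ∣ z ∣ + g a) eq (abs-drop (w h - ℓ) (gap>0 k n a))
      , (λ t → lin (𝕔 ≼ 𝕒 ⊖ 𝕓 ∷ []) (𝕓 ⊕ 𝕔 ≼ 𝕒) (w h ∷ ℓ ∷ g a ∷ [])
           (abs-drop-tight (w h - ℓ) (gap>0 k n a) (trans t (cong (λ z → + ∣ z ∣ + g a) (sym eq)))))
      , (λ p → trans (abs-drop-exact (w h - ℓ) (gap>0 k n a)
             (lin (𝕓 ⊕ 𝕔 ≼ 𝕒 ∷ []) (𝕔 ≼ 𝕒 ⊖ 𝕓) (w h ∷ ℓ ∷ g a ∷ []) p))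
           (cong (λ z → + ∣ z ∣ + g a) eq))
      where
      eq : w h - ℓ - g a ≡ w h - h
      eq = lin [] (𝕒 ⊖ 𝕓 ⊖ 𝕔 ≈ 𝕒 ⊖ (𝕓 ⊕ 𝕔)) (w h ∷ ℓ ∷ g a ∷ []) tt

    fall : + ∣ w ℓ - h ∣ ≤ + ∣ w ℓ - ℓ ∣ + g a × (+ ∣ w ℓ - h ∣ ≡ + ∣ w ℓ - ℓ ∣ + g a → w ℓ ≤ ℓ)
      × (w ℓ ≤ ℓ → + ∣ w ℓ - h ∣ ≡ + ∣ w ℓ - ℓ ∣ + g a)
    fall rewrite ∣i-j∣≡∣j-i∣ (w ℓ) h | ∣i-j∣≡∣j-i∣ (w ℓ) ℓ =
      subst (λ z → + ∣ h - w ℓ ∣ ≤ + ∣ z ∣ + g a) eq (abs-drop (h - w ℓ) (gap>0 k n a))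
      , (λ t → lin (𝕔 ≼ 𝕓 ⊕ 𝕔 ⊖ 𝕒 ∷ []) (𝕒 ≼ 𝕓) (w ℓ ∷ ℓ ∷ g a ∷ [])
           (abs-drop-tight (h - w ℓ) (gap>0 k n a) (trans t (cong (λ z → + ∣ z ∣ + g a) (sym eq)))))
      , (λ p → trans (abs-drop-exact (h - w ℓ) (gap>0 k n a)
             (lin (𝕒 ≼ 𝕓 ∷ []) (𝕔 ≼ 𝕓 ⊕ 𝕔 ⊖ 𝕒) (w ℓ ∷ ℓ ∷ g a ∷ []) p))
           (cong (λ z → + ∣ z ∣ + g a) eq))
      where
      eq : h - w ℓ - g a ≡ ℓ - w ℓ
      eq = lin [] (𝕓 ⊕ 𝕔 ⊖ 𝕒 ⊖ 𝕔 ≈ 𝕓 ⊖ 𝕒) (w ℓ ∷ ℓ ∷ g a ∷ []) tt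

    private
      divide : ∀ {γ x} → (γ ≡ + 1 ⊎ γ ≡ + 2) →
        (γ * x ≤ γ + γ → x ≤ + 2) × (γ * x ≡ γ + γ → x ≡ + 2) × (x ≡ + 2 → γ * x ≡ γ + γ)
      divide {x = x} (inj₁ refl) =
        (λ p → lin ((+ 1) ⊛ 𝕒 ≼ con (+ 2) ∷ []) (𝕒 ≼ con (+ 2)) (x ∷ []) p) ,
        (λ p → lin ((+ 1) ⊛ 𝕒 ≈ con (+ 2) ∷ []) (𝕒 ≈ con (+ 2)) (x ∷ []) p) , λ { refl → refl }
      divide {x = x} (inj₂ refl) =
        (λ p → lin ((+ 2) ⊛ 𝕒 ≼ con (+ 4) ∷ []) (𝕒 ≼ con (+ 2)) (x ∷ []) p) ,
        (λ p → lin ((+ 2) ⊛ 𝕒 ≈ con (+ 4) ∷ []) (𝕒 ≈ con (+ 2)) (x ∷ []) p) , λ { refl → refl }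

    gain≤2 : gain ≤ + 2
    gain≤2 = proj₁ (divide (gap-1-or-2 k n a)) (subst (_≤ g a + g a) (sym swapped)
      (lin (𝕒 ≼ 𝕓 ⊕ 𝕖 ∷ 𝕔 ≼ 𝕕 ⊕ 𝕖 ∷ []) (𝕒 ⊖ 𝕕 ⊕ (𝕔 ⊖ 𝕓) ≼ 𝕖 ⊕ 𝕖)
        (+ ∣ w h - ℓ ∣ ∷ + ∣ w h - h ∣ ∷ + ∣ w ℓ - h ∣ ∷ + ∣ w ℓ - ℓ ∣ ∷ g a ∷ []) (proj₁ rise , proj₁ fall)))

    gain≡2⇒tight : gain ≡ + 2 → w ℓ ≤ ℓ × h ≤ w h
    gain≡2⇒tight p =
      proj₁ (proj₂ fall) (lin
        (𝕒 ≼ 𝕓 ⊕ 𝕖 ∷ 𝕔 ≼ 𝕕 ⊕ 𝕖 ∷ 𝕒 ⊖ 𝕕 ⊕ (𝕔 ⊖ 𝕓) ≈ 𝕖 ⊕ 𝕖 ∷ []) (𝕔 ≈ 𝕕 ⊕ 𝕖)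
        (+ ∣ w h - ℓ ∣ ∷ + ∣ w h - h ∣ ∷ + ∣ w ℓ - h ∣ ∷ + ∣ w ℓ - ℓ ∣ ∷ g a ∷ []) (proj₁ rise , proj₁ fall , total)) ,
      proj₁ (proj₂ rise) (lin
        (𝕒 ≼ 𝕓 ⊕ 𝕖 ∷ 𝕔 ≼ 𝕕 ⊕ 𝕖 ∷ 𝕒 ⊖ 𝕕 ⊕ (𝕔 ⊖ 𝕓) ≈ 𝕖 ⊕ 𝕖 ∷ []) (𝕒 ≈ 𝕓 ⊕ 𝕖)
        (+ ∣ w h - ℓ ∣ ∷ + ∣ w h - h ∣ ∷ + ∣ w ℓ - h ∣ ∷ + ∣ w ℓ - ℓ ∣ ∷ g a ∷ []) (proj₁ rise , proj₁ fall , total))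
      where
      total = trans (sym swapped) (proj₂ (proj₂ (divide (gap-1-or-2 k n a))) p)

    tight⇒gain≡2 : w ℓ ≤ ℓ → h ≤ w h → gain ≡ + 2
    tight⇒gain≡2 p q = proj₁ (proj₂ (divide (gap-1-or-2 k n a))) (trans swapped
      (lin (𝕒 ≈ 𝕓 ⊕ 𝕖 ∷ 𝕔 ≈ 𝕕 ⊕ 𝕖 ∷ []) (𝕒 ⊖ 𝕕 ⊕ (𝕔 ⊖ 𝕓) ≈ 𝕖 ⊕ 𝕖)
        (+ ∣ w h - ℓ ∣ ∷ + ∣ w h - h ∣ ∷ + ∣ w ℓ - h ∣ ∷ + ∣ w ℓ - ℓ ∣ ∷ g a ∷ [])
        (proj₂ (proj₂ rise) q , proj₂ (proj₂ fall) p)))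

-- Sorting by descents

module Descents (k : Kind) (n : ℕ) (adm : Admissible k n) where
  open Disarray k n adm public

  Descent Ascent : (ℤ → ℤ) → ℕ → Set
  Descent w a = w (hi a) < w (lo k a)
  Ascent  w a = w (lo k a) < w (hi a)

  find-descent-below : ∀ {w} → IsElement k n w → ∀ m →
    (∃[ a ] V a × Descent w a) ⊎ (∀ a → a ℕ.< m → V a → Ascent w a)
  find-descent-below e zero = inj₂ λ _ ()
  find-descent-below {w} e (suc m) with find-descent-below e m | valid? k n m
  ... | inj₁ d | _ = inj₁ d
  ... | inj₂ asc | no ¬v = inj₂ λ a a<1+m v →
    asc a (ℕ.≤∧≢⇒< (ℕ.≤-pred a<1+m) λ { refl → ¬v v }) v
  ... | inj₂ asc | yes v with <-cmp (w (lo k m)) (w (hi m))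
  ...   | tri> _ _ d = inj₁ (m , v , d)
  ...   | tri≈ _ eq _ = contradiction (e .injective eq) (<⇒≢ (lower<upper m (lo k m)))
  ...   | tri< rise _ _ = inj₂ λ a a<1+m va → [ (λ a<m → asc a a<m va) , (λ { refl → rise }) ]′
    (ℕ.m≤n⇒m<n∨m≡n (ℕ.≤-pred a<1+m))

  find-descent : ∀ {w} → IsElement k n w →
    (∃[ a ] V a × Descent w a) ⊎ (∀ a → V a → Ascent w a)
  find-descent e with find-descent-below e (suc n)
  ... | inj₁ d   = inj₁ d
  ... | inj₂ asc = inj₂ λ a v → asc a (s≤s (valid⇒≤n k v)) v

  -- Induction along consecutive unfrozen integers with `y` fixed; `successor` supplies the steps,
  -- and the distance `y - x` bounds their number.
  chain : (P : ℤ → ℤ → Set) →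
    (∀ {a x} → V a → L a x → P x (x + g a)) →
    (∀ {a x y} → V a → L a x → x + g a < y → Unf y → P (x + g a) y → P x y) →
    ∀ {x y} → Unf x → Unf y → x < y → P x y
  chain P base step {x} {y} ux uy x<y = go ∣ y - x ∣ ux x<y
    (≤-reflexive (sym (0≤i⇒+∣i∣≡i (lin (𝕒 ≺ 𝕓 ∷ []) (con (+ 0) ≼ 𝕓 ⊖ 𝕒) (x ∷ y ∷ []) x<y))))
    where
    go : ∀ m {x} → Unf x → x < y → y - x ≤ + m → P x y
    go m {x} ux x<y bound with successor k adm ux uy x<y
    ... | a , v , l with x + g a ≟ y
    ...   | yes refl = base v l
    go zero {x} ux x<y bound | a , v , l | no _ = ⊥-elim
      (lin (𝕒 ≺ 𝕓 ∷ 𝕓 ⊖ 𝕒 ≼ con (+ 0) ∷ []) absurd (x ∷ y ∷ []) (x<y , bound))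
    go (suc m) {x} ux x<y bound | a , v , l | no neq = step v l x+g<y uy
      (go m (upper-unf v l) x+g<y
        (lin (con (+ 0) ≺ 𝕔 ∷ 𝕓 ⊖ 𝕒 ≼ con (+ 1) ⊕ 𝕕 ∷ []) (𝕓 ⊖ (𝕒 ⊕ 𝕔) ≼ 𝕕) (x ∷ y ∷ g a ∷ + m ∷ [])
          (gap>0 k n a , bound)))
      where
      x+g<y : x + g a < y
      x+g<y = ≤∧≢⇒< (lower-adjacent v l uy x<y) neq

  -- Such a `w` increases on neighbouring unfrozen integers, hence on all unfrozen ones, hence on ℤ.
  -- An increasing bijection of ℤ is a translation, and a frozen integer or the vanishing total
  -- displacement makes it trivial.
  module NoDescents {w : ℤ → ℤ} (e : IsElement k n w) (asc : ∀ a → V a → Ascent w a) where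

    ascent : ∀ {a x} → V a → L a x → w x < w (x + g a)
    ascent {a} {x} v l with <-cmp (w x) (w (x + g a))
    ... | tri< p _ _  = p
    ... | tri≈ _ eq _ = contradiction (e .injective eq) (<⇒≢ (lower<upper a x))
    ... | tri> _ _ d  = contradiction (asc a v) (<-asym (descent-transport (e .commutes) l (lo-lower a) d))

    monotone-unf : ∀ {x y} → Unf x → Unf y → x < y → w x < w y
    monotone-unf = chain (λ x y → w x < w y) ascent (λ v l _ _ p → <-trans (ascent v l) p)

    w-unf : ∀ {x} → Unf x → Unf (w x)
    w-unf {x} u with unf? k n (w x)
    ... | yes u′ = u′
    ... | no ¬u′ = contradiction (subst Unf (sym (e .injective (e .frozen ¬u′))) u) ¬u′

    above-frozen : ∀ {f y} → ¬ Unf f → Unf y → f < y → f < w y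
    above-frozen {f} {y} ¬u u f<y with frozen-shape k ¬u
    ... | inj₂ (inj₁ all<) = contradiction f<y (<-asym (all< y u))
    ... | inj₂ (inj₂ all>) = all> (w y) (w-unf u)
    -- The mirror `f` is the midpoint of `y` and its image, and also the midpoint of their values.
    ... | inj₁ r = lin (𝕒 ≺ 𝕓 ∷ 𝕒 ≈ 𝕔 ⊕ 𝕔 ⊖ 𝕓 ∷ []) (𝕔 ≺ 𝕓) (w (f + f - y) ∷ w y ∷ f ∷ [])
      ( monotone-unf (rf-unf k r u) u (lin (𝕒 ≺ 𝕓 ∷ []) (𝕒 ⊕ 𝕒 ⊖ 𝕓 ≺ 𝕓) (f ∷ y ∷ []) f<y)
      , e .commutes .flip y r )

    below-frozen : ∀ {f y} → ¬ Unf f → Unf y → y < f → w y < f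
    below-frozen {f} {y} ¬u u y<f with frozen-shape k ¬u
    ... | inj₂ (inj₁ all<) = all< (w y) (w-unf u)
    ... | inj₂ (inj₂ all>) = contradiction y<f (<-asym (all> y u))
    ... | inj₁ r = lin (𝕓 ≺ 𝕒 ∷ 𝕒 ≈ 𝕔 ⊕ 𝕔 ⊖ 𝕓 ∷ []) (𝕓 ≺ 𝕔) (w (f + f - y) ∷ w y ∷ f ∷ [])
      ( monotone-unf u (rf-unf k r u) (lin (𝕓 ≺ 𝕒 ∷ []) (𝕓 ≺ 𝕒 ⊕ 𝕒 ⊖ 𝕓) (f ∷ y ∷ []) y<f)
      , e .commutes .flip y r )

    monotone : ∀ {x y} → x < y → w x < w y
    monotone {x} {y} x<y with unf? k n x | unf? k n y
    ... | yes u | yes u′ = monotone-unf u u′ x<y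
    ... | yes u | no ¬u′ = subst (w x <_) (sym (e .frozen ¬u′)) (below-frozen ¬u′ u x<y)
    ... | no ¬u | yes u′ = subst (_< w y) (sym (e .frozen ¬u)) (above-frozen ¬u u′ x<y)
    ... | no ¬u | no ¬u′ = subst₂ _<_ (sym (e .frozen ¬u)) (sym (e .frozen ¬u′)) x<y

    cancel : ∀ {x y} → w x < w y → x < y
    cancel {x} {y} p with <-cmp x y
    ... | tri< q _ _    = q
    ... | tri≈ _ refl _ = contradiction refl (<⇒≢ p)
    ... | tri> _ _ q    = contradiction p (<-asym (monotone q))

    w-next : ∀ x → w (x + + 1) ≡ w x + + 1
    w-next x with e .surjective (w x + + 1)
    ... | z , eq = trans (cong w (sym z≡)) eq
      where
      x<z : x < z
      x<z = cancel (lin (𝕒 ≈ 𝕓 ⊕ con (+ 1) ∷ []) (𝕓 ≺ 𝕒) (w z ∷ w x ∷ []) eq)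
      z≤ : z ≤ x + + 1
      z≤ = ≮⇒≥ λ p → lin (𝕒 ≈ 𝕓 ⊕ con (+ 1) ∷ 𝕔 ≺ 𝕒 ∷ 𝕓 ≺ 𝕔 ∷ []) absurd (w z ∷ w x ∷ w (x + + 1) ∷ [])
        (eq , monotone p , monotone (lin [] (𝕒 ≺ 𝕒 ⊕ con (+ 1)) (x ∷ []) tt))
      z≡ : z ≡ x + + 1
      z≡ = lin (𝕒 ≺ 𝕓 ∷ 𝕓 ≼ 𝕒 ⊕ con (+ 1) ∷ []) (𝕓 ≈ 𝕒 ⊕ con (+ 1)) (x ∷ z ∷ []) (x<z , z≤)

    translation : ∀ x → w x ≡ w (+ 0) + x
    translation x = trans (cong w (sym (+-identityˡ x)))
      (shift-multiple {1} {w} w-next (+ 0) (x , sym (*-identityʳ x)))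

    offset : w (+ 0) ≡ + 0
    offset with frozen-exists k n
    ... | inj₁ (f , ¬u) = lin (𝕒 ≈ 𝕓 ∷ 𝕒 ≈ 𝕔 ⊕ 𝕓 ∷ []) (𝕔 ≈ con (+ 0)) (w f ∷ f ∷ w (+ 0) ∷ [])
      (e .frozen ¬u , translation f)
    ... | inj₂ k≡Ã = zero-average n (admissible⇒1≤n k adm)
      (trans (sym (sum-cong n λ i → lin (𝕒 ≈ 𝕓 ⊕ 𝕔 ∷ []) (𝕒 ⊖ 𝕔 ≈ 𝕓) (w (+ i) ∷ w (+ 0) ∷ + i ∷ []) (translation (+ i))))
        (e .centred k≡Ã))
      where
      sum-cong : ∀ m {f h} → (∀ i → f i ≡ h i) → sumℤ1to m f ≡ sumℤ1to m h
      sum-cong zero    eq = refl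
      sum-cong (suc m) eq = cong₂ _+_ (sum-cong m eq) (eq (suc m))
      sum-constant : ∀ m c → sumℤ1to m (λ _ → c) ≡ + m * c
      sum-constant zero    c = refl
      sum-constant (suc m) c = trans (cong (_+ c) (sum-constant m c))
        (trans (+-comm (+ m * c) c) (sym (suc-* (+ m) c)))
      zero-average : ∀ m {c} → 1 ℕ.≤ m → sumℤ1to m (λ _ → c) ≡ + 0 → c ≡ + 0
      zero-average (suc m) {c} _ eq =
        *-cancelˡ-≡ (+ suc m) c (+ 0) (trans (sym (sum-constant (suc m) c)) (trans eq (sym (*-zeroʳ (+ suc m)))))

    identity : ∀ x → w x ≡ x
    identity x = trans (translation x) (trans (cong (_+ x) offset) (+-identityˡ x))

  -- Unlike the disarray, the sum of the squared displacements drops at every descent.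
  energy : (ℤ → ℤ) → ℤ
  energy w = sumℤ1to n (λ i → (w (+ i) - + i) * (w (+ i) - + i))

  square≥0 : ∀ x → + 0 ≤ x * x
  square≥0 (+ m)      = subst (+ 0 ≤_) (pos-* m m) (+≤+ z≤n)
  square≥0 (-[1+ m ]) = +≤+ z≤n

  -- By `expand` the energy changes by twice `w h - w ℓ`, which is negative at a descent.
  energy-drops : ∀ {w} → Commutes k n w → ∀ {a} → V a → Descent w a →
    energy (λ x → w (s a x)) < energy w
  energy-drops {w} cw {a} v d = ≰⇒> λ p → lin
    (𝕒 ≈ 𝕓 ⊕ 𝕓 ∷ con (+ 0) ≼ 𝕒 ∷ 𝕓 ≺ con (+ 0) ∷ []) absurd
    (g a * Δ ∷ g a * (w h - w ℓ) ∷ [])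
    ( trans (window-change k adm v cw (λ x → x * x) (λ _ → square-even)) (expand (w h) (w ℓ) ℓ (g a))
    , nonneg (lin (𝕒 ≈ 𝕓 ⊖ 𝕔 ∷ 𝕔 ≼ 𝕓 ∷ []) (con (+ 0) ≼ 𝕒) (Δ ∷ energy (λ x → w (s a x)) ∷ energy w ∷ [])
        (sum-∸ n _ _ , p))
    , neg (lin (𝕒 ≺ 𝕓 ∷ []) (𝕒 ⊖ 𝕓 ≺ con (+ 0)) (w h ∷ w ℓ ∷ []) d) )
    where
    ℓ = lo k a
    h = hi a
    Δ = sumℤ1to n (λ i → (w (s a (+ i)) - + i) * (w (s a (+ i)) - + i) - (w (+ i) - + i) * (w (+ i) - + i))
    square-even : ∀ x → - x * - x ≡ x * x
    square-even = solve-∀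
    expand : ∀ y x ℓ g → ((y - ℓ) * (y - ℓ) - (x - ℓ) * (x - ℓ)) + ((x - (ℓ + g)) * (x - (ℓ + g)) - (y - (ℓ + g)) * (y - (ℓ + g)))
      ≡ g * (y - x) + g * (y - x)
    expand = solve-∀
    nonneg : ∀ {x} → + 0 ≤ x → + 0 ≤ g a * x
    nonneg {x} p with g a | gap-1-or-2 k n a
    ... | _ | inj₁ refl = 0≤* 1 p
    ... | _ | inj₂ refl = 0≤* 2 p
    neg : ∀ {x} → x < + 0 → g a * x < + 0
    neg {x} p with g a | gap-1-or-2 k n a
    ... | _ | inj₁ refl = lin (𝕒 ≺ con (+ 0) ∷ []) ((+ 1) ⊛ 𝕒 ≺ con (+ 0)) (x ∷ []) p
    ... | _ | inj₂ refl = lin (𝕒 ≺ con (+ 0) ∷ []) ((+ 2) ⊛ 𝕒 ≺ con (+ 0)) (x ∷ []) p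

  ev-snoc : ∀ {w vs a} → V a → (∀ x → ev vs x ≡ w (s a x)) → ∀ x → ev (vs ++ a ∷ []) x ≡ w x
  ev-snoc {w} {vs} {a} v eq x = trans (ev-++ vs (a ∷ []) x) (trans (eq (s a x)) (cong w (s-involutive v x)))

  -- Sorting terminates because the energy is a nonnegative integer. Nothing is claimed about the
  -- length of the word; it gives access to the exchange property and the flow, which are proved for
  -- words.
  find-word : ∀ {w} → IsElement k n w → ∃[ ws ] All V ws × (∀ x → ev ws x ≡ w x)
  find-word {w} e = go ∣ energy w ∣ e (≤-reflexive (sym (0≤i⇒+∣i∣≡i (energy≥0 w))))
    where
    energy≥0 : ∀ w → + 0 ≤ energy w
    energy≥0 w = sum-nonneg n λ i → square≥0 (w (+ i) - + i)
    go : ∀ m {w} → IsElement k n w → energy w ≤ + m → ∃[ ws ] All V ws × (∀ x → ev ws x ≡ w x)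
    go m {w} e bound with find-descent e
    ... | inj₂ asc = [] , [] , λ x → sym (NoDescents.identity e asc x)
    go zero {w} e bound | inj₁ (a , v , d) = contradiction (energy≥0 (λ x → w (s a x)))
      (<⇒≱ (<-≤-trans (energy-drops (e .commutes) v d) bound))
    go (suc m) {w} e bound | inj₁ (a , v , d)
      with go m (element-∘ k adm v e) (lin (𝕒 ≺ 𝕓 ∷ 𝕓 ≼ con (+ 1) ⊕ 𝕔 ∷ []) (𝕒 ≼ 𝕔)
        (energy (λ x → w (s a x)) ∷ energy w ∷ + m ∷ []) (energy-drops (e .commutes) v d , bound))
    ... | vs , vvs , eq = vs ++ a ∷ [] , All.++⁺ vvs (v ∷ []) , ev-snoc {w} {vs} v eq

-- Pattern avoidance and disarray

contains-cong : ∀ {k n w w′} → (∀ x → w x ≡ w′ x) → Contains321 k n w → Contains321 k n w′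
contains-cong eq (i , j , l , ui , uj , ul , i<j , j<l , p , q) =
  i , j , l , ui , uj , ul , i<j , j<l , subst₂ _<_ (eq j) (eq i) p , subst₂ _<_ (eq l) (eq j) q

module Avoidance (k : Kind) (n : ℕ) (adm : Admissible k n) where
  open Descents k n adm public

  Avoids : (ℤ → ℤ) → Set
  Avoids = Avoids321 k n

  Pattern : (w : ℤ → ℤ) (i j l : ℤ) → Set
  Pattern w i j l = Unf i × Unf j × Unf l × i < j × j < l × w j < w i × w l < w j

  pattern-move : ∀ {w a i j l} → V a → Pattern w i j l → s a i ≢ j → s a j ≢ l →
    Pattern (λ x → w (s a x)) (s a i) (s a j) (s a l)
  pattern-move {w} {a} {i} {j} {l} v (ui , uj , ul , i<j , j<l , p , q) i↛j j↛l =
    s-unf v ui , s-unf v uj , s-unf v ul , s-monotone v ui uj i<j i↛j , s-monotone v uj ul j<l j↛l ,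
    subst₂ _<_ (back j) (back i) p , subst₂ _<_ (back l) (back j) q
    where
    back : ∀ x → w x ≡ w (s a (s a x))
    back x = cong w (sym (s-involutive v x))

  swap-up : ∀ {a x y} → x < y → s a x ≡ y → L a x × y ≡ x + g a
  swap-up {a} {x} {y} x<y eq with moves a x
  ... | up l eq′ = l , trans (sym eq) eq′
  ... | down z l refl eq′ = contradiction (subst (z + g a <_) (trans (sym eq) eq′) x<y) (<-asym (lower<upper a z))
  ... | still _ _ eq′ = contradiction (trans (sym eq′) eq) (<⇒≢ x<y)

  -- A pattern of the new element comes from one of `w` unless two of its neighbouring entries are a
  -- swapped pair. At a descent of `w` the swap puts such a pair in increasing order.
  avoids-descend : ∀ {w} → Commutes k n w → ∀ {a} → V a → Descent w a → Avoids w →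
    Avoids (λ x → w (s a x))
  avoids-descend {w} cw {a} v d av (i , j , l , pat@(_ , _ , _ , i<j , j<l , p , q)) =
    av (contains-cong (λ x → cong w (s-involutive v x))
      (s a i , s a j , s a l , pattern-move {λ x → w (s a x)} v pat (kept i<j p) (kept j<l q)))
    where
    kept : ∀ {x y} → x < y → w (s a y) < w (s a x) → s a x ≢ y
    kept {x} {y} x<y lt eq with swap-up x<y eq
    ... | lx , refl = <-asym (descent-transport cw (lo-lower a) lx d)
      (subst₂ _<_ (cong w (s-upper v lx)) (cong w (s-lower v lx)) lt)

  Tight : (ℤ → ℤ) → ℕ → ℤ → Set
  Tight w a x = w x ≤ x × x + g a ≤ w (x + g a)

  tight-transport : ∀ {w} → Commutes k n w → ∀ {a x y} → L a x → L a y → Tight w a x → Tight w a y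
  tight-transport {w} cw {a} {x} {y} l l′ (p , q) with related cw l l′
  ... | inj₁ (c , _ , y≡ , eq , eq′) =
    lin (𝕓 ≈ 𝕒 ⊕ 𝕔 ∷ 𝕕 ≈ 𝕖 ⊕ 𝕔 ∷ 𝕖 ≼ 𝕒 ∷ []) (𝕕 ≼ 𝕓) (x ∷ y ∷ c ∷ w y ∷ w x ∷ []) (y≡ , eq , p) ,
    lin (𝕓 ≈ 𝕒 ⊕ 𝕔 ∷ 𝕕 ≈ 𝕖 ⊕ 𝕔 ∷ 𝕒 ⊕ 𝕗 ≼ 𝕖 ∷ []) (𝕓 ⊕ 𝕗 ≼ 𝕕) (x ∷ y ∷ c ∷ w (y + g a) ∷ w (x + g a) ∷ g a ∷ []) (y≡ , eq′ , q)
  ... | inj₂ (c , _ , y≡ , eq , eq′) =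
    lin (𝕓 ≈ 𝕔 ⊖ (𝕒 ⊕ 𝕗) ∷ 𝕕 ≈ 𝕔 ⊖ 𝕖 ∷ 𝕒 ⊕ 𝕗 ≼ 𝕖 ∷ []) (𝕕 ≼ 𝕓) (x ∷ y ∷ c ∷ w y ∷ w (x + g a) ∷ g a ∷ []) (y≡ , eq , q) ,
    lin (𝕓 ≈ 𝕔 ⊖ (𝕒 ⊕ 𝕗) ∷ 𝕕 ≈ 𝕔 ⊖ 𝕖 ∷ 𝕖 ≼ 𝕒 ∷ []) (𝕓 ⊕ 𝕗 ≼ 𝕕) (x ∷ y ∷ c ∷ w (y + g a) ∷ w x ∷ g a ∷ []) (y≡ , eq′ , p)

  unf-of-moved : ∀ {ws} → All V ws → ∀ {x} → ev ws x ≢ x → Unf x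
  unf-of-moved vs {x} neq with unf? k n x
  ... | yes u = u
  ... | no ¬u = contradiction (ev-frozen vs ¬u) neq

  -- The swap at a descent p < q moves the values of a 321-avoiding w the whole way back over
  -- the pair: otherwise the flow across p supplies the third entry of a pattern.
  avoids⇒tight : ∀ {ws} → All V ws → Avoids (ev ws) → ∀ {a p} → V a → L a p →
    ev ws (p + g a) < ev ws p → ev ws (p + g a) ≤ p × p + g a ≤ ev ws p
  avoids⇒tight {ws} vs av {a} {p} v l d = ≮⇒≥ ¬up , ≮⇒≥ ¬down
    where
    w = ev ws
    up-p = lower-unf v l
    uq = upper-unf v l
    open Flow vs up-p

    ¬down : ¬ w p < p + g a
    -- Being unfrozen and below `p + g a`, the value `w p` is at most `p`. So the value at `p + g a`
    -- has come down across `p`, and the flow supplies an earlier position with a value above `p`.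
    ¬down lt with upper-adjacent v l (ev-unf vs up-p) lt
    ... | wp≤p with down⇒up (lower<upper a p) (<⇒≤ (<-≤-trans d wp≤p))
    ...   | i , i≤p , p<wi = av (i , p , p + g a , unf-of-moved vs (λ e → <⇒≱ p<wi (subst (_≤ p) (sym e) i≤p)) ,
      up-p , uq , ≤∧≢⇒< i≤p (λ { refl → <⇒≱ p<wi wp≤p }) , lower<upper a p , ≤-<-trans wp≤p p<wi , d)

    ¬up : ¬ p < w (p + g a)
    ¬up p<wq with up⇒down ≤-refl (<-trans p<wq d)
    ... | i , p<i , wi≤p = av (p , p + g a , i , up-p , uq , ui , lower<upper a p ,
      ≤∧≢⇒< (lower-adjacent v l ui p<i) (λ { refl → <⇒≱ p<wq wi≤p }) , d , ≤-<-trans wi≤p p<wq)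
      where
      ui = unf-of-moved vs λ e → <⇒≱ p<i (subst (_≤ p) e wi≤p)

  -- A new pattern has a swapped pair as two neighbouring entries. By tightness its third entry
  -- crosses, under `ev ws`, the cut between the ends of that pair, so the flow supplies an entry
  -- crossing the other way. These two and one end of the pair already form a pattern of `ev ws`.
  tight⇒avoids : ∀ {ws} → All V ws → Avoids (ev ws) → ∀ {a} → V a → Tight (ev ws) a (lo k a) →
    Avoids (λ x → ev ws (s a x))
  tight⇒avoids {ws} vs av {a} v tight (i , j , l , pat@(ui , uj , ul , i<j , j<l , p , q))
    with s a i ≟ j | s a j ≟ l
  ... | no i↛j | no j↛l = av (contains-cong (λ x → cong (ev ws) (s-involutive v x))
    (s a i , s a j , s a l , pattern-move {λ x → ev ws (s a x)} v pat i↛j j↛l))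
  ... | yes i→j | _ with swap-up i<j i→j
  ...   | li , refl with tight-transport (ev-commutes vs) (lo-lower a) li tight
  ...     | wi≤i , _ with down⇒up (<-trans i<j j<l′) (<⇒≤ (<-≤-trans wl′<wi wi≤i))
    where
    open Flow vs (lower-unf v li)
    j<l′ : i + g a < s a l
    j<l′ = subst (_< s a l) i→j (s-monotone v ui ul (<-trans i<j j<l) λ e → <⇒≢ j<l (trans (sym i→j) e))
    wl′<wi : ev ws (s a l) < ev ws i
    wl′<wi = subst (λ y → ev ws (s a l) < ev ws y) (s-upper v li) q
  ...       | x , x≤i , i<wx = av (x , i , s a l , unf-of-moved vs (λ e → <⇒≱ i<wx (subst (_≤ i) (sym e) x≤i)) ,
    ui , s-unf v ul , ≤∧≢⇒< x≤i (λ { refl → <⇒≱ i<wx wi≤i }) ,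
    <-trans i<j (subst (_< s a l) i→j (s-monotone v ui ul (<-trans i<j j<l) λ e → <⇒≢ j<l (trans (sym i→j) e))) ,
    ≤-<-trans wi≤i i<wx , subst (λ y → ev ws (s a l) < ev ws y) (s-upper v li) q)
  tight⇒avoids {ws} vs av {a} v tight (i , j , l , pat@(ui , uj , ul , i<j , j<l , p , q))
    | no _ | yes j→l with swap-up j<l j→l
  ...   | lj , refl with tight-transport (ev-commutes vs) (lo-lower a) lj tight
  ...     | _ , l≤wl with up⇒down (<⇒≤ i′<j) (<-≤-trans j<l (<⇒≤ (≤-<-trans l≤wl wl<wi′)))
    where
    open Flow vs (lower-unf v lj)
    i′<j : s a i < j
    i′<j = subst (s a i <_) (s-upper v lj)
      (s-monotone v ui ul (<-trans i<j j<l) λ e → <⇒≢ i<j (trans (sym (s-involutive v i)) (trans (cong (s a) e) (s-upper v lj))))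
    wl<wi′ : ev ws (j + g a) < ev ws (s a i)
    wl<wi′ = subst (λ y → ev ws y < ev ws (s a i)) (s-lower v lj) p
  ...       | x , j<x , wx≤j = av (s a i , j + g a , x , s-unf v ui , ul , ux ,
    <-trans (subst (s a i <_) (s-upper v lj)
      (s-monotone v ui ul (<-trans i<j j<l) λ e → <⇒≢ i<j (trans (sym (s-involutive v i)) (trans (cong (s a) e) (s-upper v lj))))) j<l ,
    ≤∧≢⇒< (lower-adjacent v lj ux j<x) (λ { refl → <⇒≱ j<l (≤-trans l≤wl wx≤j) }) ,
    subst (λ y → ev ws y < ev ws (s a i)) (s-lower v lj) p ,
    ≤-<-trans wx≤j (<-≤-trans j<l l≤wl))
    where
    ux = unf-of-moved vs λ e → <⇒≱ j<x (subst (_≤ j) e wx≤j)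

  -- Words all of whose steps are tight

  dis-append : ∀ {w} → Commutes k n w → ∀ {us} → All V us →
    dis n (λ x → w (ev us x)) ℕ.≤ dis n w ℕ.+ 2 ℕ.* length us
  dis-append {w} cw [] = ℕ.m≤m+n _ _
  dis-append {w} cw {a ∷ us} (v ∷ vs) = ≤-pos
    (lin (𝕒 ≼ 𝕓 ⊕ (𝕔 ⊕ (𝕔 ⊕ con (+ 0))) ∷ 𝕓 ⊖ 𝕕 ≼ con (+ 2) ∷ [])
      (𝕒 ≼ 𝕕 ⊕ (con (+ 1) ⊕ 𝕔 ⊕ (con (+ 1) ⊕ 𝕔 ⊕ con (+ 0))))
      (+ dis n (λ x → w (s a (ev us x))) ∷ + dis n (λ x → w (s a x)) ∷ + length us ∷ + dis n w ∷ [])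
      (pos-≤ (dis-append (commutes-∘ cw (s-commutes v)) vs) , Step.gain≤2 cw v))

  dis-word : ∀ {us} → All V us → dis n (ev us) ℕ.≤ 2 ℕ.* length us
  dis-word {us} vs = subst (λ d → dis n (ev us) ℕ.≤ d ℕ.+ 2 ℕ.* length us) (dis-id n)
    (dis-append {λ x → x} commutes-id vs)

  Exact : Word → Set
  Exact ws = dis n (ev ws) ≡ 2 ℕ.* length ws

  -- Every letter adds at most 2 to the disarray, so the deficit of a prefix could never be made up.
  exact-prefix : ∀ {us vs} → All V us → All V vs → Exact (us ++ vs) → Exact us
  exact-prefix {us} {vs} vus vvs ex = pos-injective (lin
    (𝕒 ≼ 𝕔 ⊕ (𝕔 ⊕ con (+ 0)) ∷ 𝕖 ≼ 𝕒 ⊕ (𝕕 ⊕ (𝕕 ⊕ con (+ 0))) ∷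
     𝕖 ≈ 𝕔 ⊕ 𝕕 ⊕ (𝕔 ⊕ 𝕕 ⊕ con (+ 0)) ∷ 𝕓 ≈ 𝕔 ⊕ (𝕔 ⊕ con (+ 0)) ∷ []) (𝕒 ≈ 𝕓)
    (+ dis n (ev us) ∷ + (2 ℕ.* length us) ∷ + length us ∷ + length vs ∷ + dis n (ev (us ++ vs)) ∷ [])
    ( pos-≤ (dis-word vus)
    , pos-≤ (subst (ℕ._≤ dis n (ev us) ℕ.+ 2 ℕ.* length vs) (sym (dis-cong n (ev-++ us vs))) (dis-append (ev-commutes vus) vvs))
    , cong +_ (trans ex (cong (2 ℕ.*_) (List.length-++ us)))
    , refl ))

  exact-tight : ∀ {us a} → All V us → V a → Exact us → Exact (us ++ a ∷ []) → Tight (ev us) a (lo k a)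
  exact-tight {us} {a} vus v ex ex′ = Step.gain≡2⇒tight (ev-commutes vus) v (lin
    (𝕒 ≈ 𝕔 ⊕ con (+ 1) ⊕ (𝕔 ⊕ con (+ 1) ⊕ con (+ 0)) ∷ 𝕓 ≈ 𝕔 ⊕ (𝕔 ⊕ con (+ 0)) ∷ []) (𝕒 ⊖ 𝕓 ≈ con (+ 2))
    (+ dis n (λ x → ev us (s a x)) ∷ + dis n (ev us) ∷ + length us ∷ [])
    ( cong +_ (trans (dis-cong n λ x → sym (ev-++ us (a ∷ []) x)) (trans ex′ (cong (2 ℕ.*_) (List.length-++ us))))
    , cong +_ ex ))

  exact-tight-at : ∀ us {a vs} → All V (us ++ a ∷ vs) → Exact (us ++ a ∷ vs) → Tight (ev us) a (lo k a)
  exact-tight-at us {a} {vs} vws ex with All.++⁻ us vws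
  ... | vus , va ∷ vvs = exact-tight vus va (exact-prefix vus (va ∷ vvs) ex)
    (exact-prefix {us ++ a ∷ []} (All.++⁺ vus (va ∷ [])) vvs (subst Exact (sym (List.++-assoc us (a ∷ []) vs)) ex))

  exact⇒avoids : ∀ us vs → All V us → All V vs → Avoids (ev us) → Exact (us ++ vs) → Avoids (ev (us ++ vs))
  exact⇒avoids us [] vus _ av ex = subst (Avoids ∘ ev) (sym (List.++-identityʳ us)) av
  exact⇒avoids us (a ∷ vs) vus (va ∷ vvs) av ex = subst (Avoids ∘ ev) assoc
    (exact⇒avoids (us ++ a ∷ []) vs (All.++⁺ vus (va ∷ [])) vvs
      (λ c → tight⇒avoids vus av va (exact-tight-at us (All.++⁺ vus (va ∷ vvs)) ex) (contains-cong (ev-++ us (a ∷ [])) c))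
      (subst Exact (sym assoc) ex))
    where
    assoc : (us ++ a ∷ []) ++ vs ≡ us ++ a ∷ vs
    assoc = List.++-assoc us (a ∷ []) vs

  identity-avoids : Avoids (λ x → x)
  identity-avoids (i , j , l , _ , _ , _ , i<j , _ , p , _) = <-asym i<j p

  -- The given word provides the flow and, shortened by `exchange` at each descent, the recursion
  -- measure. The new word is built from the descents themselves, all of them tight by
  -- `avoids⇒tight`.
  exact-word : ∀ m {ws} → length ws ≡ m → All V ws → ∀ {w} → IsElement k n w → (∀ x → ev ws x ≡ w x) → Avoids w →
    ∃[ vs ] All V vs × (∀ x → ev vs x ≡ w x) × dis n w ≡ 2 ℕ.* length vs
  exact-word m {ws} len vws {w} e rep av with find-descent e
  ... | inj₂ asc = [] , [] , (λ x → sym (identity x)) , trans (dis-cong n identity) (dis-id n)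
    where open NoDescents e asc
  ... | inj₁ (a , v , d) with exchange vws v (lo-lower a) (subst₂ _<_ (sym (rep _)) (sym (rep _)) d)
  exact-word zero len vws e rep av | inj₁ _ | us , vus , len′ , eq with () ← trans len′ len
  exact-word (suc m) {ws} len vws {w} e rep av | inj₁ (a , v , d) | us , vus , len′ , eq
    with exact-word m (ℕ.suc-injective (trans len′ len)) vus (element-∘ k adm v e)
      (λ x → trans (eq x) (rep (s a x))) (avoids-descend (e .commutes) v d av)
  ... | vs , vvs , rep′ , dis≡ = vs ++ a ∷ [] , All.++⁺ vvs (v ∷ []) , ev-snoc {w} {vs} v rep′ ,
    trans (pos-injective (lin
      (𝕒 ⊖ 𝕓 ≈ con (+ 2) ∷ 𝕓 ≈ 𝕔 ⊕ (𝕔 ⊕ con (+ 0)) ∷ []) (𝕒 ≈ 𝕔 ⊕ con (+ 1) ⊕ (𝕔 ⊕ con (+ 1) ⊕ con (+ 0)))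
      (+ dis n w ∷ + dis n (λ x → w (s a x)) ∷ + length vs ∷ [])
      (gain′ , cong +_ dis≡)))
      (cong (2 ℕ.*_) (sym (List.length-++ vs)))
    where
    cw = commutes-∘ (e .commutes) (s-commutes v)
    l = lo-lower a
    tight : w (hi a) ≤ lo k a × hi a ≤ w (lo k a)
    tight = subst₂ (λ x y → x ≤ lo k a × hi a ≤ y) (rep (hi a)) (rep (lo k a))
      (avoids⇒tight vws (av ∘ contains-cong rep) v l (subst₂ _<_ (sym (rep _)) (sym (rep _)) d))
    gain′ : + dis n w - + dis n (λ x → w (s a x)) ≡ + 2
    -- The tight step is the one back to `w` by the same letter; before it the values at the two
    -- ends are those of `w` exchanged.
    gain′ = trans (cong (λ d → + d - + dis n (λ x → w (s a x))) (dis-cong n λ x → cong w (sym (s-involutive v x))))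
      (Step.tight⇒gain≡2 cw v (subst (_≤ lo k a) (cong w (sym (s-lower v l))) (proj₁ tight))
        (subst (hi a ≤_) (cong w (sym (s-upper v l))) (proj₂ tight)))

  avoids⇒exact : ∀ {w} → IsElement k n w → Avoids w →
    ∃[ vs ] All V vs × (∀ x → ev vs x ≡ w x) × dis n w ≡ 2 ℕ.* length vs
  avoids⇒exact e av with find-word e
  ... | ws , vws , rep = exact-word (length ws) refl vws e rep av

  A⇒C : ∀ {w} → CondA k n w → Avoids w
  A⇒C {w} (_ , (ws , ((vws , rep) , _) , refl) , dis≡) c = exact⇒avoids [] ws [] vws identity-avoids
    (trans (dis-cong n rep) dis≡) (contains-cong (sym ∘ rep) c)

  C⇒A : ∀ {w} → IsElement k n w → Avoids w → CondA k n w
  C⇒A e av with avoids⇒exact e av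
  ... | vs , vvs , rep , dis≡ = length vs , (vs , ((vvs , rep) , least) , refl) , dis≡
    where
    least : ∀ us → Represents k n _ us → length vs ℕ.≤ length us
    least us (vus , rep′) = ℕ.*-cancelˡ-≤ 2
      (subst (ℕ._≤ 2 ℕ.* length us) (trans (dis-cong n rep′) dis≡) (dis-word vus))

  -- An exact word exists, and no word is shorter than half the disarray, so the shortest words are
  -- exact.
  reduced-exact : ∀ {w ws} → IsElement k n w → Avoids w → ReducedWord k n w ws → Exact ws
  reduced-exact {w} {ws} e av ((vws , rep) , least) with avoids⇒exact e av
  ... | vs , vvs , rep′ , dis≡ = ℕ.≤-antisym (dis-word vws)
    (subst (2 ℕ.* length ws ℕ.≤_) (trans (sym dis≡) (dis-cong n (sym ∘ rep)))
      (ℕ.*-monoʳ-≤ 2 (least vs (vvs , rep′))))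

  -- Between two tight applications of s_i the value at i has to return below i, and only s_{i-1}
  -- (besides s_i) changes it; likewise for i + 1 and s_{i+1}.
  module Between {i : ℕ} (i<n : suc i ℕ.< n) where
    x y : ℤ
    x = + suc i
    y = + suc (suc i)

    tight-at : ∀ us {vs} → All V (us ++ suc i ∷ vs) → Exact (us ++ suc i ∷ vs) → ev us x ≤ x × y ≤ ev us y
    tight-at us vws ex with exact-tight-at us vws ex
    ... | t rewrite lo-suc k i | gap-inner k i<n | ℕ.+-comm i 1 = t

    extend : ∀ us c {z} → s c z ≡ z → (P : ℤ → Set) → P (ev us z) → P (ev (us ++ c ∷ []) z)
    extend us c {z} fix P p = subst P (sym (trans (ev-++ us (c ∷ []) z) (cong (ev us) fix))) p

    low : ∀ m us vs → All V (us ++ m ++ suc i ∷ vs) → Exact (us ++ m ++ suc i ∷ vs) →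
      y ≤ ev us x → All (λ c → ¬ SameLetter k n c i) m → ⊥
    low [] us vs vws ex p _ = <⇒≱ (ℤ.+<+ ℕ.≤-refl) (≤-trans p (proj₁ (tight-at us vws ex)))
    low (c ∷ m) us vs vws ex p (¬s ∷ ¬ss) with same? k n c (suc i)
    -- A further copy of the letter inside `m` is itself a tight step and gives the contradiction
    -- earlier.
    ... | yes same with refl ← same-inner k i<n (s≤s z≤n) same =
      <⇒≱ (ℤ.+<+ ℕ.≤-refl) (≤-trans p (proj₁ (tight-at us vws ex)))
    ... | no ¬same = low m (us ++ c ∷ []) vs
      (subst (All V) (sym assoc) vws) (subst Exact (sym assoc) ex)
      (extend us c (fixed k adm vc (ℕ.<⇒≤ i<n) ¬same ¬s) (y ≤_) p) ¬ss
      where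
      assoc = List.++-assoc us (c ∷ []) (m ++ suc i ∷ vs)
      vc : V c
      vc with All.++⁻ʳ us vws
      ... | v ∷ _ = v

    high : ∀ m us vs → All V (us ++ m ++ suc i ∷ vs) → Exact (us ++ m ++ suc i ∷ vs) →
      ev us y ≤ x → All (λ c → ¬ SameLetter k n c (suc (suc i))) m → ⊥
    high [] us vs vws ex p _ = <⇒≱ (ℤ.+<+ ℕ.≤-refl) (≤-trans (proj₂ (tight-at us vws ex)) p)
    high (c ∷ m) us vs vws ex p (¬s ∷ ¬ss) with same? k n c (suc i)
    ... | yes same with refl ← same-inner k i<n (s≤s z≤n) same =
      <⇒≱ (ℤ.+<+ ℕ.≤-refl) (≤-trans (proj₂ (tight-at us vws ex)) p)
    ... | no ¬same = high m (us ++ c ∷ []) vs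
      (subst (All V) (sym assoc) vws) (subst Exact (sym assoc) ex)
      (extend us c (fixed k adm vc i<n ¬s ¬same) (_≤ x) p) ¬ss
      where
      assoc = List.++-assoc us (c ∷ []) (m ++ suc i ∷ vs)
      vc : V c
      vc with All.++⁻ʳ us vws
      ... | v ∷ _ = v

    between : ∀ us m vs → All V (us ++ suc i ∷ m ++ suc i ∷ vs) → Exact (us ++ suc i ∷ m ++ suc i ∷ vs) →
      Any (λ c → SameLetter k n c i) m × Any (λ c → SameLetter k n c (suc (suc i))) m
    between us m vs vws ex =
      find i (low m us′ vs (subst (All V) (sym assoc) vws) (subst Exact (sym assoc) ex)
        (subst (y ≤_) (sym (trans (ev-++ us (suc i ∷ []) x) (cong (ev us) swap))) (proj₂ tight))) ,
      find (suc (suc i)) (high m us′ vs (subst (All V) (sym assoc) vws) (subst Exact (sym assoc) ex)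
        (subst (_≤ x) (sym (trans (ev-++ us (suc i ∷ []) y) (cong (ev us) swap′))) (proj₁ tight)))
      where
      us′ = us ++ suc i ∷ []
      assoc = List.++-assoc us (suc i ∷ []) (m ++ suc i ∷ vs)
      tight = tight-at us vws ex
      vi : V (suc i)
      vi with All.++⁻ʳ us vws
      ... | v ∷ _ = v
      lx : L (suc i) x
      lx = subst (L (suc i)) (lo-suc k i) (lo-lower (suc i))
      x+g : x + g (suc i) ≡ y
      x+g = trans (cong (λ z → x + z) (gap-inner k i<n)) (cong +_ (ℕ.+-comm (suc i) 1))
      swap : s (suc i) x ≡ y
      swap = trans (s-lower vi lx) x+g
      swap′ : s (suc i) y ≡ x
      swap′ = trans (cong (s (suc i)) (sym x+g)) (s-upper vi lx)
      find : ∀ j → (All (λ c → ¬ SameLetter k n c j) m → ⊥) → Any (λ c → SameLetter k n c j) m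
      find j contra with any? (λ c → same? k n c j) m
      ... | yes a = a
      ... | no ¬a = ⊥-elim (contra (All.¬Any⇒All¬ m ¬a))

  inner-letter : ∀ {i} → suc i ℕ.≤ n ∸ 1 → suc i ℕ.< n
  inner-letter p = ℕ.≤-trans (s≤s p) (ℕ.≤-reflexive (ℕ.m+[n∸m]≡n (admissible⇒1≤n k adm)))

  C⇒B : ∀ {w} → IsElement k n w → Avoids w → CondB k n w
  C⇒B e av ws red@((vws , _) , _) (suc i) 1≤i i≤ us a m b vs refl same same′
    with refl ← same-inner k (inner-letter i≤) 1≤i same | refl ← same-inner k (inner-letter i≤) 1≤i same′ =
    Between.between (inner-letter i≤) us m vs vws (reduced-exact e av red)

-- Pattern avoidance and braids

-- Degeneracy matters here: in the affine symmetric group with `n = 2` the letters `0` and `2`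
-- coincide, and the word 1 0 1 meets the condition of (B) but not that of (B').
not-both-neighbours : ∀ k {n b i} → Nondegenerate k n → 1 ℕ.≤ i → i ℕ.≤ n ∸ 1 →
  SameLetter k n b (i ∸ 1) → SameLetter k n b (suc i) → ⊥
not-both-neighbours typeA {i = suc i} _ _ _ refl ()
not-both-neighbours typeB {i = suc i} _ _ _ refl ()
not-both-neighbours typeC̃ {i = suc i} _ _ _ refl ()
not-both-neighbours typeÃ {i = suc i} nd _ _ (inj₁ refl) (inj₁ ())
not-both-neighbours typeÃ {i = suc i} nd _ _ (inj₁ refl) (inj₂ (inj₁ (refl , refl))) = contradiction nd λ { (s≤s (s≤s ())) }
not-both-neighbours typeÃ {n} {i = suc i} nd _ i≤ (inj₂ (inj₁ (refl , refl))) _ =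
  contradiction (ℕ.≤-trans i≤ (ℕ.m∸n≤m i 1)) ℕ.1+n≰n
not-both-neighbours typeÃ {i = suc i} nd _ _ (inj₂ (inj₂ (refl , refl))) (inj₁ refl) = contradiction nd λ { (s≤s (s≤s ())) }
not-both-neighbours typeÃ {i = suc i} (s≤s _) _ _ (inj₂ (inj₂ (refl , _))) (inj₂ (inj₁ ()))

module Braids (k : Kind) (n : ℕ) (adm : Admissible k n) where
  open Avoidance k n adm public

  -- Not symmetric: (B') forbids a braid only if its outer letter lies in `[n-1]`, while the inner
  -- one may be `0` or `n`.
  BraidLetters : ℕ → ℕ → Set
  BraidLetters a b = ∃[ i ] 1 ℕ.≤ i × i ℕ.≤ n ∸ 1 × SameLetter k n a i ×
    (SameLetter k n b (suc i) ⊎ SameLetter k n b (i ∸ 1))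

  HasBraid : Word → Set
  HasBraid ws = ∃[ i ] 1 ℕ.≤ i × i ℕ.≤ n ∸ 1 × (∃[ p ] ∃[ a ] ∃[ b ] ∃[ c ] ∃[ q ]
    (ws ≡ p ++ a ∷ b ∷ c ∷ q × SameLetter k n a i × SameLetter k n c i ×
      (SameLetter k n b (suc i) ⊎ SameLetter k n b (i ∸ 1))))

  hasBraid-snoc : ∀ {ws} a → HasBraid ws → HasBraid (ws ++ a ∷ [])
  hasBraid-snoc e (i , 1≤i , i≤ , p , a , b , c , q , refl , rest) =
    i , 1≤i , i≤ , p , a , b , c , q ++ e ∷ [] , List.++-assoc p (a ∷ b ∷ c ∷ q) (e ∷ []) , rest

  B⇒B′ : ∀ {w} → Nondegenerate k n → CondB k n w → CondB' k n w
  B⇒B′ nd condB ws red i 1≤i i≤ (p , a , b , c , q , eq , same , same′ , _)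
    with condB ws red i 1≤i i≤ p a (b ∷ []) c q eq same same′
  ... | here s₁ , here s₂ = not-both-neighbours k nd 1≤i i≤ s₁ s₂

  moved-representative : ∀ {a y z} → V a → z ℕ.< n → (Tr k n (y - + suc z) ⊎ Rf k n (y + + suc z)) →
    s a y ≢ y → SameLetter k n a (suc z) ⊎ SameLetter k n a z
  moved-representative {a} {y} {z} v z<n rep moved with same? k n a (suc z) | same? k n a z
  ... | yes p | _     = inj₁ p
  ... | no _  | yes q = inj₂ q
  ... | no ¬p | no ¬q = contradiction (still′ rep) moved
    where
    fix : s a (+ suc z) ≡ + suc z
    fix = fixed k adm v z<n ¬p ¬q
    still′ : Tr k n (y - + suc z) ⊎ Rf k n (y + + suc z) → s a y ≡ y
    still′ (inj₁ t) = trans (cong (s a) y≡) (trans (s-commutes v .shift (+ suc z) t) (trans (cong (_+ (y - + suc z)) fix) (sym y≡)))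
      where
      y≡ : y ≡ + suc z + (y - + suc z)
      y≡ = lin [] (𝕒 ≈ 𝕓 ⊕ (𝕒 ⊖ 𝕓)) (y ∷ + suc z ∷ []) tt
    still′ (inj₂ r) = trans (cong (s a) y≡) (trans (s-commutes v .flip (+ suc z) r) (trans (cong (λ x → y + + suc z - x) fix) (sym y≡)))
      where
      y≡ : y ≡ y + + suc z - + suc z
      y≡ = lin [] (𝕒 ≈ 𝕒 ⊕ 𝕓 ⊖ 𝕓) (y ∷ + suc z ∷ []) tt

  -- The upper of two adjacent letters lies in `[n-1]` unless it is `n`, and then the lower one does
  -- if `2 ≤ n`. For `n = 1` a nondegenerate group has no two distinct valid letters.
  neighbours : ∀ {a b z} → Nondegenerate k n → V a → V b → z ℕ.< n → a ≢ b →
    SameLetter k n a (suc z) → SameLetter k n b z → BraidLetters a b ⊎ BraidLetters b a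
  neighbours {a} {b} {z} nd va vb z<n a≢b sa sb with ℕ.m≤n⇒m<n∨m≡n z<n
  ... | inj₁ sz<n = inj₁ (suc z , s≤s z≤n , ℕ.m+n≤o⇒m≤o∸n (suc z) (subst (ℕ._≤ n) (ℕ.+-comm 1 (suc z)) sz<n) , sa , inj₂ sb)
  ... | inj₂ refl with nondegenerate⇒2≤n k nd
  ...   | inj₁ (s≤s 1≤z) = inj₂ (z , 1≤z , ℕ.≤-refl , sb , inj₁ sa)
  ...   | inj₂ all0 = contradiction (trans (all0 a va) (sym (all0 b vb))) a≢b

  braid-letters : ∀ {a b y} → Nondegenerate k n → V a → V b → Unf y → s a y ≢ y → s b y ≢ y →
    s a y ≢ s b y → BraidLetters a b ⊎ BraidLetters b a
  braid-letters {a} {b} {y} nd va vb u ma mb diff with window-representative k adm u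
  ... | z , z<n , rep with moved-representative va z<n rep ma | moved-representative vb z<n rep mb
  ...   | inj₁ sa | inj₂ sb = neighbours nd va vb z<n (λ { refl → diff refl }) sa sb
  ...   | inj₂ sa | inj₁ sb = [ inj₂ , inj₁ ]′ (neighbours nd vb va z<n (λ { refl → diff refl }) sb sa)
  ...   | inj₁ sa | inj₁ sb = contradiction (same-gen k y sa sb) diff
  ...   | inj₂ sa | inj₂ sb = contradiction (same-gen k y sa sb) diff

  -- The pair consists of the last position with a value above `w y` and its successor. The bound on
  -- everything in between is what `reflected` later needs, in mirrored form, for the inner entries.
  last-above : ∀ {w : ℤ → ℤ} {x y} → Unf x → Unf y → x < y → w y < w x →
    ∃[ a ] ∃[ p ] V a × L a p × p + g a ≤ y × w y < w p × w (p + g a) ≤ w y ×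
      (∀ z → Unf z → p < z → z < y → w z ≤ w y)
  last-above {w} ux uy x<y d with chain P base step ux uy x<y
    where
    Found : ℤ → Set
    Found y = ∃[ a ] ∃[ p ] V a × L a p × p + g a ≤ y × w y < w p × w (p + g a) ≤ w y ×
      (∀ z → Unf z → p < z → z < y → w z ≤ w y)
    P : ℤ → ℤ → Set
    P x y = Found y ⊎ (∀ z → Unf z → x ≤ z → z < y → w z ≤ w y)
    base : ∀ {a x} → V a → L a x → P x (x + g a)
    base {a} {x} v l with w (x + g a) <? w x
    ... | yes d = inj₁ (a , x , v , l , ≤-refl , d , ≤-refl ,
      λ z uz x<z z<y → contradiction (lower-adjacent v l uz x<z) (<⇒≱ z<y))
    ... | no ¬d = inj₂ λ z uz x≤z z<y →
      subst (λ z → w z ≤ w (x + g a)) (≤-antisym x≤z (upper-adjacent v l uz z<y)) (≮⇒≥ ¬d)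
    step : ∀ {a x y} → V a → L a x → x + g a < y → Unf y → P (x + g a) y → P x y
    step v l _ _ (inj₁ found) = inj₁ found
    step {a} {x} {y} v l x+g<y uy (inj₂ bounded) with w y <? w x
    ... | yes d = inj₁ (a , x , v , l , <⇒≤ x+g<y , d , bounded _ (upper-unf v l) ≤-refl x+g<y ,
      λ z uz x<z → bounded z uz (lower-adjacent v l uz x<z))
    ... | no ¬d = inj₂ bounded′
      where
      bounded′ : ∀ z → Unf z → x ≤ z → z < y → w z ≤ w y
      bounded′ z uz x≤z z<y with x ≟ z
      ... | yes refl = ≮⇒≥ ¬d
      ... | no x≢z = bounded z uz (lower-adjacent v l uz (≤∧≢⇒< x≤z x≢z)) z<y
  ... | inj₁ found = found
  ... | inj₂ bounded = contradiction (bounded _ ux ≤-refl x<y) (<⇒≱ d)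

  -- The threshold `t` is kept apart from `w x` because the induction moves `x` while the bound
  -- stays at its original value.
  first-below : ∀ {w : ℤ → ℤ} {x y t} → Unf x → Unf y → x < y → t ≤ w x → w y < t →
    ∃[ a ] ∃[ q ] V a × L a q × x ≤ q × q + g a ≤ y × w (q + g a) < t × t ≤ w q ×
      (∀ z → Unf z → x ≤ z → z < q + g a → t ≤ w z)
  first-below {w} {t = t} ux uy x<y = chain P base step ux uy x<y
    where
    P : ℤ → ℤ → Set
    P x y = t ≤ w x → w y < t →
      ∃[ a ] ∃[ q ] V a × L a q × x ≤ q × q + g a ≤ y × w (q + g a) < t × t ≤ w q ×
        (∀ z → Unf z → x ≤ z → z < q + g a → t ≤ w z)
    at-x : ∀ {a x} → V a → L a x → t ≤ w x → ∀ z → Unf z → x ≤ z → z < x + g a → t ≤ w z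
    at-x v l t≤wx z uz x≤z z<x+g = subst (λ z → t ≤ w z) (≤-antisym x≤z (upper-adjacent v l uz z<x+g)) t≤wx
    base : ∀ {a x} → V a → L a x → P x (x + g a)
    base {a} {x} v l t≤wx below = a , x , v , l , ≤-refl , ≤-refl , below , t≤wx , at-x v l t≤wx
    step : ∀ {a x y} → V a → L a x → x + g a < y → Unf y → P (x + g a) y → P x y
    step {a} {x} {y} v l x+g<y uy rec t≤wx below with w (x + g a) <? t
    ... | yes d = a , x , v , l , ≤-refl , <⇒≤ x+g<y , d , t≤wx , at-x v l t≤wx
    ... | no ¬d with rec (≮⇒≥ ¬d) below
    ...   | b , q , vb , lq , x+g≤q , q+g≤y , d , t≤wq , all = b , q , vb , lq ,
      <⇒≤ (<-≤-trans (lower<upper a x) x+g≤q) , q+g≤y , d , t≤wq , all′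
      where
      all′ : ∀ z → Unf z → x ≤ z → z < q + g b → t ≤ w z
      all′ z uz x≤z z<q+g with x ≟ z
      ... | yes refl = t≤wx
      ... | no x≢z = all z uz (lower-adjacent v l uz (≤∧≢⇒< x≤z x≢z)) z<q+g

  -- `braid-free` speaks of all words of this length for the element, since a braid may show only
  -- after rearrangement. `minimal` is what a shortest counterexample provides: a descent that swaps
  -- neither neighbouring pair would carry the pattern to a shorter one.
  module Minimal (nd : Nondegenerate k n) {ws : Word} (vws : All V ws)
    (braid-free : ∀ vs → All V vs → length vs ≡ length ws → (∀ x → ev vs x ≡ ev ws x) → ¬ HasBraid vs)
    (minimal : ∀ {a p i j l} → V a → L a p → ev ws (p + g a) < ev ws p → Pattern (ev ws) i j l →
      s a i ≡ j ⊎ s a j ≡ l) where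

    w : ℤ → ℤ
    w = ev ws

    cw : Commutes k n w
    cw = ev-commutes vws

    -- Three successive descents `a`, `b`, `a` remove three letters by `exchange`, and putting them
    -- back yields a word of the old length that ends in a braid. Each descent may be witnessed at
    -- any pair of its orbit, hence the separate `p`, `q`, `r`.
    no-braid : ∀ {a b} → V a → V b → BraidLetters a b → ∀ {p q r} →
      L a p → w (p + g a) < w p → L b q → w (s a (q + g b)) < w (s a q) →
      L a r → w (s a (s b (r + g a))) < w (s a (s b r)) → ⊥
    no-braid {a} {b} va vb (i , 1≤i , i≤ , sa , sb) lp d₁ lq d₂ lr d₃
      with exchange vws va lp d₁
    ... | us₁ , v₁ , len₁ , eq₁
      with exchange v₁ vb lq (subst₂ _<_ (sym (eq₁ _)) (sym (eq₁ _)) d₂)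
    ... | us₂ , v₂ , len₂ , eq₂
      with exchange v₂ va lr (subst₂ _<_ (sym (trans (eq₂ _) (eq₁ _))) (sym (trans (eq₂ _) (eq₁ _))) d₃)
    ... | us₃ , v₃ , len₃ , eq₃ = braid-free (us₃ ++ a ∷ b ∷ a ∷ []) (All.++⁺ v₃ (va ∷ vb ∷ va ∷ []))
      (trans (List.length-++ us₃) (trans (ℕ.+-comm (length us₃) 3)
        (trans (cong (2 ℕ.+_) len₃) (trans (cong suc len₂) len₁))))
      same (i , 1≤i , i≤ , us₃ , a , b , a , [] , refl , sa , sa , sb)
      where
      same : ∀ x → ev (us₃ ++ a ∷ b ∷ a ∷ []) x ≡ w x
      same x = trans (ev-++ us₃ _ x) (trans (eq₃ _) (trans (eq₂ _) (trans (eq₁ _) (cong w (begin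
        s a (s b (s a (s a (s b (s a x))))) ≡⟨ cong (s a ∘ s b) (s-involutive va _) ⟩
        s a (s b (s b (s a x)))             ≡⟨ cong (s a) (s-involutive vb _) ⟩
        s a (s a x)                         ≡⟨ s-involutive va x ⟩
        x                                   ∎)))))
        where open ≡-Reasoning

    moved-up : ∀ {a x} → V a → L a x → s a x ≢ x
    moved-up {a} {x} v l eq = <⇒≢ (lower<upper a x) (sym (trans (sym (s-lower v l)) eq))

    moved-down : ∀ {a x} → V a → L a x → s a (x + g a) ≢ x + g a
    moved-down {a} {x} v l eq = <⇒≢ (lower<upper a x) (trans (sym (s-upper v l)) eq)

    odd-centre : ∀ {c x} → Rf k n c → c ≢ x + x + + 1
    odd-centre {c} {x} r eq with rf-even k r
    ... | e , c≡ , _ with e ≤? x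
    ...   | yes p = lin (𝕒 ≈ 𝕓 ⊕ 𝕓 ⊕ con (+ 1) ∷ 𝕒 ≈ 𝕔 ⊕ 𝕔 ∷ 𝕔 ≼ 𝕓 ∷ []) absurd (c ∷ x ∷ e ∷ []) (eq , c≡ , p)
    ...   | no ¬p = lin (𝕒 ≈ 𝕓 ⊕ 𝕓 ⊕ con (+ 1) ∷ 𝕒 ≈ 𝕔 ⊕ 𝕔 ∷ 𝕓 ≺ 𝕔 ∷ []) absurd (c ∷ x ∷ e ∷ []) (eq , c≡ , ≰⇒> ¬p)

    gap-inner-letter : ∀ {a i} → 1 ℕ.≤ i → i ℕ.≤ n ∸ 1 → SameLetter k n a i → g a ≡ + 1
    gap-inner-letter {i = suc i} 1≤i i≤ same
      with refl ← same-inner k (inner-letter i≤) 1≤i same = gap-inner k (inner-letter i≤)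

    -- The pairs (p , q) and (c - q , c - p) are exchanged by the same generator a. Minimality forces
    -- q and c - q to be adjacent, and then a reduced word may end in a b a.
    reflected : ∀ {a p c} → V a → L a p → Rf k n c →
      p + g a < c - (p + g a) → w (p + g a) < w p → c < w p + w (p + g a) →
      (∀ u → Unf u → p + g a < u → u < c - (p + g a) → w (p + g a) ≤ w u) → ⊥
    reflected {a} {p} {c} va lp r q<q′ Q<P c<P+Q within
      with successor k adm (upper-unf va lp) (rf-unf k r (upper-unf va lp)) q<q′
    ... | b , vb , lq with p + g a + g b ≟ c - (p + g a)
    -- An unfrozen `u` strictly inside would give the pattern `p`, `u`, `c - p`, and `a` swaps
    -- neither `p` with `u` nor `u` with `c - p`.
    ...   | no u≢q′ = [ (λ e → <⇒≢ q<u (trans (sym (s-lower va lp)) e))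
                     , (λ e → <⇒≢ u<q′ (trans (sym (s-involutive va u)) (trans (cong (s a) (trans e (sym q′+g))) (s-upper va lq′)))) ]′
        (minimal va lp Q<P (lower-unf va lp , uu , rf-unf k r (lower-unf va lp) ,
          <-trans (lower<upper a p) q<u , <-trans u<q′ q′<p′ ,
          lin (𝕒 ≼ 𝕔 ⊖ 𝕓 ∷ 𝕔 ≺ 𝕕 ⊕ 𝕒 ∷ []) (𝕓 ≺ 𝕕) (Q ∷ w u ∷ c ∷ P ∷ []) (subst (Q ≤_) (cw .flip u r) (within (c - u) (rf-unf k r uu)
            (lin (𝕒 ≺ 𝕔 ⊖ 𝕓 ∷ []) (𝕓 ≺ 𝕔 ⊖ 𝕒) (u ∷ q ∷ c ∷ []) u<q′) (lin (𝕓 ≺ 𝕒 ∷ []) (𝕔 ⊖ 𝕒 ≺ 𝕔 ⊖ 𝕓) (u ∷ q ∷ c ∷ []) q<u)) , c<P+Q) ,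
          subst (_< w u) (sym (cw .flip p r)) (lin (𝕒 ≼ 𝕓 ∷ 𝕔 ≺ 𝕕 ⊕ 𝕒 ∷ []) (𝕔 ⊖ 𝕕 ≺ 𝕓) (Q ∷ w u ∷ c ∷ P ∷ []) (within u uu q<u u<q′ , c<P+Q))))
      where
      q u P Q : ℤ
      q = p + g a
      u = q + g b
      P = w p
      Q = w q
      uu = upper-unf vb lq
      q<u = lower<upper b q
      u<q′ : u < c - q
      u<q′ = ≤∧≢⇒< (lower-adjacent vb lq (rf-unf k r (upper-unf va lp)) q<q′) u≢q′
      lq′ = orbit-flip lp r
      q′+g : c - q + g a ≡ c - p
      q′+g = lin [] (𝕒 ⊖ (𝕓 ⊕ 𝕔) ⊕ 𝕔 ≈ 𝕒 ⊖ 𝕓) (c ∷ p ∷ g a ∷ []) tt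
      q′<p′ : c - q < c - p
      q′<p′ = lin (𝕓 ≺ 𝕒 ∷ []) (𝕔 ⊖ 𝕒 ≺ 𝕔 ⊖ 𝕓) (q ∷ p ∷ c ∷ []) (lower<upper a p)
    ...   | yes q+g≡ with braid-letters nd va vb (upper-unf va lp) (moved-down va lp) (moved-up vb lq)
              (λ e → <⇒≢ (<-trans (lower<upper a p) (lower<upper b (p + g a))) (trans (sym (s-upper va lp)) (trans e (s-lower vb lq))))
    -- If `b` were the letter in `[n-1]`, its gap would be 1 and the reflection would be centred
    -- half way between two integers.
    ...     | inj₂ (i , 1≤i , i≤ , sb , _) = odd-centre {x = p + g a} r (lin
      (𝕒 ⊕ 𝕓 ≈ 𝕔 ⊖ 𝕒 ∷ 𝕓 ≈ con (+ 1) ∷ []) (𝕔 ≈ 𝕒 ⊕ 𝕒 ⊕ con (+ 1)) (p + g a ∷ g b ∷ c ∷ []) (q+g≡ , gap-inner-letter 1≤i i≤ sb))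
    ...     | inj₁ letters = no-braid va vb letters lp Q<P lq
      (subst₂ _<_ (sym (trans (cong w (trans (cong (s a) q+g≡) sq′)) (cw .flip p r))) (sym (cong w (s-upper va lp))) c-P<P)
      lp
      (subst₂ _<_ (sym (trans (cong (w ∘ s a) (trans (s-lower vb lq) q+g≡)) (trans (cong w sq′) (cw .flip p r))))
        (sym (cong w (trans (cong (s a) sbp) (s-lower va lp)))) c-P<Q)
      where
      q P Q : ℤ
      q = p + g a
      P = w p
      Q = w q
      c-P<P : c - P < P
      c-P<P = lin (𝕒 ≺ 𝕓 ∷ 𝕔 ≺ 𝕓 ⊕ 𝕒 ∷ []) (𝕔 ⊖ 𝕓 ≺ 𝕓) (Q ∷ P ∷ c ∷ []) (Q<P , c<P+Q)
      c-P<Q : c - P < Q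
      c-P<Q = lin (𝕔 ≺ 𝕓 ⊕ 𝕒 ∷ []) (𝕔 ⊖ 𝕓 ≺ 𝕒) (Q ∷ P ∷ c ∷ []) c<P+Q
      lq′ = orbit-flip lp r
      sq′ : s a (c - q) ≡ c - p
      sq′ = trans (s-lower va lq′) (lin [] (𝕒 ⊖ (𝕓 ⊕ 𝕔) ⊕ 𝕔 ≈ 𝕒 ⊖ 𝕓) (c ∷ p ∷ g a ∷ []) tt)
      sbp : s b p ≡ p
      sbp with moves b p
      ... | still _ _ eq = eq
      ... | up l _ = contradiction
        (subst (L b) (≤-antisym (lower-adjacent va lp (upper-unf vb l) (lower<upper b p))
          (lower-adjacent vb l (upper-unf va lp) (lower<upper a p))) lq)
        (lower-not-upper vb l)
      -- A pair of `b` ending at `p` would be related to the one at `q`. A translation by some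
      -- `t > 0` gives `c - Q = P + t`, against `c < P + Q`; a reflection gives `p + q = P + Q > c`,
      -- against `p < q < c - q`.
      ... | down y l p≡ _ with related cw l lq
      ...   | inj₁ (t , _ , y≡ , _ , eq) = ⊥-elim (lin
        (𝕒 ≈ 𝕓 ⊖ 𝕔 ∷ 𝕒 ≈ 𝕕 ⊕ 𝕖 ∷ 𝕗 ≈ 𝕘 ⊕ 𝕖 ∷ 𝕘 ≺ 𝕗 ∷ 𝕓 ≺ 𝕕 ⊕ 𝕔 ∷ []) absurd
        (w (q + g b) ∷ c ∷ Q ∷ P ∷ t ∷ q ∷ y ∷ [])
        ( trans (cong w q+g≡) (cw .flip q r) , trans eq (cong (λ z → w z + t) (sym p≡)) , y≡
        , <-trans (subst (y <_) (sym p≡) (lower<upper b y)) (lower<upper a p) , c<P+Q))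
      ...   | inj₂ (e , _ , q≡ , eq , _) = ⊥-elim (lin
        (𝕒 ≈ 𝕓 ⊖ 𝕔 ∷ 𝕕 ≈ 𝕓 ⊖ 𝕖 ∷ 𝕔 ≺ 𝕒 ∷ 𝕒 ≺ 𝕗 ⊖ 𝕒 ∷ 𝕗 ≺ 𝕖 ⊕ 𝕕 ∷ []) absurd
        (q ∷ e ∷ p ∷ Q ∷ P ∷ c ∷ [])
        ( trans q≡ (cong (λ z → e - z) (sym p≡)) , trans eq (cong (λ z → e - w z) (sym p≡))
        , lower<upper a p , q<q′ , c<P+Q))

    -- If one of the two generators also moves the outer entry of the triple, there is a reflected pair;
    -- otherwise both a b a and b a b end a word of the same length.
    consecutive : ∀ {a b x} → V a → V b → L a x → L b (x + g a) →
      w (x + g a) < w x → w (x + g a + g b) < w (x + g a) → ⊥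
    consecutive {a} {b} {x} va vb lx ly Y<X Z<Y with moves a (x + g a + g b) | moves b x
    -- A translation of the pair at `x` would give the third entry a value above `w x`, so the two
    -- pairs of `a` are mirror images.
    ... | up lz _ | _ with related cw lx lz
    ...   | inj₁ (c , _ , z≡ , eq , _) = lin
      (𝕒 ≈ 𝕓 ⊕ 𝕔 ∷ 𝕕 ≈ 𝕖 ⊕ 𝕔 ∷ 𝕓 ≺ 𝕒 ∷ 𝕕 ≺ 𝕖 ∷ []) absurd
      (x + g a + g b ∷ x ∷ c ∷ w (x + g a + g b) ∷ w x ∷ [])
      (z≡ , eq , <-trans (lower<upper a x) (lower<upper b (x + g a)) , <-trans Z<Y Y<X)
    ...   | inj₂ (c , r , z≡ , eq , _) = reflected va lx r
      (subst (x + g a <_) z≡ (lower<upper b (x + g a))) Y<X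
      (lin (𝕒 ≈ 𝕔 ⊖ 𝕓 ∷ 𝕒 ≺ 𝕓 ∷ 𝕓 ≺ 𝕕 ∷ []) (𝕔 ≺ 𝕕 ⊕ 𝕓) (w (x + g a + g b) ∷ w (x + g a) ∷ c ∷ w x ∷ []) (eq , Z<Y , Y<X))
      (λ u uu y<u u<z → contradiction (lower-adjacent vb ly uu y<u) (<⇒≱ (subst (u <_) (sym z≡) u<z)))
    consecutive {a} {b} {x} va vb lx ly Y<X Z<Y | down y₀ l z≡ _ | _ = contradiction
      (subst (L a) (≤-antisym
        (upper-adjacent vb ly (lower-unf va l) (subst (y₀ <_) (sym z≡) (lower<upper a y₀)))
        (upper-adjacent va l (lower-unf vb ly) (subst (x + g a <_) z≡ (lower<upper b (x + g a))))) l)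
      (lower-not-upper va lx)
    consecutive {a} {b} {x} va vb lx ly Y<X Z<Y | still _ _ _ | up l _ = contradiction
      (subst (L b) (≤-antisym (lower-adjacent va lx (upper-unf vb l) (lower<upper b x))
        (lower-adjacent vb l (upper-unf va lx) (lower<upper a x))) ly)
      (lower-not-upper vb l)
    consecutive {a} {b} {x} va vb lx ly Y<X Z<Y | still _ _ _ | down x₀ l x≡ _ with related cw l ly
    ... | inj₁ (c , _ , y≡ , _ , eq) = lin
      (𝕒 ≈ 𝕓 ⊕ 𝕔 ∷ 𝕕 ≈ 𝕖 ⊕ 𝕔 ∷ 𝕓 ≺ 𝕒 ∷ 𝕕 ≺ 𝕖 ∷ []) absurd
      (x + g a ∷ x₀ ∷ c ∷ w (x + g a + g b) ∷ w x ∷ [])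
      ( y≡ , trans eq (cong (λ v → w v + c) (sym x≡))
      , <-trans (subst (x₀ <_) (sym x≡) (lower<upper b x₀)) (lower<upper a x) , <-trans Z<Y Y<X)
    ... | inj₂ (c , r , y≡ , eq , eq′) = reflected vb l r
      (subst₂ _<_ x≡ y≡ (lower<upper a x))
      (subst (λ v → w v < w x₀) x≡
        (lin (𝕒 ≈ 𝕓 ⊖ 𝕔 ∷ 𝕕 ≈ 𝕓 ⊖ 𝕖 ∷ 𝕕 ≺ 𝕒 ∷ []) (𝕔 ≺ 𝕖) (w (x + g a) ∷ c ∷ w x ∷ w (x + g a + g b) ∷ w x₀ ∷ [])
          (Yeq , eq′ , Z<Y)))
      (subst (λ v → c < w x₀ + w v) x≡
        (lin (𝕕 ≈ 𝕓 ⊖ 𝕖 ∷ 𝕕 ≺ 𝕒 ∷ 𝕒 ≺ 𝕔 ∷ []) (𝕓 ≺ 𝕖 ⊕ 𝕔) (w (x + g a) ∷ c ∷ w x ∷ w (x + g a + g b) ∷ w x₀ ∷ [])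
          (eq′ , Z<Y , Y<X)))
      (λ u uu x<u u<y → contradiction (lower-adjacent va lx uu (subst (_< u) (sym x≡) x<u)) (<⇒≱ (subst (u <_) (sym y≡) u<y)))
      where
      Yeq : w (x + g a) ≡ c - w x
      Yeq = trans eq (cong (λ v → c - w v) (sym x≡))
    consecutive {a} {b} {x} va vb lx ly Y<X Z<Y | still _ _ saz | still _ _ sbx
      with braid-letters nd va vb (upper-unf va lx) (moved-down va lx) (moved-up vb ly)
        (λ e → <⇒≢ (<-trans (lower<upper a x) (lower<upper b (x + g a))) (trans (sym (s-upper va lx)) (trans e (s-lower vb ly))))
    ... | inj₁ letters = no-braid va vb letters lx Y<X ly
      (subst₂ _<_ (sym (cong w saz)) (sym (cong w (s-upper va lx))) (<-trans Z<Y Y<X))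
      lx
      (subst₂ _<_ (sym (cong w (trans (cong (s a) (s-lower vb ly)) saz)))
        (sym (cong w (trans (cong (s a) sbx) (s-lower va lx)))) Z<Y)
    ... | inj₂ letters = no-braid vb va letters ly Z<Y lx
      (subst₂ _<_ (sym (cong w (s-lower vb ly))) (sym (cong w sbx)) (<-trans Z<Y Y<X))
      ly
      (subst₂ _<_ (sym (cong w (trans (cong (s b) saz) (s-upper vb ly))))
        (sym (cong w (trans (cong (s b) (s-upper va lx)) sbx))) Y<X)

    no-pattern : ∀ {i j l} → ¬ Pattern w i j l
    no-pattern {i} {j} {l} (ui , uj , ul , i<j , j<l , wj<wi , wl<wj) with last-above {w} ui uj i<j wj<wi
    ... | a , p , va , lp , q≤j , wj<wp , wq≤wj , before
      with minimal va lp (≤-<-trans wq≤wj wj<wp)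
        (lower-unf va lp , uj , ul , <-≤-trans (lower<upper a p) q≤j , j<l , wj<wp , wl<wj)
    -- One generator swaps the pair at `p` and the pair `j`, `l`. A translation would make the value
    -- grow from `p` to `j`, so they are mirror images.
    ...   | inj₂ sj≡l with swap-up j<l sj≡l
    ...     | lj , refl with related cw lp lj
    ...       | inj₁ (c , _ , j≡ , eq , _) = lin
      (𝕒 ≈ 𝕓 ⊕ 𝕔 ∷ 𝕕 ≈ 𝕖 ⊕ 𝕔 ∷ 𝕓 ≺ 𝕒 ∷ 𝕕 ≺ 𝕖 ∷ []) absurd (j ∷ p ∷ c ∷ w j ∷ w p ∷ [])
      (j≡ , eq , <-≤-trans (lower<upper a p) q≤j , wj<wp)
    ...       | inj₂ (c , r , j≡ , eq , eq′) = reflected va lp r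
      (subst (p + g a <_) j≡ (≤∧≢⇒< q≤j λ { refl → lower-not-upper va lp lj }))
      (≤-<-trans wq≤wj wj<wp)
      (lin (𝕒 ≈ 𝕓 ⊖ 𝕔 ∷ 𝕒 ≺ 𝕕 ∷ []) (𝕓 ≺ 𝕕 ⊕ 𝕔) (w j ∷ c ∷ w (p + g a) ∷ w p ∷ []) (eq , wj<wp))
      λ u uu q<u u<q′ → lin (𝕒 ≈ 𝕓 ⊖ 𝕔 ∷ 𝕕 ≈ 𝕓 ⊖ 𝕖 ∷ 𝕕 ≼ 𝕒 ∷ []) (𝕔 ≼ 𝕖)
        (w j ∷ c ∷ w (p + g a) ∷ w (c - u) ∷ w u ∷ [])
        ( eq , cw .flip u r
        , before (c - u) (rf-unf k r uu)
            (<-trans (lower<upper a p) (lin (𝕒 ≺ 𝕔 ⊖ 𝕓 ∷ []) (𝕓 ≺ 𝕔 ⊖ 𝕒) (u ∷ p + g a ∷ c ∷ []) u<q′))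
            (subst (c - u <_) (sym j≡) (lin (𝕓 ≺ 𝕒 ∷ []) (𝕔 ⊖ 𝕒 ≺ 𝕔 ⊖ 𝕓) (u ∷ p + g a ∷ c ∷ []) q<u)) )
    no-pattern {i} {j} {l} (ui , uj , ul , i<j , j<l , wj<wi , wl<wj)
        | a , p , va , lp , q≤j , wj<wp , wq≤wj , before | inj₁ sp≡j
      with refl ← trans (sym (s-lower va lp)) sp≡j
      with first-below {w} uj ul j<l ≤-refl wl<wj
    ... | b , q , vb , lq , j≤q , q+g≤l , wr<wj , wj≤wq , after
      -- Now `j` is `p + g a`, and the upper end of the pair at `q` takes the place of `l`.
      with minimal vb lq (<-≤-trans wr<wj wj≤wq)
        (lower-unf va lp , uj , upper-unf vb lq , lower<upper a p , ≤-<-trans j≤q (lower<upper b q) , wj<wp , wr<wj)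
    ...   | inj₂ sj≡r with swap-up (≤-<-trans j≤q (lower<upper b q)) sj≡r
    ...     | lj , r≡ = consecutive va vb lp lj wj<wp (subst (λ z → w z < w (p + g a)) r≡ wr<wj)
    no-pattern {i} {j} {l} (ui , uj , ul , i<j , j<l , wj<wi , wl<wj)
        | a , p , va , lp , q≤j , wj<wp , wq≤wj , before | inj₁ sp≡j
        | b , q , vb , lq , j≤q , q+g≤l , wr<wj , wj≤wq , after | inj₁ sp≡j′
      with swap-up (lower<upper a p) sp≡j′
    ... | lp′ , j≡ with related cw lp′ lq
    ...   | inj₁ (c , _ , q≡ , _ , eq) = lin
      (𝕒 ≈ 𝕓 ⊕ 𝕔 ∷ 𝕕 ≈ 𝕖 ⊕ 𝕔 ∷ 𝕓 ≺ 𝕒 ∷ 𝕕 ≺ 𝕖 ∷ []) absurd (q ∷ p ∷ c ∷ w (q + g b) ∷ w (p + g a) ∷ [])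
      (q≡ , trans eq (cong (λ z → w z + c) (sym j≡)) , <-≤-trans (lower<upper a p) j≤q , wr<wj)
    ...   | inj₂ (c , r , q≡ , eq , eq′) = reflected vb lp′ r
      (subst₂ _<_ j≡ q≡ (≤∧≢⇒< j≤q λ { refl → lower-not-upper vb lp′ (subst (L b) j≡ lq) }))
      (subst (λ z → w z < w p) j≡ wj<wp)
      (subst (λ z → c < w p + w z) j≡ (lin (𝕒 ≈ 𝕓 ⊖ 𝕔 ∷ 𝕒 ≺ 𝕕 ∷ []) (𝕓 ≺ 𝕔 ⊕ 𝕕) (w (q + g b) ∷ c ∷ w p ∷ w (p + g a) ∷ []) (eq′ , wr<wj)))
      λ u uu q<u u<q′ → subst (λ z → w z ≤ w u) j≡ (after u uu (<⇒≤ (subst (_< u) (sym j≡) q<u))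
        (<-trans (subst (u <_) (sym q≡) u<q′) (lower<upper b q)))

  -- Freeness from braids passes to the word shortened at a descent `a`: appending `a` to a word for
  -- the shorter element gives a word for `ev ws` of the right length, with the same braids.
  braid-free⇒avoids : Nondegenerate k n → ∀ m {ws} → length ws ≡ m → All V ws →
    (∀ vs → All V vs → length vs ≡ length ws → (∀ x → ev vs x ≡ ev ws x) → ¬ HasBraid vs) → Avoids (ev ws)
  braid-free⇒avoids nd m {ws} len vws free (i , j , l , pat) =
    Minimal.no-pattern nd vws free (minimal m len) pat
    where
    minimal : ∀ m → length ws ≡ m → ∀ {a p i j l} → V a → L a p → ev ws (p + g a) < ev ws p → Pattern (ev ws) i j l →
      s a i ≡ j ⊎ s a j ≡ l
    minimal m len {a} {p} {i} {j} {l} va lp d pat with s a i ≟ j | s a j ≟ l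
    ... | yes e | _     = inj₁ e
    ... | no _  | yes e = inj₂ e
    ... | no i↛j | no j↛l with exchange vws va lp d
    minimal zero len va lp d pat | no i↛j | no j↛l | us , vus , len′ , eq with () ← trans len′ len
    minimal (suc m) len {a} {p} {i} {j} {l} va lp d pat | no i↛j | no j↛l | us , vus , len′ , eq = ⊥-elim
      (braid-free⇒avoids nd m (ℕ.suc-injective (trans len′ len)) vus free′
        (contains-cong (sym ∘ eq) (s a i , s a j , s a l , pattern-move {ev ws} va pat i↛j j↛l)))
      where
      free′ : ∀ vs → All V vs → length vs ≡ length us → (∀ x → ev vs x ≡ ev us x) → ¬ HasBraid vs
      free′ vs vvs len″ eq″ braid = free (vs ++ a ∷ []) (All.++⁺ vvs (va ∷ []))
        (trans (List.length-++ vs) (trans (ℕ.+-comm (length vs) 1) (trans (cong suc len″) len′)))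
        (ev-snoc {ev ws} {vs} va λ x → trans (eq″ x) (eq x))
        (hasBraid-snoc a braid)

  -- Whether a shorter word exists is not decided here, so only the double negation is stated.
  ¬¬reduced : ∀ m {w ws} → length ws ℕ.≤ m → Represents k n w ws → (∀ us → ¬ ReducedWord k n w us) → ⊥
  ¬¬reduced m {ws = ws} len rep none = none ws (rep , λ vs rep′ → ℕ.≮⇒≥ λ shorter → shorten m len vs rep′ shorter)
    where
    shorten : ∀ m → length ws ℕ.≤ m → ∀ vs → Represents k n _ vs → length vs ℕ.< length ws → ⊥
    shorten zero len vs rep′ shorter = contradiction (ℕ.<-≤-trans shorter len) λ ()
    shorten (suc m) len vs rep′ shorter = ¬¬reduced m (ℕ.≤-pred (ℕ.<-≤-trans shorter len)) rep′ none

  B′⇒C : ∀ {w} → Nondegenerate k n → IsElement k n w → CondB' k n w → Avoids w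
  B′⇒C nd e b′ c with find-word e
  -- Avoidance is a negation, so it is enough that a reduced word cannot fail to exist.
  ... | ws , vws , rep = ¬¬reduced (length ws) ℕ.≤-refl (vws , rep) λ us ((vus , rep′) , least) →
    braid-free⇒avoids nd (length us) refl vus
      (λ vs vvs len eq (i , 1≤i , i≤ , braid) → b′ vs ((vvs , λ x → trans (eq x) (rep′ x)) ,
        λ vs′ r → subst (ℕ._≤ length vs′) (sym len) (least vs′ r)) i 1≤i i≤ braid)
      (contains-cong (sym ∘ rep′) c)

  degenerate-avoids : ∀ {w} → TwoCongruent k n → IsElement k n w → Avoids w
  degenerate-avoids {w} two e (i , j , l , ui , uj , ul , i<j , j<l , p , q) =
    [ increasing i<j p , [ increasing j<l q , increasing (<-trans i<j j<l) (<-trans q p) ]′ ]′ (two i j l ui uj ul)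
    where
    increasing : ∀ {x y} → x < y → w y < w x → ¬ Tr k n (y - x)
    increasing {x} {y} x<y d t = lin (𝕔 ≈ 𝕕 ⊕ (𝕓 ⊖ 𝕒) ∷ 𝕒 ≺ 𝕓 ∷ 𝕔 ≺ 𝕕 ∷ []) absurd (x ∷ y ∷ w y ∷ w x ∷ [])
      (trans (cong w (lin [] (𝕓 ≈ 𝕒 ⊕ (𝕓 ⊖ 𝕒)) (x ∷ y ∷ []) tt)) (e .commutes .shift x t) , x<y , d)

theorem1p2 : (k : Kind) (n : ℕ) → Admissible k n →
    (w : ℤ → ℤ) → InW k n w →
    (CondA k n w ⇔ Avoids321 k n w) ×
    (CondB k n w ⇔ Avoids321 k n w) ×
    (Nondegenerate k n → (CondB' k n w ⇔ Avoids321 k n w))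
theorem1p2 k n adm w w∈W =
  mk⇔ A⇒C (C⇒A e) , mk⇔ B⇒C (C⇒B e) , λ nd → mk⇔ (B′⇒C nd e) (B⇒B′ nd ∘ C⇒B e)
  where
  open Braids k n adm
  e : IsElement k n w
  e = InW⇒IsElement k w∈W
  B⇒C : CondB k n w → Avoids w
  B⇒C condB = [ (λ nd → B′⇒C nd e (B⇒B′ nd condB)) , (λ two → degenerate-avoids two e) ]′ (degenerate k adm)
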